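{- Let $n$ be a positive integer and write $2n+3=3^{\beta}n_1$ with $n_1$ a positive integer and $3\nmid n_1$. Then $$t(1,2,3,6;n)=2(3^{\beta+1}-2)\sigma(n_1)-2a(2n+3).$$
   Context: $\sigma(n)=\sum_{d\mid n,\,d\ge1}d$. The integers $a(n)$ ($n\ge1$) are defined by $q\prod_{k=1}^{\infty}(1-q^{2k})(1-q^{4k})(1-q^{6k})(1-q^{12k})=\sum_{n=1}^{\infty}a(n)q^n$ for $|q|<1$. For positive integers $a,b,c,d$ and a nonnegative integer $n$, $t(a,b,c,d;n)$ denotes the number of $(x,y,z,w)\in\mathbb Z^4$ with $n=a\frac{x(x-1)}2+b\frac{y(y-1)}2+c\frac{z(z-1)}2+d\frac{w(w-1)}2$. -}

module Defs where

open import Data.Nat as ℕ using (ℕ; zero; suc)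
open import Data.Nat.Divisibility using (_∣?_)
open import Data.Integer as ℤ using (ℤ; +_; _-_)
open import Data.List using (List; filter; upTo; map; length)
open import Data.Nat.ListAction using (sum)
open import Data.Bool using (true; false)
open import Data.Product using (_×_; Σ-syntax)
open import Data.List.Membership.Propositional using (_∈_)
open import Data.List.Relation.Unary.Unique.Propositional using (Unique)
open import Relation.Binary.PropositionalEquality using (_≡_)
open import Function.Bundles using (_⇔_)

σ : ℕ → ℕ
σ n = sum (filter (_∣? n) (map suc (upTo n)))

Series : Set
Series = ℕ → ℤ

_⊛_ : Series → Series → Series
(f ⊛ g) n = go n
  where
  go : ℕ → ℤ
  go zero = f zero ℤ.* g n
  go (suc i) = go i ℤ.+ f (suc i) ℤ.* g (n ℕ.∸ suc i)

one : Series
one zero = + 1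
one (suc _) = + 0

-- the series 1 - q^m  (m ≥ 1)
oneMinusQ^ : ℕ → Series
oneMinusQ^ m zero = + 1
oneMinusQ^ m (suc j) with suc j ℕ.≡ᵇ m
... | true = ℤ.- (+ 1)
... | false = + 0

-- ∏_{k=1}^{N} (1-q^{2k})(1-q^{4k})(1-q^{6k})(1-q^{12k})
-- (for m,k ≥ 1 with m*k > N the factor is ≡ 1 mod q^{N+1}, so this
--  truncation has the correct coefficients in degrees ≤ N)
P : ℕ → Series
P zero = one
P (suc k) = P k ⊛ (oneMinusQ^ (2 ℕ.* suc k) ⊛ (oneMinusQ^ (4 ℕ.* suc k)
             ⊛ (oneMinusQ^ (6 ℕ.* suc k) ⊛ oneMinusQ^ (12 ℕ.* suc k))))

-- a(n) = coefficient of q^n in q ∏_{k≥1} (1-q^{2k})(1-q^{4k})(1-q^{6k})(1-q^{12k})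
a : ℕ → ℤ
a zero = + 0
a (suc m) = P m m

-- x(x-1)/2 (exact division; x(x-1) is always even)
tri : ℤ → ℤ
tri x = (x ℤ.* (x - + 1)) ℤ./ + 2

ℤ⁴ : Set
ℤ⁴ = ℤ × ℤ × ℤ × ℤ

IsRep : ℕ → ℕ → ℕ → ℕ → ℕ → ℤ⁴ → Set
IsRep a b c d n (x Data.Product., y Data.Product., z Data.Product., w) =
  + n ≡ + a ℤ.* tri x ℤ.+ + b ℤ.* tri y ℤ.+ + c ℤ.* tri z ℤ.+ + d ℤ.* tri w

tIs : ℕ → ℕ → ℕ → ℕ → ℕ → ℕ → Set
tIs a b c d n k = Σ[ L ∈ List ℤ⁴ ] (Unique L × (∀ v → (v ∈ L) ⇔ IsRep a b c d n v) × length L ≡ k)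

{-# OPTIONS --safe #-}
module Submission where

-- Write ψ(q) = Σ q^(n(n+1)/2) over n ≥ 0 and φ(q) = Σ q^(n²) over n ∈ ℤ. Zagier's involution on
-- the solutions of x² + 4yz = N yields convolution recurrences for divisor sums. They determine the
-- logarithmic derivatives of ψ(q) and φ(-q), so that the product q ∏ (1 - q^2k)(1 - q^4k)(1 - q^6k)(1 - q^12k)
-- equals q ψ(q²) ψ(q⁶) φ(-q²) φ(-q⁶), and they give Legendre's theorem ψ(q)⁴ = Σ σ(2m+1) q^m.
-- Let a(q) = Σ q^(u² + uv + v²). The 3-dissection of ψ turns Legendre's theorem into
-- 4 ψ(q) ψ(q³) a(q) = Σ (σ(6m+3) + 15 σ((2m+1)/3)) q^m. Splitting the hexagonal lattice by the
-- parity of v gives a(q) = φ(-q) φ(-q³) + 8 q ψ(q²) ψ(q⁶), and multiplying this by ψ(q) ψ(q³)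
-- compares the three quantities of the theorem.

open import Defs
open import Data.Nat using (ℕ; suc; _^_)
open import Data.Nat.Divisibility using (_∣_)
open import Data.Integer using (+_; _-_; _*_)
open import Data.Product using (Σ-syntax; _×_)
open import Relation.Binary.PropositionalEquality using (_≡_)
open import Relation.Nullary using (¬_)

open import Algebra.Bundles using (CommutativeSemiring)
import Algebra.Solver.Ring.NaturalCoefficients.Default
open import Algebra.Structures.Biased using (isCommutativeSemiringˡ)
open import Data.Bool using (Bool; true; false)
open import Data.Empty using (⊥-elim)
open import Data.Integer as ℤ using (ℤ; -[1+_]; _+_; -_; ∣_∣)
open import Data.Integer.DivMod using (_/ℕ_; _%ℕ_; a≡a%ℕn+[a/ℕn]*n; n%ℕd<d; div-pos-is-/ℕ)
import Data.Integer.Properties as ℤ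
open import Data.Integer.Tactic.RingSolver using (solve; solve-∀)
open import Data.List using (List; []; _∷_; map; _++_; concatMap; filter; upTo; length)
open import Data.List.Membership.Propositional using (_∈_)
open import Data.List.Membership.Propositional.Properties
  using (∈-map⁺; ∈-map⁻; ∈-++⁺ˡ; ∈-++⁺ʳ; ∈-++⁻; ∈-filter⁺; ∈-filter⁻; ∈-upTo⁺; ∈-upTo⁻)
open import Data.List.Membership.Propositional.Properties.WithK using (unique∧set⇒bag)
open import Data.List.Properties using (upTo-∷ʳ)
open import Data.List.Relation.Binary.BagAndSetEquality using (∼bag⇒↭)
open import Data.List.Relation.Binary.Permutation.Propositional as Perm using (_↭_)
open import Data.List.Relation.Unary.All as All using (All)
open import Data.List.Relation.Unary.AllPairs as AllPairs using (AllPairs)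
open import Data.List.Relation.Unary.Any using (here; there)
open import Data.List.Relation.Unary.Unique.Propositional using (Unique)
open import Data.List.Relation.Unary.Unique.Propositional.Properties
  using (++⁺; map⁺; upTo⁺; filter⁺)
open import Data.Nat as ℕ using (zero; z≤n; s≤s)
open import Data.Nat.Divisibility using (divides; _∣?_; ∣m⇒∣m*n; m∣m*n)
import Data.Nat.DivMod as ℕ
open import Data.Nat.ListAction using (sum)
open import Data.Nat.Primality using (Prime; prime?; euclidsLemma)
import Data.Nat.Properties as ℕ
import Data.Nat.Tactic.RingSolver as ℕ-Solver
open import Data.Product using (_,_; proj₁; proj₂; ∃)
open import Data.Sum using (_⊎_; inj₁; inj₂)
open import Data.Unit using (⊤; tt)
open import Function using (_∘_; id; _$_)
open import Function.Bundles using (mk⇔)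
open import Level using (0ℓ)
open import Relation.Binary.PropositionalEquality
  using (_≢_; refl; sym; trans; cong; cong₂; subst; subst₂; module ≡-Reasoning)
open import Relation.Binary.Structures using (IsEquivalence)
open import Relation.Nullary using (Dec; yes; no; ¬?)
open import Relation.Nullary.Decidable using (toWitness)
open import Relation.Unary using (Decidable)

-- The obstacle is to identify an infinite product with theta functions when coefficient sequences
-- offer neither limits nor division. A series is therefore pinned down by its constant term and a
-- relation `D f ≈ f ⊛ α` with `D` = q d/dq. For the product and for the theta functions alike, `α`
-- is a divisor sum, so the two sides are compared degree by degree, with no appeal to the Jacobi
-- triple product. For the theta functions the relation comes from weighted sums over x² + 4yz = N:
-- everything cancels away from z + x = y, and on z + x = y one has N = (2y - x)². Taking N = 8n + 1
-- leaves the triangular n, taking N = 4n leaves the squares, and taking N = 8n + 5 leaves nothing,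
-- which is the recurrence behind Legendre's theorem. Theta sums run over ℤ, where every triangular
-- number occurs twice; this is the origin of the powers of 2 among the constants.

private variable
  A B : Set
  X Y Z : A → Set

-- Finite sums

infix 7 _*[_]
_*[_] : ∀ {a b : ℤ} (c : ℤ) → a ≡ b → c * (a - b) ≡ + 0
_*[_] {a} c refl = trans (cong (c *_) (ℤ.i≡j⇒i-j≡0 {a} refl)) (ℤ.*-zeroʳ c)

infixr 6 _⊕_
_⊕_ : ∀ {a b : ℤ} → a ≡ + 0 → b ≡ + 0 → a + b ≡ + 0
refl ⊕ refl = refl

-- Certificates for linear arithmetic: `c *[ e ]` and `⊕` assemble a combination of hypotheses that
-- is zero, and the ring solver checks that the two sides of the goal differ by exactly this
-- combination.
linear : ∀ {d a b} → d ≡ + 0 → a - b ≡ d → a ≡ b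
linear {d} {a} {b} d≡0 e = ℤ.i-j≡0⇒i≡j a b (trans e d≡0)

halve : ∀ {a b : ℤ} → + 2 * a ≡ + 2 * b → a ≡ b
halve {a} {b} = ℤ.*-cancelˡ-≡ (+ 2) a b

+-cancel : ∀ x y {u v : ℤ} → x + u ≡ y + v → u ≡ v → x ≡ y
+-cancel x y {u} {v} e e′ = linear (+ 1 *[ e ] ⊕ (- + 1) *[ e′ ]) (solve (x ∷ y ∷ u ∷ v ∷ []))

sumL : List A → (A → ℤ) → ℤ
sumL [] w = + 0
sumL (x ∷ xs) w = w x + sumL xs w

sumL-cong : ∀ (xs : List A) {v w} → (∀ {a} → a ∈ xs → v a ≡ w a) → sumL xs v ≡ sumL xs w
sumL-cong [] e = refl
sumL-cong (x ∷ xs) e = cong₂ _+_ (e (here refl)) (sumL-cong xs (e ∘ there))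

sumL-++ : ∀ (xs ys : List A) w → sumL (xs ++ ys) w ≡ sumL xs w + sumL ys w
sumL-++ [] ys w = sym (ℤ.+-identityˡ _)
sumL-++ (x ∷ xs) ys w = trans (cong (ℤ._+_ (w x)) (sumL-++ xs ys w))
    (sym (ℤ.+-assoc (w x) (sumL xs w) (sumL ys w)))

sumL-map : ∀ (f : A → B) xs w → sumL (map f xs) w ≡ sumL xs (w ∘ f)
sumL-map f [] w = refl
sumL-map f (x ∷ xs) w = cong (ℤ._+_ (w (f x))) (sumL-map f xs w)

sumL-concatMap : ∀ (f : A → List B) xs w →
  sumL (concatMap f xs) w ≡ sumL xs (λ a → sumL (f a) w)
sumL-concatMap f [] w = refl
sumL-concatMap f (x ∷ xs) w =
  trans (sumL-++ (f x) _ w) (cong (ℤ._+_ (sumL (f x) w)) (sumL-concatMap f xs w))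

sumL-↭ : ∀ {xs ys : List A} w → xs ↭ ys → sumL xs w ≡ sumL ys w
sumL-↭ w Perm.refl = refl
sumL-↭ w (Perm.prep x p) = cong (ℤ._+_ (w x)) (sumL-↭ w p)
sumL-↭ w (Perm.swap {xs} {ys} x y p) rewrite sumL-↭ w p = swap (w x) (w y) (sumL ys w)
  where
  swap : ∀ a b c → a + (b + c) ≡ b + (a + c)
  swap = solve-∀
sumL-↭ w (Perm.trans p q) = trans (sumL-↭ w p) (sumL-↭ w q)

sumL-+ : ∀ (xs : List A) v w → sumL xs v + sumL xs w ≡ sumL xs (λ a → v a + w a)
sumL-+ [] v w = refl
sumL-+ (x ∷ xs) v w =
  trans (shuffle (v x) (sumL xs v) (w x) (sumL xs w)) (cong (ℤ._+_ (v x + w x)) (sumL-+ xs v w))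
  where
  shuffle : ∀ a b c d → (a + b) + (c + d) ≡ (a + c) + (b + d)
  shuffle = solve-∀

sumL-* : ∀ (xs : List A) c w → c * sumL xs w ≡ sumL xs (λ a → c * w a)
sumL-* [] c w = ℤ.*-zeroʳ c
sumL-* (x ∷ xs) c w = trans (ℤ.*-distribˡ-+ c (w x) (sumL xs w)) (cong (ℤ._+_ (c * w x)) (sumL-* xs c w))

sumL-filter : ∀ (Z? : Decidable Z) (xs : List A) w →
  sumL xs w ≡ sumL (filter Z? xs) w + sumL (filter (¬? ∘ Z?) xs) w
sumL-filter Z? [] w = refl
sumL-filter Z? (x ∷ xs) w with Z? x
... | yes _ = trans (cong (ℤ._+_ (w x)) (sumL-filter Z? xs w))
    (sym (ℤ.+-assoc (w x) (sumL (filter Z? xs) w) (sumL (filter (¬? ∘ Z?) xs) w)))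
... | no _ = trans (cong (ℤ._+_ (w x)) (sumL-filter Z? xs w))
    (swap (w x) (sumL (filter Z? xs) w) (sumL (filter (¬? ∘ Z?) xs) w))
  where
  swap : ∀ a b c → a + (b + c) ≡ b + (a + c)
  swap = solve-∀

-- Enumerable predicates

record Enum {A : Set} (X : A → Set) : Set where
  constructor enum
  field
    list : List A
    unique : Unique list
    sound : ∀ {a} → a ∈ list → X a
    complete : ∀ {a} → X a → a ∈ list

open Enum

opaque
  -- Opaque, so that sums are compared through their arguments and enumerations are unfolded only
  -- where a lemma asks for it.
  ∑ : {A : Set} {X : A → Set} → Enum X → (A → ℤ) → ℤ
  ∑ E = sumL (list E)

card : Enum X → ℤ
card E = ∑ E (λ _ → + 1)

opaque
  unfolding ∑

  card-length : ∀ (E : Enum X) → + length (list E) ≡ card E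
  card-length E = go (list E)
    where
    go : (xs : List A) → + length xs ≡ sumL xs (λ _ → + 1)
    go [] = refl
    go (x ∷ xs) = cong (ℤ._+_ (+ 1)) (go xs)

module _ (f : A → B) where

  map-unique : (∀ {x y} → X x → X y → f x ≡ f y → x ≡ y) →
    ∀ {xs} → All X xs → Unique xs → Unique (map f xs)
  map-unique inj All.[] AllPairs.[] = AllPairs.[]
  map-unique {X = X} inj (px All.∷ pxs) (x∉ AllPairs.∷ u) =
    distinct pxs x∉ AllPairs.∷ map-unique inj pxs u
    where
    distinct : ∀ {ys} → All X ys → All (_ ≢_) ys → All (f _ ≢_) (map f ys)
    distinct All.[] All.[] = All.[]
    distinct (py All.∷ pys) (≢ All.∷ ≢s) = (≢ ∘ inj px py) All.∷ distinct pys ≢s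

-- The maps are total on the ambient types but the inverse laws are demanded only on the predicates,
-- so that values such as predecessors of nonpositive integers need no care.
record _≅_ {A B : Set} (X : A → Set) (Y : B → Set) : Set where
  field
    to : A → B
    from : B → A
    to-⊆ : ∀ {a} → X a → Y (to a)
    from-⊆ : ∀ {b} → Y b → X (from b)
    from-to : ∀ {a} → X a → from (to a) ≡ a
    to-from : ∀ {b} → Y b → to (from b) ≡ b

open _≅_

transport : X ≅ Y → Enum X → Enum Y
transport i E .list = map (to i) (list E)
transport i E .unique = map-unique (to i)
  (λ px py e → trans (sym (from-to i px)) (trans (cong (from i) e) (from-to i py)))
  (All.tabulate (sound E)) (unique E)
transport i E .sound m with ∈-map⁻ (to i) m
... | a , a∈ , refl = to-⊆ i (sound E a∈)
transport i E .complete {b} q =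
  subst (_∈ map (to i) (list E)) (to-from i q) (∈-map⁺ (to i) (complete E (from-⊆ i q)))

opaque
  unfolding ∑

  -- Duplicate-free lists with the same members are permutations of each other. Hence a sum depends
  -- only on the predicate, and bijections need not respect any order.
  ∑-irrelevant : ∀ (E F : Enum X) w → ∑ E w ≡ ∑ F w
  ∑-irrelevant E F w = sumL-↭ w $ ∼bag⇒↭ $ unique∧set⇒bag (unique E) (unique F)
    (mk⇔ (complete F ∘ sound E) (complete E ∘ sound F))

opaque
  unfolding ∑

  ∑-cong : ∀ (E : Enum X) {v w} → (∀ a → X a → v a ≡ w a) → ∑ E v ≡ ∑ E w
  ∑-cong E e = sumL-cong (list E) (λ a∈ → e _ (sound E a∈))

opaque
  unfolding ∑

  ∑-≅ : ∀ (i : X ≅ Y) (E : Enum X) (F : Enum Y) v w →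
    (∀ a → X a → v a ≡ w (to i a)) → ∑ E v ≡ ∑ F w
  ∑-≅ i E F v w e = begin
    ∑ E v                ≡⟨ ∑-cong E e ⟩
    ∑ E (w ∘ to i)       ≡⟨ sumL-map (to i) (list E) w ⟨
    ∑ (transport i E) w  ≡⟨ ∑-irrelevant (transport i E) F w ⟩
    ∑ F w                ∎
    where open ≡-Reasoning

opaque
  unfolding ∑

  ∑-+ : ∀ (E : Enum X) v w → ∑ E v + ∑ E w ≡ ∑ E (λ a → v a + w a)
  ∑-+ E = sumL-+ (list E)

  ∑-* : ∀ (E : Enum X) c w → c * ∑ E w ≡ ∑ E (λ a → c * w a)
  ∑-* E = sumL-* (list E)

∑-neg : ∀ (E : Enum X) w → - ∑ E w ≡ ∑ E (λ a → - w a)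
∑-neg E w = begin
  - ∑ E w                    ≡⟨ ℤ.-1*i≡-i (∑ E w) ⟨
  - (+ 1) * ∑ E w            ≡⟨ ∑-* E (- + 1) w ⟩
  ∑ E (λ a → - (+ 1) * w a)  ≡⟨ ∑-cong E (λ a _ → ℤ.-1*i≡-i (w a)) ⟩
  ∑ E (λ a → - w a)          ∎
  where open ≡-Reasoning

opaque
  unfolding ∑

  ∑-zero : ∀ (E : Enum X) {w} → (∀ a → X a → w a ≡ + 0) → ∑ E w ≡ + 0
  ∑-zero {X = X} E {w} z = go (list E) (λ a∈ → z _ (sound E a∈))
    where
    go : ∀ xs → (∀ {a} → a ∈ xs → w a ≡ + 0) → sumL xs w ≡ + 0
    go [] z = refl
    go (x ∷ xs) z = z (here refl) ⊕ go xs (z ∘ there)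

∑-empty : ∀ (E : Enum X) {w} → (∀ a → ¬ X a) → ∑ E w ≡ + 0
∑-empty E ¬X = ∑-zero E (λ a p → ⊥-elim (¬X a p))

infixl 5 _∩_ _∖_
_∩_ : Enum X → Decidable Z → Enum (λ a → X a × Z a)
_∩_ E Z? .list = filter Z? (list E)
_∩_ E Z? .unique = filter⁺ Z? (unique E)
_∩_ E Z? .sound m = let a∈ , r = ∈-filter⁻ Z? m in sound E a∈ , r
_∩_ E Z? .complete (p , r) = ∈-filter⁺ Z? (complete E p) r

_∖_ : Enum X → Decidable Z → Enum (λ a → X a × ¬ Z a)
E ∖ Z? = E ∩ (¬? ∘ Z?)

opaque
  unfolding ∑

  ∑-split : ∀ (E : Enum X) (Z? : Decidable Z) w → ∑ E w ≡ ∑ (E ∩ Z?) w + ∑ (E ∖ Z?) w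
  ∑-split E Z? = sumL-filter Z? (list E)

∑-∩ : ∀ (E : Enum X) (Z? : Decidable Z) {w} →
  (∀ a → X a → ¬ Z a → w a ≡ + 0) → ∑ E w ≡ ∑ (E ∩ Z?) w
∑-∩ E Z? {w} z = trans (∑-split E Z? w)
  (trans (cong (ℤ._+_ (∑ (E ∩ Z?) w)) (∑-zero (E ∖ Z?) (λ a (p , ¬r) → z a p ¬r)))
      (ℤ.+-identityʳ (∑ (E ∩ Z?) w)))

Σ-enum : {A B : Set} {X : A → Set} {Y : A → B → Set} → Enum X → (∀ a → Enum (Y a)) → Enum
    (λ (a , b) → X a × Y a b)
Σ-enum {A} {B} {X} {Y} E F = record
  { list = concatMap block (list E)
  ; unique = distinct (unique E)
  ; sound = λ m → let a∈ , b∈ = ∈⁻ (list E) m in sound E a∈ , sound (F _) b∈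
  ; complete = λ (p , q) → ∈⁺ (complete E p) (complete (F _) q)
  }
  where
  block : A → List (A × B)
  block a = map (a ,_) (list (F a))
  ∈⁻ : ∀ xs {a b} → (a , b) ∈ concatMap block xs → a ∈ xs × b ∈ list (F a)
  ∈⁻ (x ∷ xs) m with ∈-++⁻ (block x) m
  ... | inj₂ m′ = let a∈ , b∈ = ∈⁻ xs m′ in there a∈ , b∈
  ... | inj₁ m′ with ∈-map⁻ (x ,_) m′
  ...   | b , b∈ , refl = here refl , b∈
  ∈⁺ : ∀ {xs a b} → a ∈ xs → b ∈ list (F a) → (a , b) ∈ concatMap block xs
  ∈⁺ (here refl) b∈ = ∈-++⁺ˡ (∈-map⁺ _ b∈)
  ∈⁺ {x ∷ _} (there a∈) b∈ = ∈-++⁺ʳ (block x) (∈⁺ a∈ b∈)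
  distinct : ∀ {xs} → Unique xs → Unique (concatMap block xs)
  distinct AllPairs.[] = AllPairs.[]
  distinct {x ∷ xs} (x∉ AllPairs.∷ u) =
    ++⁺ (map⁺ (cong proj₂) (unique (F x))) (distinct u) disjoint
    where
    disjoint : ∀ {ab} → ¬ (ab ∈ block x × ab ∈ concatMap block xs)
    disjoint (m , m′) with ∈-map⁻ (x ,_) m
    ... | _ , _ , refl = All.lookup x∉ (proj₁ (∈⁻ xs m′)) refl

opaque
  unfolding ∑

  ∑-Σ : {A B : Set} {X : A → Set} {Y : A → B → Set} (E : Enum X) (F : ∀ a → Enum (Y a)) (w : A × B → ℤ) →
    ∑ (Σ-enum {Y = Y} E F) w ≡ ∑ E (λ a → ∑ (F a) (λ b → w (a , b)))
  ∑-Σ E F w = trans (sumL-concatMap _ (list E) w)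
    (sumL-cong (list E) (λ {a} _ → sumL-map (a ,_) (list (F a)) w))

≅-id : (∀ a → X a → Y a) → (∀ a → Y a → X a) → X ≅ Y
≅-id p q = record { to = id ; from = id ; to-⊆ = p _ ; from-⊆ = q _
                  ; from-to = λ _ → refl ; to-from = λ _ → refl }

range : ∀ n → Enum (ℕ._< n)
range n = record { list = upTo n ; unique = upTo⁺ n ; sound = ∈-upTo⁻ ; complete = ∈-upTo⁺ }

opaque
  unfolding ∑

  ∑-range-suc : ∀ n w → ∑ (range (suc n)) w ≡ ∑ (range n) w + w n
  ∑-range-suc n w = begin
    sumL (upTo (suc n)) w          ≡⟨ cong (λ ks → sumL ks w) (upTo-∷ʳ n) ⟨
    sumL (upTo n ++ n ∷ []) w      ≡⟨ sumL-++ (upTo n) (n ∷ []) w ⟩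
    sumL (upTo n) w + (w n + + 0)  ≡⟨ cong (ℤ._+_ (sumL (upTo n) w)) (ℤ.+-identityʳ (w n)) ⟩
    sumL (upTo n) w + w n          ∎
    where open ≡-Reasoning

initial : ∀ n → (ℕ._< suc n) ≅ (λ (i , j) → i ℕ.+ j ≡ n)
initial n = record
  { to = λ i → i , n ℕ.∸ i ; from = proj₁
  ; to-⊆ = λ i<1+n → ℕ.m+[n∸m]≡n (ℕ.≤-pred i<1+n)
  ; from-⊆ = λ { {i , j} refl → s≤s (ℕ.m≤m+n i j) }
  ; from-to = λ _ → refl
  ; to-from = λ { {i , j} refl → cong (i ,_) (ℕ.m+n∸m≡n i j) } }

antidiagonal : ∀ n → Enum (λ (i , j) → i ℕ.+ j ≡ n)
antidiagonal n = transport (initial n) (range (suc n))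

∣≤∣ : ∀ n → Enum (λ x → ∣ x ∣ ℕ.≤ n)
∣≤∣ n = record
  { list = map +_ (upTo (suc n)) ++ map -[1+_] (upTo n)
  ; unique = ++⁺ (map⁺ ℤ.+-injective (upTo⁺ (suc n))) (map⁺ ℤ.-[1+-injective (upTo⁺ n)) disjoint
  ; sound = λ m → snd (∈-++⁻ (map +_ (upTo (suc n))) m)
  ; complete = cmp }
  where
  disjoint : ∀ {x} → ¬ (x ∈ map +_ (upTo (suc n)) × x ∈ map -[1+_] (upTo n))
  disjoint (p , q) with ∈-map⁻ +_ p | ∈-map⁻ -[1+_] q
  ... | _ , _ , refl | _ , _ , ()
  snd : ∀ {x} → x ∈ map +_ (upTo (suc n)) ⊎ x ∈ map -[1+_] (upTo n) → ∣ x ∣ ℕ.≤ n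
  snd (inj₁ m) with ∈-map⁻ +_ m
  ... | _ , k∈ , refl = ℕ.≤-pred (∈-upTo⁻ k∈)
  snd (inj₂ m) with ∈-map⁻ -[1+_] m
  ... | _ , k∈ , refl = ∈-upTo⁻ k∈
  cmp : ∀ {x} → ∣ x ∣ ℕ.≤ n → x ∈ map +_ (upTo (suc n)) ++ map -[1+_] (upTo n)
  cmp {+ k} le = ∈-++⁺ˡ (∈-map⁺ +_ (∈-upTo⁺ (s≤s le)))
  cmp { -[1+ k ]} le = ∈-++⁺ʳ _ (∈-map⁺ -[1+_] (∈-upTo⁺ le))

singleton : (a : A) → Enum (_≡ a)
singleton a = record { list = a ∷ [] ; unique = All.[] AllPairs.∷ AllPairs.[]
                     ; sound = λ { (here e) → e } ; complete = here }

opaque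
  unfolding ∑

  ∑-singleton : ∀ (a : A) w → ∑ (singleton a) w ≡ w a
  ∑-singleton a w = ℤ.+-identityʳ (w a)

  ∑-range-zero : ∀ w → ∑ (range 0) w ≡ + 0
  ∑-range-zero w = refl

-- Graded sets and their generating series

record Graded (A : Set) : Set where
  field
    deg : A → ℕ
    fibre : ∀ n → Enum (λ a → deg a ≡ n)

open Graded

gen : Graded A → (A → ℤ) → Series
gen G w n = ∑ (fibre G n) w

graded-⊗ : ∀ {A B : Set} (G : Graded A) (H : Graded B) n →
  (λ (((i , j) , a , b) : (ℕ × ℕ) × A × B) → (i ℕ.+ j ≡ n) × (deg G a ≡ i) × (deg H b ≡ j)) ≅
  (λ ((a , b) : A × B) → deg G a ℕ.+ deg H b ≡ n)
graded-⊗ {A} {B} G H n = record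
  { to = proj₂ ; from = λ (a , b) → (deg G a , deg H b) , a , b
  ; to-⊆ = λ { (e , refl , refl) → e } ; from-⊆ = λ e → e , refl , refl
  ; from-to = λ { (_ , refl , refl) → refl } ; to-from = λ _ → refl }

infixr 4 _⊗_
_⊗_ : Graded A → Graded B → Graded (A × B)
(G ⊗ H) .deg (a , b) = deg G a ℕ.+ deg H b
(G ⊗ H) .fibre n = transport (graded-⊗ G H n)
  (Σ-enum (antidiagonal n) (λ (i , j) → Σ-enum (fibre G i) (λ _ → fibre H j)))

∑-⊗ : ∀ (G : Graded A) (H : Graded B) w n → gen (G ⊗ H) w n ≡
  ∑ (antidiagonal n) (λ (i , j) → ∑ (fibre G i) (λ a → ∑ (fibre H j) (λ b → w (a , b))))
∑-⊗ G H w n = begin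
  ∑ (fibre (G ⊗ H) n) w
    ≡⟨ ∑-≅ (graded-⊗ G H n) E (fibre (G ⊗ H) n) (w ∘ proj₂) w (λ _ _ → refl) ⟨
  ∑ E (w ∘ proj₂)
    ≡⟨ ∑-Σ (antidiagonal n) F (w ∘ proj₂) ⟩
  ∑ (antidiagonal n) (λ ij → ∑ (F ij) w)
    ≡⟨ ∑-cong (antidiagonal n) (λ (i , j) _ → ∑-Σ (fibre G i) (λ _ → fibre H j) w) ⟩
  ∑ (antidiagonal n) (λ (i , j) → ∑ (fibre G i) (λ a → ∑ (fibre H j) (λ b → w (a , b)))) ∎
  where
  open ≡-Reasoning
  F : ∀ ij → Enum (λ (a , b) → deg G a ≡ proj₁ ij × deg H b ≡ proj₂ ij)
  F (i , j) = Σ-enum (fibre G i) (λ _ → fibre H j)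
  E = Σ-enum (antidiagonal n) F

-- The decidable equation on degrees cuts each fibre out of any finite set known to contain it, so a
-- crude bound is enough.
bounded : ∀ (e : A → ℕ) {X : ℕ → A → Set} → (∀ n → Enum (X n)) → (∀ a → X (e a) a) → Graded A
bounded e E b .deg = e
bounded e E b .fibre n = transport
  (≅-id (λ a → proj₂) (λ { a refl → b a , refl })) (E n ∩ (λ a → e a ℕ.≟ n))

regrade : (G : Graded A) (e : A → ℕ) → (∀ a → deg G a ℕ.≤ e a) → Graded A
regrade G e le = bounded e {λ n a → deg G a ℕ.< suc n}
  (λ n → transport (record
    { to = proj₂ ; from = λ a → deg G a , a
    ; to-⊆ = λ { (p , refl) → p } ; from-⊆ = λ p → p , refl
    ; from-to = λ { (p , refl) → refl } ; to-from = λ _ → refl })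
    (Σ-enum (range (suc n)) (fibre G)))
  (s≤s ∘ le)

scale : ∀ c .{{_ : ℕ.NonZero c}} → Graded A → Graded A
scale c G = regrade G (λ a → c ℕ.* deg G a) (λ a → ℕ.m≤n*m (deg G a) c)

-- The semiring of power series

partial : Series → Series → ℕ → ℕ → ℤ
partial f g n zero = f zero * g n
partial f g n (suc i) = partial f g n i + f (suc i) * g (n ℕ.∸ suc i)

-- The local function of _⊛_ has no name here. Abstracting over suc n and over ℤ._+_ makes it
-- appear applied to variables, which lets unification solve the _ below.
mutual
  ⊛-partial : ∀ f g n → (f ⊛ g) n ≡ partial f g n n
  ⊛-partial f g zero = refl
  ⊛-partial f g (suc n) with suc n | ℤ._+_
  ... | w | _⊞_ = cong (_⊞ (f w * g (n ℕ.∸ n))) (go-partial f g w n)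

  go-partial : ∀ f g n i → _ ≡ partial f g n i
  go-partial f g n zero = refl
  go-partial f g n (suc i) = cong (_+ (f (suc i) * g (n ℕ.∸ suc i))) (go-partial f g n i)

⊛-∑ : ∀ f g n → (f ⊛ g) n ≡ ∑ (antidiagonal n) (λ (i , j) → f i * g j)
⊛-∑ f g n = trans (⊛-partial f g n)
  (trans (partial-∑ n) (∑-≅ (initial n) (range (suc n)) (antidiagonal n) term (λ (i , j) → f i * g j)
      (λ _ _ → refl)))
  where
  term : ℕ → ℤ
  term k = f k * g (n ℕ.∸ k)
  partial-∑ : ∀ i → partial f g n i ≡ ∑ (range (suc i)) term
  partial-∑ zero = sym (trans (∑-range-suc 0 term)
    (trans (cong (_+ term 0) (∑-range-zero term)) (ℤ.+-identityˡ (term 0))))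
  partial-∑ (suc i) = trans (cong (_+ term (suc i)) (partial-∑ i))
    (sym (∑-range-suc (suc i) term))

∑*∑ : ∀ (E : Enum X) (F : Enum Y) v w → ∑ E v * ∑ F w ≡ ∑ E (λ a → ∑ F (λ b → v a * w b))
∑*∑ E F v w = begin
  ∑ E v * ∑ F w                      ≡⟨ ℤ.*-comm (∑ E v) (∑ F w) ⟩
  ∑ F w * ∑ E v                      ≡⟨ ∑-* E (∑ F w) v ⟩
  ∑ E (λ a → ∑ F w * v a)
    ≡⟨ ∑-cong E (λ a _ → trans (ℤ.*-comm (∑ F w) (v a)) (∑-* F (v a) w)) ⟩
  ∑ E (λ a → ∑ F (λ b → v a * w b))  ∎
  where open ≡-Reasoning

infix 3 _≈_
_≈_ : Series → Series → Set
f ≈ g = ∀ n → f n ≡ g n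

infixl 7 _∙_
_∙_ : (A → ℤ) → (B → ℤ) → A × B → ℤ
(v ∙ w) (a , b) = v a * w b

-- The device behind the bijective proofs: a product of generating series enumerates pairs, so an
-- identity between products reduces to a bijection that respects degrees and weights.
gen-⊗ : ∀ (G : Graded A) (H : Graded B) v w → gen G v ⊛ gen H w ≈ gen (G ⊗ H) (v ∙ w)
gen-⊗ G H v w n = begin
  (gen G v ⊛ gen H w) n
    ≡⟨ ⊛-∑ (gen G v) (gen H w) n ⟩
  ∑ (antidiagonal n) (λ (i , j) → gen G v i * gen H w j)
    ≡⟨ ∑-cong (antidiagonal n) (λ (i , j) _ → ∑*∑ (fibre G i) (fibre H j) v w) ⟩
  ∑ (antidiagonal n) (λ (i , j) → ∑ (fibre G i) (λ a → ∑ (fibre H j) (λ b → v a * w b)))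
    ≡⟨ ∑-⊗ G H (v ∙ w) n ⟨
  gen (G ⊗ H) (v ∙ w) n
    ∎
  where open ≡-Reasoning

⊛-cong : ∀ {f f′ g g′} → f ≈ f′ → g ≈ g′ → f ⊛ g ≈ f′ ⊛ g′
⊛-cong {f} {f′} {g} {g′} p q n = begin
  (f ⊛ g) n                                     ≡⟨ ⊛-∑ f g n ⟩
  ∑ (antidiagonal n) (λ (i , j) → f i * g j)    ≡⟨ ∑-cong (antidiagonal n)
      (λ (i , j) _ → cong₂ _*_ (p i) (q j)) ⟩
  ∑ (antidiagonal n) (λ (i , j) → f′ i * g′ j)  ≡⟨ ⊛-∑ f′ g′ n ⟨
  (f′ ⊛ g′) n                                   ∎
  where open ≡-Reasoning

-- Every series is a generating series, which reduces the semiring laws to bijections.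
identity : Graded ℕ
identity .deg = id
identity .fibre = singleton

gen-identity : ∀ f → f ≈ gen identity f
gen-identity f n = sym (∑-singleton n f)

⊛-comm : ∀ f g → f ⊛ g ≈ g ⊛ f
⊛-comm f g n = trans (⊛-∑ f g n) (trans
  (∑-≅ swap (antidiagonal n) (antidiagonal n) (λ (i , j) → f i * g j) (λ (i , j) → g i * f j)
      (λ (i , j) _ → ℤ.*-comm (f i) (g j)))
  (sym (⊛-∑ g f n)))
  where
  swap : (λ (i , j) → i ℕ.+ j ≡ n) ≅ (λ (i , j) → i ℕ.+ j ≡ n)
  swap = record { to = λ (i , j) → j , i ; from = λ (i , j) → j , i
    ; to-⊆ = λ {(i , j)} → trans (ℕ.+-comm j i) ; from-⊆ = λ {(i , j)} → trans (ℕ.+-comm j i)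
    ; from-to = λ _ → refl ; to-from = λ _ → refl }

⊛-assoc : ∀ f g h → (f ⊛ g) ⊛ h ≈ f ⊛ (g ⊛ h)
⊛-assoc f g h n = begin
  ((f ⊛ g) ⊛ h) n
    ≡⟨ ⊛-cong {f ⊛ g} (λ k → trans (⊛-cong (gen-identity f) (gen-identity g) k) (gen-⊗ I I f g k))
                      (gen-identity h) n ⟩
  (gen (I ⊗ I) (f ∙ g) ⊛ gen I h) n
    ≡⟨ gen-⊗ (I ⊗ I) I (f ∙ g) h n ⟩
  gen ((I ⊗ I) ⊗ I) (f ∙ g ∙ h) n
    ≡⟨ ∑-≅ shift (fibre ((I ⊗ I) ⊗ I) n) (fibre (I ⊗ I ⊗ I) n) (f ∙ g ∙ h) (f ∙ (g ∙ h))
         (λ ((i , j) , k) _ → ℤ.*-assoc (f i) (g j) (h k)) ⟩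
  gen (I ⊗ I ⊗ I) (f ∙ (g ∙ h)) n
    ≡⟨ gen-⊗ I (I ⊗ I) f (g ∙ h) n ⟨
  (gen I f ⊛ gen (I ⊗ I) (g ∙ h)) n
    ≡⟨ ⊛-cong {f} (gen-identity f)
         (λ k → trans (⊛-cong (gen-identity g) (gen-identity h) k) (gen-⊗ I I g h k)) n ⟨
  (f ⊛ (g ⊛ h)) n
    ∎
  where
  open ≡-Reasoning
  I = identity
  shift : (λ ((i , j) , k) → (i ℕ.+ j) ℕ.+ k ≡ n) ≅ (λ (i , j , k) → i ℕ.+ (j ℕ.+ k) ≡ n)
  shift = record { to = λ ((i , j) , k) → i , j , k ; from = λ (i , j , k) → (i , j) , k
    ; to-⊆ = λ {((i , j) , k)} → trans (sym (ℕ.+-assoc i j k))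
    ; from-⊆ = λ {(i , j , k)} → trans (ℕ.+-assoc i j k)
    ; from-to = λ _ → refl ; to-from = λ _ → refl }

infixl 6 _∔_
_∔_ : Series → Series → Series
(f ∔ g) n = f n + g n

nil : Series
nil n = + 0

⊛-zeroˡ : ∀ f → nil ⊛ f ≈ nil
⊛-zeroˡ f n = trans (⊛-∑ nil f n) (∑-zero (antidiagonal n) (λ (i , j) _ → ℤ.*-zeroˡ (f j)))

⊛-distribʳ : ∀ f g h → (g ∔ h) ⊛ f ≈ (g ⊛ f) ∔ (h ⊛ f)
⊛-distribʳ f g h n = begin
  ((g ∔ h) ⊛ f) n
    ≡⟨ ⊛-∑ (g ∔ h) f n ⟩
  ∑ E (λ (i , j) → (g i + h i) * f j)
    ≡⟨ ∑-cong E (λ (i , j) _ → ℤ.*-distribʳ-+ (f j) (g i) (h i)) ⟩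
  ∑ E (λ (i , j) → g i * f j + h i * f j)
    ≡⟨ ∑-+ E (λ (i , j) → g i * f j) (λ (i , j) → h i * f j) ⟨
  ∑ E (λ (i , j) → g i * f j) + ∑ E (λ (i , j) → h i * f j)
    ≡⟨ cong₂ _+_ (⊛-∑ g f n) (⊛-∑ h f n) ⟨
  (g ⊛ f) n + (h ⊛ f) n
    ∎
  where
  open ≡-Reasoning
  E = antidiagonal n

⊛-identityˡ : ∀ f → one ⊛ f ≈ f
⊛-identityˡ f n = begin
  (one ⊛ f) n                                    ≡⟨ ⊛-∑ one f n ⟩
  ∑ E (λ (i , j) → one i * f j)                  ≡⟨ ∑-∩ E (λ (i , _) → i ℕ.≟ 0) higher ⟩
  ∑ (E ∩ λ (i , _) → i ℕ.≟ 0) (λ (i , j) → one i * f j)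
    ≡⟨ ∑-≅ constant (E ∩ λ (i , _) → i ℕ.≟ 0) (singleton n)
         (λ (i , j) → one i * f j) f (λ { (_ , j) (_ , refl) → ℤ.*-identityˡ (f j) }) ⟩
  ∑ (singleton n) f                              ≡⟨ ∑-singleton n f ⟩
  f n                                            ∎
  where
  open ≡-Reasoning
  E = antidiagonal n
  higher : ∀ ((i , j) : ℕ × ℕ) → i ℕ.+ j ≡ n → i ≢ 0 → one i * f j ≡ + 0
  higher (zero , j) _ i≢0 = ⊥-elim (i≢0 refl)
  higher (suc i , j) _ _ = ℤ.*-zeroˡ (f j)
  constant : (λ ((i , j) : ℕ × ℕ) → (i ℕ.+ j ≡ n) × (i ≡ 0)) ≅ (_≡ n)
  constant = record { to = proj₂ ; from = 0 ,_ ; to-⊆ = λ { (e , refl) → e } ; from-⊆ = λ e → e , refl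
    ; from-to = λ { (_ , refl) → refl } ; to-from = λ _ → refl }

seriesSemiring : CommutativeSemiring 0ℓ 0ℓ
seriesSemiring = record
  { Carrier = Series ; _≈_ = _≈_ ; _+_ = _∔_ ; _*_ = _⊛_ ; 0# = nil ; 1# = one
  ; isCommutativeSemiring = isCommutativeSemiringˡ record
    { +-isCommutativeMonoid = record
      { isMonoid = record
        { isSemigroup = record
          { isMagma = record { isEquivalence = ≈-equiv ; ∙-cong = λ p q n → cong₂ _+_ (p n) (q n) }
          ; assoc = λ f g h n → ℤ.+-assoc (f n) (g n) (h n) }
        ; identity = (λ f n → ℤ.+-identityˡ (f n)) , (λ f n → ℤ.+-identityʳ (f n)) }
      ; comm = λ f g n → ℤ.+-comm (f n) (g n) }
    ; *-isCommutativeMonoid = record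
      { isMonoid = record
        { isSemigroup = record
          { isMagma = record { isEquivalence = ≈-equiv ; ∙-cong = ⊛-cong }
          ; assoc = ⊛-assoc }
        ; identity = ⊛-identityˡ , (λ f n → trans (⊛-comm f one n) (⊛-identityˡ f n)) }
      ; comm = ⊛-comm }
    ; distribʳ = ⊛-distribʳ
    ; zeroˡ = ⊛-zeroˡ } }
  where
  ≈-equiv : IsEquivalence _≈_
  ≈-equiv = record { refl = λ n → refl ; sym = λ p n → sym (p n) ; trans = λ p q n → trans (p n) (q n) }

-- Logarithmic derivatives

D : Series → Series
D f n = + n * f n

-- `α` plays the role of q f′/f; the relation is multiplied out because series are not divided.
Log : Series → Series → Set
Log f α = D f ≈ f ⊛ α

D-⊛ : ∀ f g → D (f ⊛ g) ≈ (D f ⊛ g) ∔ (f ⊛ D g)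
D-⊛ f g n = begin
  + n * (f ⊛ g) n
    ≡⟨ cong (+ n *_) (⊛-∑ f g n) ⟩
  + n * ∑ E (λ (i , j) → f i * g j)
    ≡⟨ ∑-* E (+ n) (λ (i , j) → f i * g j) ⟩
  ∑ E (λ (i , j) → + n * (f i * g j))
    ≡⟨ ∑-cong E (λ { (i , j) refl → leibniz (+ i) (+ j) (f i) (g j) }) ⟩
  ∑ E (λ (i , j) → D f i * g j + f i * D g j)
    ≡⟨ ∑-+ E (λ (i , j) → D f i * g j) (λ (i , j) → f i * D g j) ⟨
  ∑ E (λ (i , j) → D f i * g j) + ∑ E (λ (i , j) → f i * D g j)
    ≡⟨ cong₂ _+_ (⊛-∑ (D f) g n) (⊛-∑ f (D g) n) ⟨
  (D f ⊛ g) n + (f ⊛ D g) n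
    ∎
  where
  open ≡-Reasoning
  E = antidiagonal n
  leibniz : ∀ i j x y → (i + j) * (x * y) ≡ i * x * y + x * (j * y)
  leibniz = solve-∀

open Algebra.Solver.Ring.NaturalCoefficients.Default seriesSemiring
  using (_:+_; _:*_; _:=_) renaming (solve to solve⊛)

Log-⊛ : ∀ {f g α β} → Log f α → Log g β → Log (f ⊛ g) (α ∔ β)
Log-⊛ {f} {g} {α} {β} p q n = begin
  D (f ⊛ g) n                          ≡⟨ D-⊛ f g n ⟩
  (D f ⊛ g) n + (f ⊛ D g) n            ≡⟨ cong₂ _+_ (⊛-cong {g = g} p (λ _ → refl) n)
      (⊛-cong {f} (λ _ → refl) q n) ⟩
  ((f ⊛ α) ⊛ g) n + (f ⊛ (g ⊛ β)) n    ≡⟨ rearrange f g α β n ⟩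
  ((f ⊛ g) ⊛ (α ∔ β)) n                ∎
  where
  open ≡-Reasoning
  rearrange : ∀ f g α β → ((f ⊛ α) ⊛ g) ∔ (f ⊛ (g ⊛ β)) ≈ (f ⊛ g) ⊛ (α ∔ β)
  rearrange = solve⊛ 4 (λ f g α β → (f :* α) :* g :+ f :* (g :* β) := (f :* g) :* (α :+ β)) (λ _ → refl)

-- Substituting q^c for q multiplies q d/dq by c, so the weight on the logarithmic side gains the
-- factor c. In degrees not divisible by c both sides are empty sums.
Log-scale : ∀ c .{{_ : ℕ.NonZero c}} (G : Graded A) (H : Graded B) v w →
  Log (gen G v) (gen H w) → Log (gen (scale c G) v) (gen (scale c H) (λ b → + c * w b))
Log-scale c G H v w p n = trans (lhs≡rhs n (c ∣? n)) (sym (gen-⊗ (scale c G) (scale c H) v w′ n))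
  where
  open ≡-Reasoning
  w′ = λ b → + c * w b
  pull : ∀ x y z → x * (y * z) ≡ y * (x * z)
  pull = solve-∀
  lhs≡rhs : ∀ n → Dec (c ∣ n) → + n * gen (scale c G) v n ≡ gen (scale c G ⊗ scale c H) (v ∙ w′) n
  lhs≡rhs n (no c∤n) = trans
    (cong (+ n *_) (∑-empty (fibre (scale c G) n)
        (λ a e → c∤n (divides (deg G a) (trans (sym e) (ℕ.*-comm c (deg G a)))))))
    (trans (ℤ.*-zeroʳ (+ n)) (sym (∑-empty (fibre (scale c G ⊗ scale c H) n)
      (λ (a , b) e → c∤n (divides (deg G a ℕ.+ deg H b) (trans (sym e)
        (trans (sym (ℕ.*-distribˡ-+ c (deg G a) (deg H b))) (ℕ.*-comm c (deg G a ℕ.+ deg H b)))))))))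
  lhs≡rhs _ (yes (divides k refl)) = begin
    + (k ℕ.* c) * ∑ (fibre (scale c G) (k ℕ.* c)) v
      ≡⟨ cong₂ _*_ (trans (cong +_ (ℕ.*-comm k c)) (ℤ.pos-* c k))
           (∑-≅ (≅-id (λ a → div k (deg G a)) (λ a → mul k (deg G a))) (fibre (scale c G) (k ℕ.* c))
               (fibre G k) v v (λ _ _ → refl)) ⟩
    + c * + k * ∑ (fibre G k) v
      ≡⟨ trans (ℤ.*-assoc (+ c) (+ k) (gen G v k)) (cong (+ c *_) (trans (p k) (gen-⊗ G H v w k))) ⟩
    + c * ∑ (fibre (G ⊗ H) k) (v ∙ w)
      ≡⟨ ∑-* (fibre (G ⊗ H) k) (+ c) (v ∙ w) ⟩
    ∑ (fibre (G ⊗ H) k) (λ ab → + c * (v ∙ w) ab)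
      ≡⟨ ∑-≅ (≅-id (λ (a , b) e → trans (sym (ℕ.*-distribˡ-+ c (deg G a) (deg H b)))
          (mul k (deg G a ℕ.+ deg H b) e))
                   (λ (a , b) e → div k (deg G a ℕ.+ deg H b) (trans (ℕ.*-distribˡ-+ c (deg G a) (deg H b)) e)))
           (fibre (G ⊗ H) k) (fibre (scale c G ⊗ scale c H) (k ℕ.* c)) (λ ab → + c * (v ∙ w) ab) (v ∙ w′)
           (λ (a , b) _ → pull (+ c) (v a) (w b)) ⟩
    ∑ (fibre (scale c G ⊗ scale c H) (k ℕ.* c)) (v ∙ w′)
      ∎
    where
    mul : ∀ k d → d ≡ k → c ℕ.* d ≡ k ℕ.* c
    mul k d refl = ℕ.*-comm c k
    div : ∀ k d → c ℕ.* d ≡ k ℕ.* c → d ≡ k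
    div k d e = ℕ.*-cancelˡ-≡ d k c (trans e (ℕ.*-comm k c))

-- The term i = 0 isolates the coefficient in the top degree, and its factor is nonzero in positive
-- degrees; the constant term is a separate datum. The recurrence is assumed only up to degree k,
-- since a truncated product obeys the required one only so far.
recurrence-unique : ∀ k (c : ℕ → ℕ → ℤ) (f g : Series) →
  (∀ m → c 0 (suc m) ≢ + 0) →
  (∀ m → m ℕ.≤ k → ∑ (antidiagonal m) (λ (i , j) → c i j * f j) ≡ + 0) →
  (∀ m → m ℕ.≤ k → ∑ (antidiagonal m) (λ (i , j) → c i j * g j) ≡ + 0) →
  f 0 ≡ g 0 → ∀ m → m ℕ.≤ k → f m ≡ g m
recurrence-unique k c f g c≢0 p q f0≡g0 m m≤k = go (suc m) m ℕ.≤-refl m≤k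
  where
  open ≡-Reasoning
  leading : Decidable (λ ((i , j) : ℕ × ℕ) → i ≡ 0)
  leading (i , j) = i ℕ.≟ 0
  term : Series → ℕ × ℕ → ℤ
  term h (i , j) = c i j * h j
  top : ∀ b → (λ ((i , j) : ℕ × ℕ) → (i ℕ.+ j ≡ b) × (i ≡ 0)) ≅ (_≡ b)
  top b = record { to = proj₂ ; from = 0 ,_ ; to-⊆ = λ { (e , refl) → e } ; from-⊆ = λ e → e , refl
    ; from-to = λ { (_ , refl) → refl } ; to-from = λ _ → refl }
  split : ∀ b h → ∑ (antidiagonal b) (term h) ≡ c 0 b * h b + ∑ (antidiagonal b ∖ leading) (term h)
  split b h = trans (∑-split (antidiagonal b) leading (term h))
    (cong (_+ ∑ (antidiagonal b ∖ leading) (term h))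
      (trans (∑-≅ (top b) (antidiagonal b ∩ leading) (singleton b) (term h) (λ j → c 0 j * h j)
               (λ { (_ , j) (_ , refl) → refl }))
             (∑-singleton b (λ j → c 0 j * h j))))
  step : ∀ b → b ℕ.≤ k → (∀ j → j ℕ.< b → f j ≡ g j) → f b ≡ g b
  step zero _ _ = f0≡g0
  step b@(suc m) b≤k ih = ℤ.*-cancelˡ-≡ (c 0 b) (f b) (g b) {{ℤ.≢-nonZero (c≢0 m)}}
    (+-cancel (c 0 b * f b) (c 0 b * g b)
      (trans (sym (split b f)) (trans (trans (p b b≤k) (sym (q b b≤k))) (split b g))) rest)
    where
    rest : ∑ (antidiagonal b ∖ leading) (term f) ≡ ∑ (antidiagonal b ∖ leading) (term g)
    rest = ∑-cong (antidiagonal b ∖ leading) λ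
      { (zero , j) (e , i≢0) → ⊥-elim (i≢0 refl)
      ; (suc i , j) (e , _) → cong (c (suc i) j *_) (ih j (subst (j ℕ.<_) e (s≤s (ℕ.m≤n+m j i)))) }
  go : ∀ b m → m ℕ.< b → m ℕ.≤ k → f m ≡ g m
  go (suc b) m m<b m≤k = step m m≤k
    (λ j j<m → go b j (ℕ.<-≤-trans j<m (ℕ.≤-pred m<b)) (ℕ.<⇒≤ (ℕ.<-≤-trans j<m m≤k)))

-- Residues, parity signs and triangular numbers

divMod-unique : ∀ d .{{_ : ℕ.NonZero d}} x q r → r ℕ.< d → x ≡ + r + q * + d →
  x /ℕ d ≡ q × x %ℕ d ≡ r
divMod-unique d x q r r<d e = q′≡q , ℤ.+-injective (remainder q′≡q)
  where
  q′ = x /ℕ d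
  r′ = x %ℕ d
  gap : ∀ x r q r′ q′ d → x ≡ r + q * d → x ≡ r′ + q′ * d → (q′ - q) * d ≡ r - r′
  gap x r q r′ q′ d e e′ = linear (+ 1 *[ e ] ⊕ (- + 1) *[ e′ ]) (solve (x ∷ r ∷ q ∷ r′ ∷ q′ ∷ d ∷ []))
  gap′ : (q′ - q) * + d ≡ + r - + r′
  gap′ = gap x (+ r) q (+ r′) q′ (+ d) e (a≡a%ℕn+[a/ℕn]*n x d)
  small : ∣ q′ - q ∣ ℕ.* d ℕ.< 1 ℕ.* d
  small = subst₂ ℕ._<_ (trans (cong ∣_∣ (sym gap′)) (ℤ.abs-* (q′ - q) (+ d))) (sym (ℕ.*-identityˡ d))
    (ℕ.≤-<-trans (subst (ℕ._≤ r ℕ.⊔ r′) (cong ∣_∣ (sym (ℤ.m-n≡m⊖n r r′))) (ℤ.∣m⊝n∣≤m⊔n r r′))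
                 (ℕ.⊔-lub r<d (n%ℕd<d x d)))
  q′≡q : q′ ≡ q
  q′≡q = ℤ.i-j≡0⇒i≡j q′ q (ℤ.∣i∣≡0⇒i≡0 (ℕ.n<1⇒n≡0 (ℕ.*-cancelʳ-< d (∣ q′ - q ∣) 1 small)))
  remainder : q′ ≡ q → + r′ ≡ + r
  remainder e′ = +-cancel (+ r′) (+ r) (trans (sym (a≡a%ℕn+[a/ℕn]*n x d)) e) (cong (_* + d) e′)

alternating : ℕ → ℤ
alternating zero = + 1
alternating (suc n) = - alternating n

ε : ℤ → ℤ
ε x = alternating ∣ x ∣

alternating-+ : ∀ m n → alternating (m ℕ.+ n) ≡ alternating m * alternating n
alternating-+ zero n = sym (ℤ.*-identityˡ (alternating n))
alternating-+ (suc m) n = trans (cong -_ (alternating-+ m n)) (ℤ.neg-distribˡ-* (alternating m) (alternating n))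

ε-⊖ : ∀ m n → ε (m ℤ.⊖ n) ≡ alternating m * alternating n
ε-⊖ zero zero = refl
ε-⊖ zero (suc n) = sym (ℤ.*-identityˡ (alternating (suc n)))
ε-⊖ (suc m) zero = sym (ℤ.*-identityʳ (alternating (suc m)))
ε-⊖ (suc m) (suc n) = trans (cong ε (ℤ.[1+m]⊖[1+n]≡m⊖n m n))
  (trans (ε-⊖ m n) (signs (alternating m) (alternating n)))
  where
  signs : ∀ x y → x * y ≡ (- x) * (- y)
  signs = solve-∀

ε-+ : ∀ x y → ε (x + y) ≡ ε x * ε y
ε-+ (+ m) (+ n) = alternating-+ m n
ε-+ (+ m) -[1+ n ] = ε-⊖ m (suc n)
ε-+ -[1+ m ] (+ n) = trans (ε-⊖ n (suc m)) (ℤ.*-comm (alternating n) (alternating (suc m)))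
ε-+ -[1+ m ] -[1+ n ] = trans (cong alternating (cong suc (sym (ℕ.+-suc m n)))) (alternating-+ (suc m) (suc n))

ε-neg : ∀ x → ε (- x) ≡ ε x
ε-neg x = cong alternating (ℤ.∣-i∣≡∣i∣ x)

ε-sign : ∀ x → ε x ≡ + 1 ⊎ ε x ≡ - + 1
ε-sign x = go ∣ x ∣
  where
  go : ∀ n → alternating n ≡ + 1 ⊎ alternating n ≡ - + 1
  go zero = inj₁ refl
  go (suc n) with go n
  ... | inj₁ e rewrite e = inj₂ refl
  ... | inj₂ e rewrite e = inj₁ refl

ε-double : ∀ x → ε (x + x) ≡ + 1
ε-double x rewrite ε-+ x x with ε-sign x
... | inj₁ e rewrite e = refl
... | inj₂ e rewrite e = refl

triangle : ℕ → ℕ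
triangle zero = zero
triangle (suc k) = suc k ℕ.+ triangle k

triN : ℤ → ℕ
triN (+ zero) = 0
triN (+ suc k) = triangle k
triN -[1+ k ] = triangle (suc k)

triZ : ℤ → ℤ
triZ x = + triN x

2*triangle : ∀ k → + 2 * + triangle k ≡ + k * + suc k
2*triangle zero = refl
2*triangle (suc k) = linear (+ 1 *[ 2*triangle k ]) (step (+ k) (+ triangle k))
  where
  step : ∀ k t → + 2 * (+ 1 + k + t) - (+ 1 + k) * (+ 2 + k) ≡ + 1 * (+ 2 * t - k * (+ 1 + k))
  step = solve-∀

2*triZ : ∀ x → + 2 * triZ x ≡ x * (x - + 1)
2*triZ (+ zero) = refl
2*triZ (+ suc k) = trans (2*triangle k) (ℤ.*-comm (+ k) (+ suc k))
2*triZ -[1+ k ] = trans (2*triangle (suc k)) (signs (+ k))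
  where
  signs : ∀ k → (+ 1 + k) * (+ 2 + k) ≡ - (+ 1 + k) * (- (+ 1 + k) - + 1)
  signs = solve-∀

tri≡triZ : ∀ x → tri x ≡ triZ x
tri≡triZ x = trans (div-pos-is-/ℕ (x * (x - + 1)) 2)
  (proj₁ (divMod-unique 2 (x * (x - + 1)) (triZ x) 0 (s≤s z≤n)
    (trans (sym (2*triZ x)) (trans (ℤ.*-comm (+ 2) (triZ x)) (sym (ℤ.+-identityˡ (triZ x * + 2)))))))

triN-reflect : ∀ x → triN (+ 1 - x) ≡ triN x
triN-reflect x = ℤ.+-injective (halve (trans (2*triZ (+ 1 - x)) (trans (symmetric x) (sym (2*triZ x)))))
  where
  symmetric : ∀ x → (+ 1 - x) * (+ 1 - x - + 1) ≡ x * (x - + 1)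
  symmetric = solve-∀

k≤triangle : ∀ k → k ℕ.≤ triangle k
k≤triangle zero = z≤n
k≤triangle (suc k) = ℕ.m≤m+n (suc k) (triangle k)

∣x∣≤1+triN : ∀ x → ∣ x ∣ ℕ.≤ suc (triN x)
∣x∣≤1+triN (+ zero) = z≤n
∣x∣≤1+triN (+ suc k) = s≤s (k≤triangle k)
∣x∣≤1+triN -[1+ k ] = ℕ.≤-trans (k≤triangle (suc k)) (ℕ.n≤1+n _)

triG : Graded ℤ
triG = bounded triN {λ n x → ∣ x ∣ ℕ.≤ suc n} (∣≤∣ ∘ suc) ∣x∣≤1+triN

sqN : ℤ → ℕ
sqN x = ∣ x ∣ ℕ.* ∣ x ∣

+sqN : ∀ x → + sqN x ≡ x * x
+sqN (+ n) = ℤ.pos-* n n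
+sqN -[1+ n ] = refl

k≤k*k : ∀ k → k ℕ.≤ k ℕ.* k
k≤k*k zero = z≤n
k≤k*k n@(suc _) = ℕ.m≤m*n n n

sqG : Graded ℤ
sqG = bounded sqN {λ n x → ∣ x ∣ ℕ.≤ n} ∣≤∣ (λ x → k≤k*k ∣ x ∣)

-- (d , δ) stands for the factorisation (1 + d)(1 + δ).
pairG : Graded (ℕ × ℕ)
pairG = bounded (λ (d , δ) → suc d ℕ.* suc δ) {λ n (d , δ) → d ℕ.< n × δ ℕ.< n}
  (λ n → Σ-enum (range n) (λ _ → range n))
  (λ (d , δ) → ℕ.m≤m*n (suc d) (suc δ) , ℕ.m≤n*m (suc δ) (suc d))

-- Zagier's involution on the solutions of x² + 4yz = N

x≡-x⇒x≡0 : ∀ x → x ≡ - x → x ≡ + 0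
x≡-x⇒x≡0 x e = halve (linear (+ 1 *[ e ]) (solve (x ∷ [])))

module Involution (c n : ℤ) where

  ℤ³ = ℤ × ℤ × ℤ

  -- In terms of x = 2ξ - c the equation reads x² + 4yz = 4n + c², so c = 0 and c = 1 cover even and
  -- odd x.
  Triple : ℤ³ → Set
  Triple (ξ , y , z) = + 0 ℤ.< y × + 0 ℤ.< z × ξ * (ξ - c) + y * z ≡ n

  δ : ℤ³ → ℤ
  δ (ξ , y , z) = z + (ξ + ξ) - c - y

  -- With x = 2ξ - c, `turn` sends (x, y, z) to (2y - x, y, x + z - y), the middle branch of
  -- Zagier's involution; `swap` gives (-x, z, y), under which δ = x + z - y changes sign; `flip`
  -- gives (-x, y, z).
  turn swap flip : ℤ³ → ℤ³
  turn v@(ξ , y , z) = y - ξ + c , y , δ v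
  swap (ξ , y , z) = c - ξ , z , y
  flip (ξ , y , z) = c - ξ , y , z

  private
    complement : ∀ ξ → c - (c - ξ) ≡ ξ
    complement ξ = solve (c ∷ ξ ∷ [])

    flip-eq : ∀ ξ y z → ξ * (ξ - c) + y * z ≡ n → (c - ξ) * (c - ξ - c) + y * z ≡ n
    flip-eq ξ y z e = linear (+ 1 *[ e ]) (solve (c ∷ n ∷ ξ ∷ y ∷ z ∷ []))

    swap-eq : ∀ ξ y z → ξ * (ξ - c) + y * z ≡ n → (c - ξ) * (c - ξ - c) + z * y ≡ n
    swap-eq ξ y z e = linear (+ 1 *[ e ]) (solve (c ∷ n ∷ ξ ∷ y ∷ z ∷ []))

    turn-eq : ∀ ξ y z → ξ * (ξ - c) + y * z ≡ n →
      (y - ξ + c) * (y - ξ + c - c) + y * (z + (ξ + ξ) - c - y) ≡ n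
    turn-eq ξ y z e = linear (+ 1 *[ e ]) (solve (c ∷ n ∷ ξ ∷ y ∷ z ∷ []))

    δ-swap : ∀ ξ y z → y + ((c - ξ) + (c - ξ)) - c - z ≡ - (z + (ξ + ξ) - c - y)
    δ-swap ξ y z = solve (c ∷ ξ ∷ y ∷ z ∷ [])

    δ-turn : ∀ ξ y z → z + (ξ + ξ) - c - y + ((y - ξ + c) + (y - ξ + c)) - c - y ≡ z
    δ-turn ξ y z = solve (c ∷ ξ ∷ y ∷ z ∷ [])

    turn-turn : ∀ ξ y → y - (y - ξ + c) + c ≡ ξ
    turn-turn ξ y = solve (c ∷ ξ ∷ y ∷ [])

  flip-≅ : Triple ≅ Triple
  flip-≅ = record { to = flip ; from = flip ; to-⊆ = valid _ ; from-⊆ = valid _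
    ; from-to = λ {(ξ , v)} _ → cong (_, v) (complement ξ)
    ; to-from = λ {(ξ , v)} _ → cong (_, v) (complement ξ) }
    where
    valid : ∀ v → Triple v → Triple (flip v)
    valid (ξ , y , z) (0<y , 0<z , e) = 0<y , 0<z , flip-eq ξ y z e

  Nonzero Positive : ℤ³ → Set
  Nonzero v = Triple v × δ v ≢ + 0
  Positive v = + 0 ℤ.< δ v

  swap-≅ : (λ v → Nonzero v × Positive v) ≅ (λ v → Nonzero v × ¬ Positive v)
  swap-≅ = record { to = swap ; from = swap
    ; to-⊆ = λ {v} ((t , δ≢0) , 0<δ) → (valid v t , nonzero v δ≢0) ,
        ℤ.<-asym (subst (ℤ._< + 0) (sym (negated v)) (ℤ.neg-mono-< 0<δ))
    ; from-⊆ = λ {v} ((t , δ≢0) , 0≮δ) → (valid v t , nonzero v δ≢0) ,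
        subst (+ 0 ℤ.<_) (sym (negated v)) (ℤ.neg-mono-< (ℤ.≤∧≢⇒< (ℤ.≮⇒≥ 0≮δ) δ≢0))
    ; from-to = λ {(ξ , v)} _ → cong (_, v) (complement ξ)
    ; to-from = λ {(ξ , v)} _ → cong (_, v) (complement ξ) }
    where
    negated : ∀ v → δ (swap v) ≡ - δ v
    negated (ξ , y , z) = δ-swap ξ y z
    valid : ∀ v → Triple v → Triple (swap v)
    valid (ξ , y , z) (0<y , 0<z , e) = 0<z , 0<y , swap-eq ξ y z e
    nonzero : ∀ v → δ v ≢ + 0 → δ (swap v) ≢ + 0
    nonzero v δ≢0 e = δ≢0 (ℤ.neg-injective (trans (sym (negated v)) e))

  turn-≅ : (λ v → Nonzero v × Positive v) ≅ (λ v → Nonzero v × Positive v)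
  turn-≅ = record { to = turn ; from = turn ; to-⊆ = valid _ ; from-⊆ = valid _
    ; from-to = λ {v} _ → involutive v ; to-from = λ {v} _ → involutive v }
    where
    involutive : ∀ v → turn (turn v) ≡ v
    involutive (ξ , y , z) = cong₂ (λ ξ′ z′ → ξ′ , y , z′) (turn-turn ξ y) (δ-turn ξ y z)
    valid : ∀ v → Nonzero v × Positive v → Nonzero (turn v) × Positive (turn v)
    valid (ξ , y , z) (((0<y , 0<z , e) , _) , 0<δ) =
      ((0<y , 0<δ , turn-eq ξ y z e) , ℤ.<⇒≢ 0<δ′ ∘ sym) , 0<δ′
      where
      0<δ′ : + 0 ℤ.< δ (turn (ξ , y , z))
      0<δ′ = subst (+ 0 ℤ.<_) (sym (δ-turn ξ y z)) 0<z

  -- Zagier's involution turn acts where δ > 0, while swap exchanges δ > 0 and δ < 0, so that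
  -- everything cancels except on the boundary δ = 0.
  ∑-boundary : (E : Enum Triple) (h g : ℤ³ → ℤ) →
    (∀ v → g (flip v) ≡ - g v) →
    (let f = λ v → h v + g v ; k = λ v → f v + f (swap v)) →
    (∀ v → Triple v → k (turn v) ≡ - k v) →
    ∑ E h ≡ ∑ (E ∩ (λ v → δ v ℤ.≟ + 0)) f
  ∑-boundary E h g odd anti = begin
    ∑ E h
      ≡⟨ ℤ.+-identityʳ (∑ E h) ⟨
    ∑ E h + + 0
      ≡⟨ cong (ℤ._+_ (∑ E h)) ∑g≡0 ⟨
    ∑ E h + ∑ E g
      ≡⟨ ∑-+ E h g ⟩
    ∑ E f
      ≡⟨ ∑-split E (λ v → δ v ℤ.≟ + 0) f ⟩
    ∑ (E ∩ (λ v → δ v ℤ.≟ + 0)) f + ∑ E′ f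
      ≡⟨ cong (ℤ._+_ (∑ (E ∩ (λ v → δ v ℤ.≟ + 0)) f)) ∑′f≡0 ⟩
    ∑ (E ∩ (λ v → δ v ℤ.≟ + 0)) f + + 0
      ≡⟨ ℤ.+-identityʳ _ ⟩
    ∑ (E ∩ (λ v → δ v ℤ.≟ + 0)) f
      ∎
    where
    open ≡-Reasoning
    f k : ℤ³ → ℤ
    f v = h v + g v
    k v = f v + f (swap v)
    E′ = E ∖ (λ v → δ v ℤ.≟ + 0)
    positive? : Decidable Positive
    positive? v = + 0 ℤ.<? δ v
    E⁺ = E′ ∩ positive?
    ∑g≡0 : ∑ E g ≡ + 0
    ∑g≡0 = x≡-x⇒x≡0 (∑ E g) (trans
      (∑-≅ flip-≅ E E g (λ v → - g v) (λ v _ → trans (sym (ℤ.neg-involutive (g v))) (cong -_ (sym (odd v)))))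
      (sym (∑-neg E g)))
    ∑⁺k≡0 : ∑ E⁺ k ≡ + 0
    ∑⁺k≡0 = x≡-x⇒x≡0 (∑ E⁺ k) (trans
      (∑-≅ turn-≅ E⁺ E⁺ k (λ v → - k v)
        (λ v ((t , _) , _) → trans (sym (ℤ.neg-involutive (k v))) (cong -_ (sym (anti v t)))))
      (sym (∑-neg E⁺ k)))
    ∑′f≡0 : ∑ E′ f ≡ + 0
    ∑′f≡0 = begin
      ∑ E′ f                           ≡⟨ ∑-split E′ positive? f ⟩
      ∑ E⁺ f + ∑ (E′ ∖ positive?) f
        ≡⟨ cong (ℤ._+_ (∑ E⁺ f)) (∑-≅ swap-≅ E⁺ (E′ ∖ positive?) (f ∘ swap) f (λ _ _ → refl)) ⟨
      ∑ E⁺ f + ∑ E⁺ (f ∘ swap)         ≡⟨ ∑-+ E⁺ f (f ∘ swap) ⟩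
      ∑ E⁺ k                           ≡⟨ ∑⁺k≡0 ⟩
      + 0                              ∎

open Involution using (Triple; ℤ³)

suc-pred : ∀ {y} → + 0 ℤ.< y → + suc (ℕ.pred ∣ y ∣) ≡ y
suc-pred (ℤ.+<+ (s≤s _)) = refl

+suc-positive : ∀ n → + 0 ℤ.< + suc n
+suc-positive n = ℤ.+<+ (s≤s z≤n)

triple-≅ : ∀ c (G : Graded ℤ) → (∀ ξ → + deg G ξ ≡ ξ * (ξ - c)) → ∀ n →
  (λ ((ξ , d , δ) : ℤ × ℕ × ℕ) → deg G ξ ℕ.+ suc d ℕ.* suc δ ≡ n) ≅ Triple c (+ n)
triple-≅ c G degG n = record
  { to = λ (ξ , d , δ) → ξ , + suc d , + suc δ
  ; from = λ (ξ , y , z) → ξ , ℕ.pred ∣ y ∣ , ℕ.pred ∣ z ∣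
  ; to-⊆ = λ {(ξ , d , δ)} e → +suc-positive d , +suc-positive δ , trans (sym (equation ξ d δ)) (cong +_ e)
  ; from-⊆ = λ {(ξ , y , z)} (0<y , 0<z , e) → ℤ.+-injective (trans (equation ξ (ℕ.pred ∣ y ∣) (ℕ.pred ∣ z ∣))
      (trans (cong₂ (λ y z → ξ * (ξ - c) + y * z) (suc-pred 0<y) (suc-pred 0<z)) e))
  ; from-to = λ _ → refl
  ; to-from = λ {(ξ , y , z)} (0<y , 0<z , _) → cong₂ (λ y z → ξ , y , z) (suc-pred 0<y) (suc-pred 0<z) }
  where
  equation : ∀ ξ d δ → + (deg G ξ ℕ.+ suc d ℕ.* suc δ) ≡ ξ * (ξ - c) + + suc d * + suc δ
  equation ξ d δ = cong₂ _+_ (degG ξ) (ℤ.pos-* (suc d) (suc δ))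

2triG : Graded ℤ
2triG = scale 2 triG

deg-2triG : ∀ ξ → + (2 ℕ.* triN ξ) ≡ ξ * (ξ - + 1)
deg-2triG ξ = trans (ℤ.pos-* 2 (triN ξ)) (2*triZ ξ)

deg-sqG : ∀ ξ → + sqN ξ ≡ ξ * (ξ - + 0)
deg-sqG ξ = trans (+sqN ξ) (cong (ξ *_) (sym (ℤ.+-identityʳ ξ)))

oddTriples : ∀ n → Enum (Triple (+ 1) (+ n))
oddTriples n = transport (triple-≅ (+ 1) 2triG deg-2triG n) (fibre (2triG ⊗ pairG) n)

evenTriples : ∀ n → Enum (Triple (+ 0) (+ n))
evenTriples n = transport (triple-≅ (+ 0) sqG deg-sqG n) (fibre (sqG ⊗ pairG) n)

ε-odd : ∀ x → ε x ≡ - + 1 → ∃ λ w → x ≡ w + w + + 1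
ε-odd (+ n) e with go n e
  where
  go : ∀ n → alternating n ≡ - + 1 → ∃ λ k → n ≡ suc (k ℕ.+ k)
  go (suc zero) e = 0 , refl
  go (suc (suc n)) e with go n (trans (sym (ℤ.neg-involutive (alternating n))) e)
  ... | k , refl = suc k , cong (suc ∘ suc) (sym (ℕ.+-suc k k))
... | k , refl = + k , ℤ.+-comm (+ 1) (+ k + + k)
ε-odd x@(-[1+ n ]) e with ε-odd (+ suc n) e
... | w , e′ = - w - + 1 , linear (- + 1 *[ e′ ]) (lemma (+ suc n) w)
  where
  lemma : ∀ s w → - s - (- w - + 1 + (- w - + 1) + + 1) ≡ - + 1 * (s - (w + w + + 1))
  lemma = solve-∀

ε-odd-* : ∀ y z → ε y ≡ - + 1 → ε z ≡ - + 1 → ε (y * z) ≡ - + 1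
ε-odd-* y z p q with ε-odd y p | ε-odd z q
... | a , refl | b , refl = trans (cong ε (expand a b))
  (trans (ε-+ (w + w) (+ 1)) (cong (_* - + 1) (ε-double w)))
  where
  w = a * b + a * b + a + b
  expand : ∀ a b → (a + a + + 1) * (b + b + + 1) ≡
    (a * b + a * b + a + b) + (a * b + a * b + a + b) + + 1
  expand = solve-∀

-- The argument on the left is the third coordinate after `turn`. Its parity does not involve ξ, so
-- the new signs of y and z are functions of the old ones.
ε-ξ : ∀ z ξ c y → ε (z + (ξ + ξ) - c - y) ≡ ε z * ε c * ε y
ε-ξ z ξ c y = begin
  ε (z + (ξ + ξ) - c - y)               ≡⟨ ε-+ (z + (ξ + ξ) - c) (- y) ⟩
  ε (z + (ξ + ξ) - c) * ε (- y)         ≡⟨ cong₂ _*_ (ε-+ (z + (ξ + ξ)) (- c)) (ε-neg y) ⟩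
  ε (z + (ξ + ξ)) * ε (- c) * ε y       ≡⟨ cong₂ (λ s t → s * t * ε y) (ε-+ z (ξ + ξ)) (ε-neg c) ⟩
  ε z * ε (ξ + ξ) * ε c * ε y           ≡⟨ cong (λ s → ε z * s * ε c * ε y) (ε-double ξ) ⟩
  ε z * + 1 * ε c * ε y                 ≡⟨ cong (λ s → s * ε c * ε y) (ℤ.*-identityʳ (ε z)) ⟩
  ε z * ε c * ε y                       ∎
  where open ≡-Reasoning

-- The three instances of ∑-boundary

module Psi (n : ℕ) where
  N = + (2 ℕ.* n)
  open Involution (+ 1) N using (δ; turn; swap; flip; ∑-boundary)

  -- `H` is four times the wanted weight -ε(y) y on even z, and 0 on odd z. `G` is odd in x = 2ξ -
  -- 1, so it does not affect the sum; it is chosen to make the symmetrised weight `K` change sign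
  -- under `turn`. The signs ε y and ε z are separate arguments so that a case split on them leaves
  -- polynomials.
  H G K : (ey ez x y z : ℤ) → ℤ
  H ey ez x y z = - (+ 2 * (+ 1 + ez) * ey * y)
  G ey ez x y z = - ((+ 1 + ez) * (+ 1 - ey) * x)
  K ey ez x y z = (H ey ez x y z + G ey ez x y z) + (H ez ey (- x) z y + G ez ey (- x) z y)

  h g f k : ℤ³ (+ 1) N → ℤ
  h (ξ , y , z) = H (ε y) (ε z) (ξ + ξ - + 1) y z
  g (ξ , y , z) = G (ε y) (ε z) (ξ + ξ - + 1) y z
  f v = h v + g v
  k v = f v + f (swap v)

  odd : ∀ v → g (flip v) ≡ - g v
  odd (ξ , y , z) = lemma (+ 1 + ε z) (+ 1 - ε y) ξ
    where
    lemma : ∀ s t ξ → - (s * t * (+ 1 - ξ + (+ 1 - ξ) - + 1)) ≡ - - (s * t * (ξ + ξ - + 1))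
    lemma = solve-∀

  k≡K : ∀ ξ y z → k (ξ , y , z) ≡ K (ε y) (ε z) (ξ + ξ - + 1) y z
  k≡K ξ y z = cong (λ x → f (ξ , y , z) + (H (ε z) (ε y) x z y + G (ε z) (ε y) x z y)) (lemma ξ)
    where
    lemma : ∀ ξ → + 1 - ξ + (+ 1 - ξ) - + 1 ≡ - (ξ + ξ - + 1)
    lemma = solve-∀

  -- For fixed signs this is a polynomial identity. `turn` replaces x by 2y - x and gives the third
  -- coordinate the sign -ε(z) ε(y), whence `ez * - + 1 * ey`. The pattern with y and z both odd
  -- does not cancel and has to be excluded by parity.
  cancels : ∀ ey ez ξ y z → ey ≡ + 1 ⊎ ey ≡ - + 1 → ez ≡ + 1 ⊎ ez ≡ - + 1 → ¬ (ey ≡ - + 1 × ez ≡ - + 1) →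
    K ey (ez * - + 1 * ey) (+ 2 * y - (ξ + ξ - + 1)) y (z + (ξ + ξ) - + 1 - y) ≡ - K ey ez (ξ + ξ - + 1) y z
  cancels ey ez ξ y z (inj₁ refl) (inj₁ refl) _ = lemma₁ ξ y z
    where
    lemma₁ : ∀ ξ y z → (- (+ 0 * y) + - (+ 0 * (+ 2 * y - (ξ + ξ - + 1)))) +
        (- (-[1+ 3 ] * (z + (ξ + ξ) - + 1 - y)) + - (+ 4 * - (+ 2 * y - (ξ + ξ - + 1))))
      ≡ - ((- (+ 4 * y) + - (+ 0 * (ξ + ξ - + 1))) + (- (+ 4 * z) + - (+ 0 * - (ξ + ξ - + 1))))
    lemma₁ = solve-∀
  cancels ey ez ξ y z (inj₁ refl) (inj₂ refl) _ = lemma₂ ξ y z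
    where
    lemma₂ : ∀ ξ y z → (- (+ 4 * y) + - (+ 0 * (+ 2 * y - (ξ + ξ - + 1)))) +
        (- (+ 4 * (z + (ξ + ξ) - + 1 - y)) + - (+ 0 * - (+ 2 * y - (ξ + ξ - + 1))))
      ≡ - ((- (+ 0 * y) + - (+ 0 * (ξ + ξ - + 1))) + (- (-[1+ 3 ] * z) + - (+ 4 * - (ξ + ξ - + 1))))
    lemma₂ = solve-∀
  cancels ey ez ξ y z (inj₂ refl) (inj₁ refl) _ = lemma₃ ξ y z
    where
    lemma₃ : ∀ ξ y z → (- (-[1+ 3 ] * y) + - (+ 4 * (+ 2 * y - (ξ + ξ - + 1)))) +
        (- (+ 0 * (z + (ξ + ξ) - + 1 - y)) + - (+ 0 * - (+ 2 * y - (ξ + ξ - + 1))))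
      ≡ - ((- (-[1+ 3 ] * y) + - (+ 4 * (ξ + ξ - + 1))) + (- (+ 0 * z) + - (+ 0 * - (ξ + ξ - + 1))))
    lemma₃ = solve-∀
  cancels ey ez ξ y z (inj₂ p) (inj₂ q) ¬odd = ⊥-elim (¬odd (p , q))

  -- Both ξ(ξ - 1) and `N` are even, hence so is y z.
  not-odd : ∀ ξ y z → ξ * (ξ - + 1) + y * z ≡ N → ¬ (ε y ≡ - + 1 × ε z ≡ - + 1)
  not-odd ξ y z e (p , q) = contradiction (trans (sym (ε-double (+ n))) (trans (cong ε e′)
    (trans (ε-+ (triZ ξ + triZ ξ) (y * z)) (cong₂ _*_ (ε-double (triZ ξ)) (ε-odd-* y z p q)))))
    where
    contradiction : ¬ (+ 1 ≡ - + 1)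
    contradiction ()
    lemma : ∀ t yz n q N → + 2 * t ≡ q → q + yz ≡ N → N ≡ + 2 * n → n + n ≡ t + t + yz
    lemma t yz n q N e₁ e₂ e₃ = linear (- + 1 *[ e₁ ] ⊕ (- + 1) *[ e₂ ] ⊕ (- + 1) *[ e₃ ])
      (solve (t ∷ yz ∷ n ∷ q ∷ N ∷ []))
    e′ : + n + + n ≡ triZ ξ + triZ ξ + y * z
    e′ = lemma (triZ ξ) (y * z) (+ n) (ξ * (ξ - + 1)) N (2*triZ ξ) e (ℤ.pos-* 2 n)

  anti : ∀ v → Triple (+ 1) N v → k (turn v) ≡ - k v
  anti v@(ξ , y , z) (_ , _ , e) = begin
    k (turn v)
      ≡⟨ k≡K (y - ξ + + 1) y z′ ⟩
    K (ε y) (ε z′) (y - ξ + + 1 + (y - ξ + + 1) - + 1) y z′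
      ≡⟨ cong₂ (λ s x → K (ε y) s x y z′) (ε-ξ z ξ (+ 1) y) (lemma ξ y) ⟩
    K (ε y) (ε z * - + 1 * ε y) (+ 2 * y - (ξ + ξ - + 1)) y z′
      ≡⟨ cancels (ε y) (ε z) ξ y z (ε-sign y) (ε-sign z) (not-odd ξ y z e) ⟩
    - K (ε y) (ε z) (ξ + ξ - + 1) y z
      ≡⟨ cong -_ (k≡K ξ y z) ⟨
    - k v
      ∎
    where
    open ≡-Reasoning
    z′ = z + (ξ + ξ) - + 1 - y
    lemma : ∀ ξ y → y - ξ + + 1 + (y - ξ + + 1) - + 1 ≡ + 2 * y - (ξ + ξ - + 1)
    lemma = solve-∀

  boundary : ∑ (oddTriples (2 ℕ.* n)) h ≡ ∑ (oddTriples (2 ℕ.* n) ∩ (λ v → δ v ℤ.≟ + 0)) f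
  boundary = ∑-boundary (oddTriples (2 ℕ.* n)) h g odd anti

module Phi (n : ℕ) where
  N = + n
  open Involution (+ 0) N using (δ; turn; swap; flip; ∑-boundary)

  -- `H` keeps the odd z, with s = ε ξ; up to sign it is the weight of Φ times `μ-weight`. `G` is
  -- odd in x, which is ξ itself because c = 0. `turn` multiplies s by ε(y), and the sign patterns
  -- with odd y rely on this.
  H G K : (ey ez s x y z : ℤ) → ℤ
  H ey ez s x y z = (+ 1 - ez) * s * y
  G ey ez s x y z = - ((+ 1 - ez) * (+ 1 + ey) * s * x)
  K ey ez s x y z = (H ey ez s x y z + G ey ez s x y z)
    + (H ez ey s (+ 0 - x) z y + G ez ey s (+ 0 - x) z y)

  h g f k : ℤ³ (+ 0) N → ℤ
  h (ξ , y , z) = H (ε y) (ε z) (ε ξ) ξ y z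
  g (ξ , y , z) = G (ε y) (ε z) (ε ξ) ξ y z
  f v = h v + g v
  k v = f v + f (swap v)

  ε-reflect : ∀ ξ → ε (+ 0 - ξ) ≡ ε ξ
  ε-reflect ξ = trans (cong ε (ℤ.+-identityˡ (- ξ))) (ε-neg ξ)

  odd : ∀ v → g (flip v) ≡ - g v
  odd (ξ , y , z) = trans (cong (λ s → G (ε y) (ε z) s (+ 0 - ξ) y z) (ε-reflect ξ))
    (lemma (+ 1 - ε z) (+ 1 + ε y) (ε ξ) ξ)
    where
    lemma : ∀ s t u ξ → - (s * t * u * (+ 0 - ξ)) ≡ - - (s * t * u * ξ)
    lemma = solve-∀

  k≡K : ∀ ξ y z → k (ξ , y , z) ≡ K (ε y) (ε z) (ε ξ) ξ y z
  k≡K ξ y z = cong (λ s → f (ξ , y , z) + (H (ε z) (ε y) s (+ 0 - ξ) z y + G (ε z) (ε y) s (+ 0 - ξ) z y))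
    (ε-reflect ξ)

  cancels : ∀ ey ez s ξ y z → ey ≡ + 1 ⊎ ey ≡ - + 1 → ez ≡ + 1 ⊎ ez ≡ - + 1 →
    K ey (ez * + 1 * ey) (ey * s) (y - ξ + + 0) y (z + (ξ + ξ) - + 0 - y) ≡ - K ey ez s ξ y z
  cancels ey ez s ξ y z (inj₁ refl) (inj₁ refl) = lemma₁ s ξ y z
    where
    lemma₁ : ∀ s ξ y z → (+ 0 * (+ 1 * s) * y + - (+ 0 * (+ 1 * s) * (y - ξ + + 0))) +
        (+ 0 * (+ 1 * s) * (z + (ξ + ξ) - + 0 - y) + - (+ 0 * (+ 1 * s) * (+ 0 - (y - ξ + + 0))))
      ≡ - ((+ 0 * s * y + - (+ 0 * s * ξ)) + (+ 0 * s * z + - (+ 0 * s * (+ 0 - ξ))))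
    lemma₁ = solve-∀
  cancels ey ez s ξ y z (inj₁ refl) (inj₂ refl) = lemma₂ s ξ y z
    where
    lemma₂ : ∀ s ξ y z → (+ 2 * (+ 1 * s) * y + - (+ 4 * (+ 1 * s) * (y - ξ + + 0))) +
        (+ 0 * (+ 1 * s) * (z + (ξ + ξ) - + 0 - y) + - (+ 0 * (+ 1 * s) * (+ 0 - (y - ξ + + 0))))
      ≡ - ((+ 2 * s * y + - (+ 4 * s * ξ)) + (+ 0 * s * z + - (+ 0 * s * (+ 0 - ξ))))
    lemma₂ = solve-∀
  cancels ey ez s ξ y z (inj₂ refl) (inj₁ refl) = lemma₃ s ξ y z
    where
    lemma₃ : ∀ s ξ y z → (+ 2 * (-[1+ 0 ] * s) * y + - (+ 0 * (-[1+ 0 ] * s) * (y - ξ + + 0))) +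
        (+ 2 * (-[1+ 0 ] * s) * (z + (ξ + ξ) - + 0 - y) + - (+ 0 * (-[1+ 0 ] * s) * (+ 0 - (y - ξ + + 0))))
      ≡ - ((+ 0 * s * y + - (+ 0 * s * ξ)) + (+ 2 * s * z + - (+ 4 * s * (+ 0 - ξ))))
    lemma₃ = solve-∀
  cancels ey ez s ξ y z (inj₂ refl) (inj₂ refl) = lemma₄ s ξ y z
    where
    lemma₄ : ∀ s ξ y z → (+ 0 * (-[1+ 0 ] * s) * y + - (+ 0 * (-[1+ 0 ] * s) * (y - ξ + + 0))) +
        (+ 2 * (-[1+ 0 ] * s) * (z + (ξ + ξ) - + 0 - y) + - (+ 4 * (-[1+ 0 ] * s) * (+ 0 - (y - ξ + + 0))))
      ≡ - ((+ 2 * s * y + - (+ 0 * s * ξ)) + (+ 2 * s * z + - (+ 0 * s * (+ 0 - ξ))))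
    lemma₄ = solve-∀

  ε-turn : ∀ ξ y → ε (y - ξ + + 0) ≡ ε y * ε ξ
  ε-turn ξ y = trans (cong ε (ℤ.+-identityʳ (y - ξ))) (trans (ε-+ y (- ξ)) (cong (ε y *_) (ε-neg ξ)))

  anti : ∀ v → Triple (+ 0) N v → k (turn v) ≡ - k v
  anti v@(ξ , y , z) (_ , _ , e) = begin
    k (turn v)
      ≡⟨ k≡K (y - ξ + + 0) y z′ ⟩
    K (ε y) (ε z′) (ε (y - ξ + + 0)) (y - ξ + + 0) y z′
      ≡⟨ cong₂ (λ s t → K (ε y) s t (y - ξ + + 0) y z′) (ε-ξ z ξ (+ 0) y) (ε-turn ξ y) ⟩
    K (ε y) (ε z * + 1 * ε y) (ε y * ε ξ) (y - ξ + + 0) y z′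
      ≡⟨ cancels (ε y) (ε z) (ε ξ) ξ y z (ε-sign y) (ε-sign z) ⟩
    - K (ε y) (ε z) (ε ξ) ξ y z
      ≡⟨ cong -_ (k≡K ξ y z) ⟨
    - k v
      ∎
    where
    open ≡-Reasoning
    z′ = z + (ξ + ξ) - + 0 - y

  boundary : ∑ (evenTriples n) h ≡ ∑ (evenTriples n ∩ (λ v → δ v ℤ.≟ + 0)) f
  boundary = ∑-boundary (evenTriples n) h g odd anti

module Sigma (n : ℕ) where
  N = + suc (2 ℕ.* n)
  open Involution (+ 1) N using (δ; turn; swap; flip; ∑-boundary)

  -- With x = 2ξ - 1, `h` is y (yz - x²). For ξ(ξ - 1)/2 = i and yz = 2j + 1 the bracket equals 2 (j
  -- - 4i), and j - 4i is the coefficient in the recurrence of a fourth power. The auxiliary `g` is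
  -- x y².
  h g f k : ℤ³ (+ 1) N → ℤ
  h (ξ , y , z) = y * (y * z - (ξ + ξ - + 1) * (ξ + ξ - + 1))
  g (ξ , y , z) = (ξ + ξ - + 1) * y * y
  f v = h v + g v
  k v = f v + f (swap v)

  odd : ∀ v → g (flip v) ≡ - g v
  odd (ξ , y , z) = lemma ξ y
    where
    lemma : ∀ ξ y → (+ 1 - ξ + (+ 1 - ξ) - + 1) * y * y ≡ - ((ξ + ξ - + 1) * y * y)
    lemma = solve-∀

  -- With x = 2ξ - 1, `turn` exchanges y + z with z + x and negates y - x, so the factored form
  -- makes the change of sign of `k` visible.
  factorised : ∀ ξ y z → k (ξ , y , z) ≡ (y + z) * (y - (ξ + ξ - + 1)) * (z + (ξ + ξ - + 1))
  factorised ξ y z = lemma ξ y z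
    where
    lemma : ∀ ξ y z →
      (y * (y * z - (ξ + ξ - + 1) * (ξ + ξ - + 1)) + (ξ + ξ - + 1) * y * y)
      + (z * (z * y - (+ 1 - ξ + (+ 1 - ξ) - + 1) * (+ 1 - ξ + (+ 1 - ξ) - + 1)) +
          (+ 1 - ξ + (+ 1 - ξ) - + 1) * z * z)
      ≡ (y + z) * (y - (ξ + ξ - + 1)) * (z + (ξ + ξ - + 1))
    lemma = solve-∀

  anti : ∀ v → Triple (+ 1) N v → k (turn v) ≡ - k v
  anti v@(ξ , y , z) _ = trans (factorised (y - ξ + + 1) y (δ v))
    (trans (lemma ξ y z) (cong -_ (sym (factorised ξ y z))))
    where
    lemma : ∀ ξ y z → (y + (z + (ξ + ξ) - + 1 - y)) * (y - (y - ξ + + 1 + (y - ξ + + 1) - + 1))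
      * (z + (ξ + ξ) - + 1 - y + (y - ξ + + 1 + (y - ξ + + 1) - + 1))
      ≡ - ((y + z) * (y - (ξ + ξ - + 1)) * (z + (ξ + ξ - + 1)))
    lemma = solve-∀

  -- On δ = 0 the form becomes (y - ξ)(y - ξ + 1), a product of consecutive integers, while `N` is
  -- odd.
  no-boundary : ∀ v → ¬ (Triple (+ 1) N v × δ v ≡ + 0)
  no-boundary (ξ , y , z) ((_ , _ , e) , δ≡0) = contradiction
    (trans (sym (ε-double (triZ (y - ξ + + 1))))
        (trans (cong ε parity) (trans (ε-+ (+ n + + n) (+ 1)) (cong (_* - + 1) (ε-double (+ n))))))
    where
    contradiction : ¬ (+ 1 ≡ - + 1)
    contradiction ()
    lemma : ∀ ξ y z n N t → ξ * (ξ - + 1) + y * z ≡ N → z + (ξ + ξ) - + 1 - y ≡ + 0 → N ≡ + 1 + + 2 * n →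
      + 2 * t ≡ (y - ξ + + 1) * (y - ξ + + 1 - + 1) → t + t ≡ n + n + + 1
    lemma ξ y z n N t e₁ e₂ e₃ e₄ = linear (+ 1 *[ e₁ ] ⊕ (- y) *[ e₂ ] ⊕ + 1 *[ e₃ ] ⊕ + 1 *[ e₄ ])
      (solve (ξ ∷ y ∷ z ∷ n ∷ N ∷ t ∷ []))
    parity : triZ (y - ξ + + 1) + triZ (y - ξ + + 1) ≡ + n + + n + + 1
    parity = lemma ξ y z (+ n) N (triZ (y - ξ + + 1)) e δ≡0
      (cong (ℤ._+_ (+ 1)) (ℤ.pos-* 2 n)) (2*triZ (y - ξ + + 1))

  vanishes : ∑ (oddTriples (suc (2 ℕ.* n))) h ≡ + 0
  vanishes = trans (∑-boundary (oddTriples (suc (2 ℕ.* n))) h g odd anti)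
    (∑-empty (oddTriples (suc (2 ℕ.* n)) ∩ (λ v → δ v ℤ.≟ + 0)) no-boundary)

open Involution using (δ)

-- The logarithmic derivatives of ψ(q) and φ(-q)

triangleG : Graded ℕ
triangleG = bounded triangle {λ n k → k ℕ.< suc n} (range ∘ suc) (s≤s ∘ k≤triangle)

squareG : Graded ℕ
squareG = bounded (λ r → r ℕ.* r) {λ n k → k ℕ.< suc n} (range ∘ suc) (s≤s ∘ k≤k*k)

-- The sums run over all integers: in Ramanujan's notation Ψ = 2 ψ(q) and Φ = φ(-q).
Ψ Φ : Series
Ψ = gen triG (λ _ → + 1)
Φ = gen sqG ε

-- The divisor sums that ψ(q) = ∏ (1 - q^2k)²/(1 - q^k) and φ(-q) = ∏ (1 - q^k)²/(1 - q^2k) lead one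
-- to expect. The parity condition falls on the divisor in the first and on the codivisor in the
-- second.
λ-weight μ-weight : ℕ × ℕ → ℤ
λ-weight (d , _) = - (ε (+ suc d) * + suc d)
μ-weight (d , δ) = - ((+ 1 - ε (+ suc δ)) * + suc d)

positive? : Decidable (λ x → + 0 ℤ.< x)
positive? x = + 0 ℤ.<? x

Ψ-card : ∀ n → Ψ n ≡ + 2 * card (fibre triangleG n)
Ψ-card n = trans (∑-split (fibre triG n) positive? (λ _ → + 1))
  (trans (cong₂ _+_ (sym (∑-≅ pos T (fibre triG n ∩ positive?) (λ _ → + 1) (λ _ → + 1) (λ _ _ → refl)))
                    (sym (∑-≅ neg T (fibre triG n ∖ positive?) (λ _ → + 1) (λ _ → + 1) (λ _ _ → refl))))
         (double (card T)))
  where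
  T = fibre triangleG n
  double : ∀ x → x + x ≡ + 2 * x
  double = solve-∀
  triN-neg : ∀ p → triN (- + p) ≡ triangle p
  triN-neg zero = refl
  triN-neg (suc p) = refl
  0≮-p : ∀ p → ¬ (+ 0 ℤ.< - + p)
  0≮-p zero (ℤ.+<+ ())
  0≮-p (suc p) ()
  pos : (λ p → triangle p ≡ n) ≅ (λ x → triN x ≡ n × + 0 ℤ.< x)
  pos = record { to = λ p → + suc p ; from = λ x → ℕ.pred ∣ x ∣
    ; to-⊆ = λ {p} e → e , +suc-positive p
    ; from-⊆ = λ { (e , ℤ.+<+ (s≤s _)) → e }
    ; from-to = λ _ → refl ; to-from = λ (_ , 0<x) → suc-pred 0<x }
  neg : (λ p → triangle p ≡ n) ≅ (λ x → triN x ≡ n × ¬ (+ 0 ℤ.< x))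
  neg = record { to = λ p → - + p ; from = ∣_∣
    ; to-⊆ = λ {p} e → trans (triN-neg p) e , 0≮-p p
    ; from-⊆ = λ { {+ zero} (e , _) → e ; {+ suc x} (_ , 0≮x) → ⊥-elim (0≮x (+suc-positive x)) ; { -[1+ x ]}
        (e , _) → e }
    ; from-to = λ {p} _ → ℤ.∣-i∣≡∣i∣ (+ p)
    ; to-from = λ { {+ zero} _ → refl ; {+ suc x} (_ , 0≮x) → ⊥-elim (0≮x (+suc-positive x)) ; { -[1+ x ]} _
        → refl } }

-- Restricted to positive degrees, because the root 0 is its own negative and would be counted once.
Φ-sum : ∀ n → Φ (suc n) ≡ + 2 * ∑ (fibre squareG (suc n)) (λ r → ε (+ r))
Φ-sum n = trans (∑-split (fibre sqG (suc n)) positive? ε)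
  (trans (cong₂ _+_ (sym (∑-≅ pos R (fibre sqG (suc n) ∩ positive?) (λ r → ε (+ r)) ε (λ _ _ → refl)))
                    (sym (∑-≅ neg R (fibre sqG (suc n) ∖ positive?) (λ r → ε (+ r)) ε
                        (λ r _ → sym (ε-neg (+ r))))))
         (double (∑ R (λ r → ε (+ r)))))
  where
  R = fibre squareG (suc n)
  double : ∀ x → x + x ≡ + 2 * x
  double = solve-∀
  pos : (λ r → r ℕ.* r ≡ suc n) ≅ (λ x → sqN x ≡ suc n × + 0 ℤ.< x)
  pos = record { to = +_ ; from = ∣_∣
    ; to-⊆ = λ { {suc r} e → e , +suc-positive r }
    ; from-⊆ = λ (e , _) → e
    ; from-to = λ _ → refl ; to-from = λ { (_ , ℤ.+<+ _) → refl } }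
  neg : (λ r → r ℕ.* r ≡ suc n) ≅ (λ x → sqN x ≡ suc n × ¬ (+ 0 ℤ.< x))
  neg = record { to = λ r → - + r ; from = ∣_∣
    ; to-⊆ = λ { {suc r} e → e , λ () }
    ; from-⊆ = λ (e , _) → e
    ; from-to = λ {r} _ → ℤ.∣-i∣≡∣i∣ (+ r)
    ; to-from = λ { {+ zero} (() , _) ; {+ suc x} (_ , 0≮x) → ⊥-elim (0≮x (+suc-positive x)) ; { -[1+ x ]} _
        → refl } }

alternating-double : ∀ k → alternating (k ℕ.+ k) ≡ + 1
alternating-double k = ε-double (+ k)

-- On the boundary z = k + 1 and the terms are the values of the weight there; only even z
-- contribute, giving 4 (2 + 4 + ... + 2p) = 4 p (p + 1).
∑-odd-triangle : ∀ p → ∑ (range (p ℕ.+ p)) (λ k → + 2 * (+ 1 - alternating k) * + suc k) ≡ + 8 * + triangle p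
∑-odd-triangle zero = ∑-range-zero (λ k → + 2 * (+ 1 - alternating k) * + suc k)
∑-odd-triangle (suc p) = begin
  ∑ (range (suc p ℕ.+ suc p)) u                        ≡⟨ cong (λ m → ∑ (range (suc m)) u) (ℕ.+-suc p p) ⟩
  ∑ (range (suc (suc (p ℕ.+ p)))) u                    ≡⟨ ∑-range-suc (suc (p ℕ.+ p)) u ⟩
  ∑ (range (suc (p ℕ.+ p))) u + u (suc (p ℕ.+ p))      ≡⟨ cong (_+ u (suc (p ℕ.+ p)))
      (∑-range-suc (p ℕ.+ p) u) ⟩
  ∑ (range (p ℕ.+ p)) u + u (p ℕ.+ p) + u (suc (p ℕ.+ p))
    ≡⟨ cong₂ (λ s e → s + + 2 * (+ 1 - e) * + suc (p ℕ.+ p) + + 2 * (+ 1 - - e) * + suc (suc (p ℕ.+ p)))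
         (∑-odd-triangle p) (alternating-double p) ⟩
  + 8 * + triangle p + + 0 * + suc (p ℕ.+ p) + + 4 * + suc (suc (p ℕ.+ p))
    ≡⟨ lemma (+ triangle p) (+ p) ⟩
  + 8 * + triangle (suc p)
    ∎
  where
  open ≡-Reasoning
  u : ℕ → ℤ
  u k = + 2 * (+ 1 - alternating k) * + suc k
  lemma : ∀ t p → + 8 * t + + 0 * (+ 1 + (p + p)) + + 4 * (+ 2 + (p + p)) ≡ + 8 * (+ 1 + p + t)
  lemma = solve-∀

-- On the boundary y = k + 1 runs up to 2r - 1, and the odd values give 2 (1 + 3 + ... + (2r - 1)).
∑-odd-square : ∀ r → ∑ (range (r ℕ.+ r ℕ.∸ 1)) (λ k → (+ 1 - alternating (suc k)) * + suc k) ≡ + 2 * + (r ℕ.* r)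
∑-odd-square zero = ∑-range-zero (λ k → (+ 1 - alternating (suc k)) * + suc k)
∑-odd-square (suc q) = trans (cong (λ m → ∑ (range m) u) (ℕ.+-suc q q))
    (trans (go q) (cong (+ 2 *_) (sym (ℤ.pos-* (suc q) (suc q)))))
  where
  open ≡-Reasoning
  u : ℕ → ℤ
  u k = (+ 1 - alternating (suc k)) * + suc k
  lemma : ∀ q → + 2 * ((+ 1 + q) * (+ 1 + q)) + + 0 * (+ 2 + (q + q)) + + 2 * (+ 3 + (q + q)) ≡ + 2 *
      ((+ 2 + q) * (+ 2 + q))
  lemma = solve-∀
  go : ∀ q → ∑ (range (suc (q ℕ.+ q))) u ≡ + 2 * (+ suc q * + suc q)
  go zero = trans (∑-range-suc 0 u) (cong (_+ u 0) (∑-range-zero u))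
  go (suc q) = begin
    ∑ (range (suc (suc q ℕ.+ suc q))) u                     ≡⟨ cong (λ m → ∑ (range (suc (suc m))) u)
        (ℕ.+-suc q q) ⟩
    ∑ (range (3 ℕ.+ (q ℕ.+ q))) u                           ≡⟨ ∑-range-suc (2 ℕ.+ (q ℕ.+ q)) u ⟩
    ∑ (range (2 ℕ.+ (q ℕ.+ q))) u + u (2 ℕ.+ (q ℕ.+ q))     ≡⟨ cong (_+ u (2 ℕ.+ (q ℕ.+ q)))
        (∑-range-suc (1 ℕ.+ (q ℕ.+ q)) u) ⟩
    ∑ (range (1 ℕ.+ (q ℕ.+ q))) u + u (1 ℕ.+ (q ℕ.+ q)) + u (2 ℕ.+ (q ℕ.+ q))
      ≡⟨ cong₂ (λ s e → s + (+ 1 - - - e) * + (2 ℕ.+ (q ℕ.+ q)) + (+ 1 - - - - e) * + (3 ℕ.+ (q ℕ.+ q)))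
           (go q) (alternating-double q) ⟩
    + 2 * (+ suc q * + suc q) + + 0 * + (2 ℕ.+ (q ℕ.+ q)) + + 2 * + (3 ℕ.+ (q ℕ.+ q))
      ≡⟨ lemma (+ q) ⟩
    + 2 * (+ suc (suc q) * + suc (suc q)) ∎

half-even : ∀ δ → ℕ.⌊ suc (δ ℕ.+ δ) /2⌋ ≡ δ
half-even zero = refl
half-even (suc δ) = trans (cong (λ m → ℕ.⌊ suc (suc m) /2⌋) (ℕ.+-suc δ δ)) (cong suc (half-even δ))

half-odd : ∀ δ → alternating (suc δ) ≡ + 1 → suc (ℕ.⌊ δ /2⌋ ℕ.+ ℕ.⌊ δ /2⌋) ≡ δ
half-odd (suc zero) e = refl
half-odd (suc (suc δ)) e = cong suc (trans (cong suc (ℕ.+-suc _ _))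
  (cong suc (half-odd δ (trans (sym (ℤ.neg-involutive (alternating (suc δ)))) e))))

-- The weight lives on even z. For z = 2z′ the equation ξ(ξ - 1) + yz = 2n halves to ξ(ξ - 1)/2 +
-- yz′ = n. In the shifted index z = δ + 1 this means δ = 2δ′ + 1, hence the floor.
halve-≅ : ∀ n → (λ ((ξ , d , δ) : ℤ × ℕ × ℕ) → triN ξ ℕ.+ suc d ℕ.* suc δ ≡ n) ≅
  (λ ((ξ , d , δ) : ℤ × ℕ × ℕ) → (2 ℕ.* triN ξ ℕ.+ suc d ℕ.* suc δ ≡ 2 ℕ.* n) × alternating (suc δ) ≡ + 1)
halve-≅ n = record
  { to = λ (ξ , d , δ) → ξ , d , suc (δ ℕ.+ δ)
  ; from = λ (ξ , d , δ) → ξ , d , ℕ.⌊ δ /2⌋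
  ; to-⊆ = λ {(ξ , d , δ)} e → trans (double (triN ξ) d δ) (cong (2 ℕ.*_) e) ,
      trans (ℤ.neg-involutive (alternating (δ ℕ.+ δ))) (alternating-double δ)
  ; from-⊆ = λ {(ξ , d , δ)} (e , s) → ℕ.*-cancelˡ-≡ _ n 2
      (trans (sym (double (triN ξ) d ℕ.⌊ δ /2⌋))
          (trans (cong (λ k → 2 ℕ.* triN ξ ℕ.+ suc d ℕ.* suc k) (half-odd δ s)) e))
  ; from-to = λ {(ξ , d , δ)} _ → cong (λ k → ξ , d , k) (half-even δ)
  ; to-from = λ {(ξ , d , δ)} (_ , s) → cong (λ k → ξ , d , k) (half-odd δ s) }
  where
  double : ∀ t d δ → 2 ℕ.* t ℕ.+ suc d ℕ.* suc (suc (δ ℕ.+ δ)) ≡ 2 ℕ.* (t ℕ.+ suc d ℕ.* suc δ)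
  double = ℕ-Solver.solve-∀

-- Positivity of y and z selects the root q ≥ 0 of q(q + 1) = 2n over its companion -q - 1.
half-sum : ∀ {y z} q → + 0 ℤ.< y → + 0 ℤ.< z → y + z ≡ q + q + + 1 →
  + ∣ q ∣ ≡ q × ℕ.pred ∣ z ∣ ℕ.< ∣ q ∣ ℕ.+ ∣ q ∣
half-sum (+ q) (ℤ.+<+ {n = suc y} (s≤s _)) (ℤ.+<+ {n = suc z} (s≤s _)) e = refl ,
  ℕ.≤-trans (ℕ.m≤n+m (suc z) y) (ℕ.≤-reflexive
      (ℕ.suc-injective (trans (ℤ.+-injective e) (ℕ.+-comm (q ℕ.+ q) 1))))
half-sum -[1+ q ] (ℤ.+<+ (s≤s _)) (ℤ.+<+ (s≤s _)) ()

-- On δ = 0 put p = y - ξ. Then y + z = 2p + 1 and p(p + 1) = 2n, so n is the triangular number of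
-- index p and z = k + 1 runs through 1, ..., 2p, the upper bound being the positivity of y.
triangle-boundary : ∀ n → (λ ((p , k) : ℕ × ℕ) → triangle p ≡ n × k ℕ.< p ℕ.+ p) ≅
  (λ v → Triple (+ 1) (+ (2 ℕ.* n)) v × δ (+ 1) (+ (2 ℕ.* n)) v ≡ + 0)
triangle-boundary n = record
  { to = λ (p , k) → + (p ℕ.+ p ℕ.∸ k) - + p , + (p ℕ.+ p ℕ.∸ k) , + suc k
  ; from = λ (ξ , y , z) → ∣ y - ξ ∣ , ℕ.pred ∣ z ∣
  ; to-⊆ = λ {(p , k)} (e , k<2p) → let 2p = complement p k k<2p in
      (ℤ.+<+ (ℕ.m<n⇒0<n∸m k<2p) , +suc-positive k ,
       valid (+ (p ℕ.+ p ℕ.∸ k)) (+ p) (+ k) (+ triangle p) N 2p (2*triangle p)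
           (trans (ℤ.pos-* 2 n) (cong (λ m → + 2 * + m) (sym e)))) ,
      on-boundary (+ (p ℕ.+ p ℕ.∸ k)) (+ p) (+ k) 2p
  ; from-⊆ = λ {(ξ , y , z)} ((0<y , 0<z , e) , e₀) →
      let +q , k< = half-sum (y - ξ) 0<y 0<z (boundary-sum ξ y z e₀)
      in ℤ.+-injective (halve (trans (2*triangle ∣ y - ξ ∣)
           (trans (cong (λ q → q * (+ 1 + q)) +q) (trans (root ξ y z N e e₀) (ℤ.pos-* 2 n))))) , k<
  ; from-to = λ {(p , k)} _ → cong (λ q → ∣ q ∣ , k) (cancel (+ (p ℕ.+ p ℕ.∸ k)) (+ p))
  ; to-from = λ {(ξ , y , z)} ((0<y , 0<z , e) , e₀) →
      let +q , k< = half-sum (y - ξ) 0<y 0<z (boundary-sum ξ y z e₀)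
          q = ∣ y - ξ ∣ ; k = ℕ.pred ∣ z ∣
          y≡ : + (q ℕ.+ q ℕ.∸ k) ≡ y
          y≡ = recover (+ (q ℕ.+ q ℕ.∸ k)) (+ q) (+ k) ξ y z (complement q k k<) +q (suc-pred 0<z) e₀
      in cong₂ _,_ (trans (cong₂ _-_ y≡ +q) (cancel y ξ)) (cong₂ _,_ y≡ (suc-pred 0<z))
  }
  where
  N = + (2 ℕ.* n)
  complement : ∀ p k → k ℕ.< p ℕ.+ p → + (p ℕ.+ p ℕ.∸ k) + + k ≡ + p + + p
  complement p k k<2p = cong +_ (ℕ.m∸n+n≡m (ℕ.<⇒≤ k<2p))
  valid : ∀ y p k t N → y + k ≡ p + p → + 2 * t ≡ p * (+ 1 + p) → N ≡ + 2 * t →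
    (y - p) * (y - p - + 1) + y * (+ 1 + k) ≡ N
  valid y p k t N e₁ e₂ e₃ = linear (y *[ e₁ ] ⊕ (- + 1) *[ e₂ ] ⊕ (- + 1) *[ e₃ ])
    (solve (y ∷ p ∷ k ∷ t ∷ N ∷ []))
  on-boundary : ∀ y p k → y + k ≡ p + p → + 1 + k + ((y - p) + (y - p)) - + 1 - y ≡ + 0
  on-boundary y p k e = linear (+ 1 *[ e ]) (solve (y ∷ p ∷ k ∷ []))
  boundary-sum : ∀ ξ y z → z + (ξ + ξ) - + 1 - y ≡ + 0 → y + z ≡ (y - ξ) + (y - ξ) + + 1
  boundary-sum ξ y z e = linear (+ 1 *[ e ]) (solve (ξ ∷ y ∷ z ∷ []))
  root : ∀ ξ y z N → ξ * (ξ - + 1) + y * z ≡ N → z + (ξ + ξ) - + 1 - y ≡ + 0 → (y - ξ) * (+ 1 + (y - ξ)) ≡ N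
  root ξ y z N e e₀ = linear (+ 1 *[ e ] ⊕ (- y) *[ e₀ ]) (solve (ξ ∷ y ∷ z ∷ N ∷ []))
  cancel : ∀ y q → y - (y - q) ≡ q
  cancel = solve-∀
  recover : ∀ y′ q k ξ y z → y′ + k ≡ q + q → q ≡ y - ξ → + 1 + k ≡ z → z + (ξ + ξ) - + 1 - y ≡ + 0 → y′ ≡ y
  recover y′ q k ξ y z e₁ e₂ e₃ e₀ = linear (+ 1 *[ e₁ ] ⊕ (+ 2) *[ e₂ ] ⊕ (- + 1) *[ e₃ ] ⊕ (- + 1) *[ e₀ ])
    (solve (y′ ∷ q ∷ k ∷ ξ ∷ y ∷ z ∷ []))

Log-Ψ : Log Ψ (gen pairG λ-weight)
-- The factor 2 (1 + ε z) in `H` is 4 on even z, so the identity appears four times over.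
Log-Ψ n = ℤ.*-cancelˡ-≡ (+ 4) _ _ (begin
  + 4 * (+ n * Ψ n)                     ≡⟨ cong (λ s → + 4 * (+ n * s)) (Ψ-card n) ⟩
  + 4 * (+ n * (+ 2 * card T))          ≡⟨ rescale (+ n) (card T) ⟩
  + 8 * + n * card T                    ≡⟨ ∑-* T (+ 8 * + n) (λ _ → + 1) ⟩
  ∑ T (λ p → + 8 * + n * + 1)           ≡⟨ ∑-cong T
      (λ { p refl → trans (ℤ.*-identityʳ (+ 8 * + n)) (sym (∑-odd-triangle p)) }) ⟩
  ∑ T (λ p → ∑ (range (p ℕ.+ p)) u)     ≡⟨ ∑-Σ T (λ p → range (p ℕ.+ p)) (u ∘ proj₂) ⟨
  ∑ T′ (u ∘ proj₂)                      ≡⟨ ∑-≅ (triangle-boundary n) T′ (E ∩ λ v → δ (+ 1) N v ℤ.≟ + 0)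
      (u ∘ proj₂) f on-boundary ⟩
  ∑ (E ∩ λ v → δ (+ 1) N v ℤ.≟ + 0) f   ≡⟨ boundary ⟨
  ∑ E h                                 ≡⟨ ∑-≅ (triple-≅ (+ 1) 2triG deg-2triG (2 ℕ.* n)) E₀ E h₀ h
      (λ _ _ → refl) ⟨
  ∑ E₀ h₀                               ≡⟨ ∑-∩ E₀ even? odd-vanish ⟩
  ∑ (E₀ ∩ even?) h₀                     ≡⟨ ∑-≅ (halve-≅ n) (fibre (triG ⊗ pairG) n) (E₀ ∩ even?) w₄ h₀
      even-weight ⟨
  ∑ (fibre (triG ⊗ pairG) n) w₄         ≡⟨ ∑-* (fibre (triG ⊗ pairG) n) (+ 4) ((λ _ → + 1) ∙ λ-weight) ⟨
  + 4 * gen (triG ⊗ pairG) ((λ _ → + 1) ∙ λ-weight) n ≡⟨ cong (+ 4 *_)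
      (gen-⊗ triG pairG (λ _ → + 1) λ-weight n) ⟨
  + 4 * (Ψ ⊛ gen pairG λ-weight) n      ∎)
  where
  open ≡-Reasoning
  open Psi n using (h; f; boundary; H; G)
  N = + (2 ℕ.* n)
  T = fibre triangleG n
  T′ = Σ-enum T (λ p → range (p ℕ.+ p))
  E = oddTriples (2 ℕ.* n)
  E₀ = fibre (2triG ⊗ pairG) (2 ℕ.* n)
  u : ℕ → ℤ
  u k = + 2 * (+ 1 - alternating k) * + suc k
  h₀ : ℤ × ℕ × ℕ → ℤ
  h₀ = h ∘ to (triple-≅ (+ 1) 2triG deg-2triG (2 ℕ.* n))
  w₄ : ℤ × ℕ × ℕ → ℤ
  w₄ v = + 4 * ((λ _ → + 1) ∙ λ-weight) v
  even? : Decidable (λ ((ξ , d , δ) : ℤ × ℕ × ℕ) → alternating (suc δ) ≡ + 1)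
  even? (ξ , d , δ) = alternating (suc δ) ℤ.≟ + 1
  rescale : ∀ n c → + 4 * (n * (+ 2 * c)) ≡ + 8 * n * c
  rescale = solve-∀
  odd-vanish : ∀ v → deg (2triG ⊗ pairG) v ≡ 2 ℕ.* n → ¬ (alternating (suc (proj₂ (proj₂ v))) ≡ + 1) → h₀ v
      ≡ + 0
  odd-vanish (ξ , d , δ) _ odd with ε-sign (+ suc δ)
  ... | inj₁ e = ⊥-elim (odd e)
  ... | inj₂ e = trans (cong (λ s → - (+ 2 * (+ 1 + s) * ε (+ suc d) * + suc d)) e)
      (lemma (ε (+ suc d)) (+ suc d))
    where
    lemma : ∀ s d → - (+ 0 * s * d) ≡ + 0
    lemma = solve-∀
  even-weight : ∀ v → deg (triG ⊗ pairG) v ≡ n → w₄ v ≡ h₀ (to (halve-≅ n) v)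
  even-weight (ξ , d , δ) _ = trans (lemma (ε (+ suc d)) (+ suc d))
    (cong (λ s → - (+ 2 * (+ 1 + s) * ε (+ suc d) * + suc d))
      (sym (trans (ℤ.neg-involutive (alternating (δ ℕ.+ δ))) (alternating-double δ))))
    where
    lemma : ∀ s d → + 4 * (+ 1 * - (s * d)) ≡ - (+ 4 * s * d)
    lemma = solve-∀
  on-boundary : ∀ ((p , k) : ℕ × ℕ) → triangle p ≡ n × k ℕ.< p ℕ.+ p → u k ≡ f
      (to (triangle-boundary n) (p , k))
  on-boundary (p , k) (_ , k<2p) = trans (lemma (alternating k) (+ p) (+ k) y y+k≡2p (ε-sign (+ k)))
    (cong (λ s → H s (- alternating k) (y - + p + (y - + p) - + 1) y (+ suc k) + G s (- alternating k)
        (y - + p + (y - + p) - + 1) y (+ suc k)) (sym εy))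
    where
    y = + (p ℕ.+ p ℕ.∸ k)
    y+k≡2p : y + + k ≡ + p + + p
    y+k≡2p = cong +_ (ℕ.m∸n+n≡m (ℕ.<⇒≤ k<2p))
    εy : ε y ≡ alternating k
    εy = trans (cong ε {y} (+-cancel y (+ p + + p - + k) (trans y+k≡2p (sym (lemma′ (+ p) (+ k)))) refl))
      (trans (ε-+ (+ p + + p) (- + k)) (trans (cong₂ _*_ (ε-double (+ p)) (ε-neg (+ k)))
          (ℤ.*-identityˡ (alternating k))))
      where
      lemma′ : ∀ p k → p + p - k + k ≡ p + p
      lemma′ = solve-∀
    lemma : ∀ s p k y → y + k ≡ p + p → s ≡ + 1 ⊎ s ≡ - + 1 → + 2 * (+ 1 - s) * (+ 1 + k) ≡
      - (+ 2 * (+ 1 + - s) * s * y) + - ((+ 1 + - s) * (+ 1 - s) * (y - p + (y - p) - + 1))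
    lemma s p k y e (inj₁ refl) = solve (p ∷ k ∷ y ∷ [])
    lemma s p k y e (inj₂ refl) = linear ((+ 4) *[ e ]) (solve (p ∷ k ∷ y ∷ []))

half-sum′ : ∀ {y z} q → + 0 ℤ.< y → + 0 ℤ.< z → y + z ≡ q + q →
  + ∣ q ∣ ≡ q × ℕ.pred ∣ y ∣ ℕ.< ∣ q ∣ ℕ.+ ∣ q ∣ ℕ.∸ 1
half-sum′ (+ q) (ℤ.+<+ {n = suc y} (s≤s _)) (ℤ.+<+ {n = suc z} (s≤s _)) e = refl ,
  ℕ.≤-trans (ℕ.≤-trans (s≤s (ℕ.m≤m+n y z)) (ℕ.≤-reflexive (sym (ℕ.+-suc y z))))
            (ℕ.≤-reflexive (cong (ℕ._∸ 1) (ℤ.+-injective e)))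
half-sum′ -[1+ q ] (ℤ.+<+ (s≤s _)) (ℤ.+<+ (s≤s _)) ()

-- On δ = 0 put r = y - ξ. Now c = 0 gives y + z = 2r and r² = n, so r is the positive root and y =
-- k + 1 runs through 1, ..., 2r - 1.
square-boundary : ∀ n → (λ ((r , k) : ℕ × ℕ) → r ℕ.* r ≡ n × k ℕ.< r ℕ.+ r ℕ.∸ 1) ≅
  (λ v → Triple (+ 0) (+ n) v × δ (+ 0) (+ n) v ≡ + 0)
square-boundary n = record
  { to = λ (r , k) → + suc k - + r , + suc k , + (r ℕ.+ r ℕ.∸ suc k)
  ; from = λ (ξ , y , z) → ∣ y - ξ ∣ , ℕ.pred ∣ y ∣
  ; to-⊆ = λ {(r , k)} (e , k<) → let k<2r = below r k k< ; 2r = complement r k k<2r in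
      (+suc-positive k , ℤ.+<+ (ℕ.m<n⇒0<n∸m k<2r) ,
       valid (+ suc k) (+ r) (+ (r ℕ.+ r ℕ.∸ suc k)) (+ n) 2r (trans (sym (ℤ.pos-* r r)) (cong +_ e))) ,
      on-boundary (+ suc k) (+ r) (+ (r ℕ.+ r ℕ.∸ suc k)) 2r
  ; from-⊆ = λ {(ξ , y , z)} ((0<y , 0<z , e) , e₀) →
      let +q , k< = half-sum′ (y - ξ) 0<y 0<z (boundary-sum ξ y z e₀)
      in ℤ.+-injective (trans (ℤ.pos-* ∣ y - ξ ∣ ∣ y - ξ ∣)
           (trans (cong (λ q → q * q) +q) (root ξ y z (+ n) e e₀))) , k<
  ; from-to = λ {(r , k)} _ → cong (λ q → ∣ q ∣ , k) (cancel (+ suc k) (+ r))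
  ; to-from = λ {(ξ , y , z)} ((0<y , 0<z , e) , e₀) →
      let +q , k< = half-sum′ (y - ξ) 0<y 0<z (boundary-sum ξ y z e₀)
          q = ∣ y - ξ ∣ ; k = ℕ.pred ∣ y ∣
      in cong₂ _,_ (trans (cong₂ _-_ (suc-pred 0<y) +q) (cancel y ξ))
           (cong₂ _,_ (suc-pred 0<y) (recover (+ suc k) (+ q) (+ (q ℕ.+ q ℕ.∸ suc k)) ξ y z
             (complement q k (below q k k<)) +q (suc-pred 0<y) e₀))
  }
  where
  below : ∀ r k → k ℕ.< r ℕ.+ r ℕ.∸ 1 → suc k ℕ.< r ℕ.+ r
  below (suc r) k k< = s≤s k<
  complement : ∀ r k → suc k ℕ.< r ℕ.+ r → + suc k + + (r ℕ.+ r ℕ.∸ suc k) ≡ + r + + r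
  complement r k k<2r = cong +_ (ℕ.m+[n∸m]≡n (ℕ.<⇒≤ k<2r))
  valid : ∀ y r z N → y + z ≡ r + r → r * r ≡ N → (y - r) * (y - r - + 0) + y * z ≡ N
  valid y r z N e₁ e₂ = linear (y *[ e₁ ] ⊕ + 1 *[ e₂ ]) (solve (y ∷ r ∷ z ∷ N ∷ []))
  on-boundary : ∀ y r z → y + z ≡ r + r → z + ((y - r) + (y - r)) - + 0 - y ≡ + 0
  on-boundary y r z e = linear (+ 1 *[ e ]) (solve (y ∷ r ∷ z ∷ []))
  boundary-sum : ∀ ξ y z → z + (ξ + ξ) - + 0 - y ≡ + 0 → y + z ≡ (y - ξ) + (y - ξ)
  boundary-sum ξ y z e = linear (+ 1 *[ e ]) (solve (ξ ∷ y ∷ z ∷ []))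
  root : ∀ ξ y z N → ξ * (ξ - + 0) + y * z ≡ N → z + (ξ + ξ) - + 0 - y ≡ + 0 → (y - ξ) * (y - ξ) ≡ N
  root ξ y z N e e₀ = linear (+ 1 *[ e ] ⊕ (- y) *[ e₀ ]) (solve (ξ ∷ y ∷ z ∷ N ∷ []))
  cancel : ∀ y q → y - (y - q) ≡ q
  cancel = solve-∀
  recover : ∀ y′ q z′ ξ y z → y′ + z′ ≡ q + q → q ≡ y - ξ → y′ ≡ y → z + (ξ + ξ) - + 0 - y ≡ + 0 → z′ ≡ z
  recover y′ q z′ ξ y z e₁ e₂ e₃ e₀ = linear (+ 1 *[ e₁ ] ⊕ (+ 2) *[ e₂ ] ⊕ (- + 1) *[ e₃ ] ⊕ (- + 1) *[ e₀ ])
    (solve (y′ ∷ q ∷ z′ ∷ ξ ∷ y ∷ z ∷ []))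

Log-Φ : Log Φ (gen pairG μ-weight)
Log-Φ n = begin
  + n * Φ n                             ≡⟨ rescale n ⟩
  ∑ R (λ r → + 2 * + n * ε (+ r))
    ≡⟨ ∑-cong R (λ { r refl → trans (cong (_* ε (+ r)) (sym (∑-odd-square r)))
         (trans (ℤ.*-comm _ (ε (+ r))) (∑-* (range (r ℕ.+ r ℕ.∸ 1)) (ε (+ r)) v)) }) ⟩
  ∑ R (λ r → ∑ (range (r ℕ.+ r ℕ.∸ 1)) (λ k → u (r , k)))
                                        ≡⟨ ∑-Σ R (λ r → range (r ℕ.+ r ℕ.∸ 1)) u ⟨
  ∑ R′ u                                ≡⟨ ∑-≅ (square-boundary n) R′ (E ∩ λ v → δ (+ 0) (+ n) v ℤ.≟ + 0) u
      (-_ ∘ f) on-boundary ⟩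
  ∑ (E ∩ λ v → δ (+ 0) (+ n) v ℤ.≟ + 0) (-_ ∘ f)  ≡⟨ ∑-neg (E ∩ λ v → δ (+ 0) (+ n) v ℤ.≟ + 0) f ⟨
  - ∑ (E ∩ λ v → δ (+ 0) (+ n) v ℤ.≟ + 0) f       ≡⟨ cong -_ boundary ⟨
  - ∑ E h                               ≡⟨ ∑-neg E h ⟩
  ∑ E (-_ ∘ h)                          ≡⟨ ∑-≅ (triple-≅ (+ 0) sqG deg-sqG n) E₀ E (ε ∙ μ-weight) (-_ ∘ h)
                                             (λ (ξ , d , δ) _ → lemma (ε ξ) (ε (+ suc δ)) (+ suc d)) ⟨
  ∑ E₀ (ε ∙ μ-weight)                   ≡⟨ gen-⊗ sqG pairG ε μ-weight n ⟨
  (Φ ⊛ gen pairG μ-weight) n            ∎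
  where
  open ≡-Reasoning
  open Phi n using (h; f; boundary; H; G)
  R = fibre squareG n
  R′ = Σ-enum R (λ r → range (r ℕ.+ r ℕ.∸ 1))
  E = evenTriples n
  E₀ = fibre (sqG ⊗ pairG) n
  v : ℕ → ℤ
  v k = (+ 1 - alternating (suc k)) * + suc k
  u : ℕ × ℕ → ℤ
  u (r , k) = ε (+ r) * v k
  rescale : ∀ n → + n * Φ n ≡ ∑ (fibre squareG n) (λ r → + 2 * + n * ε (+ r))
  -- Degree 0 is outside the doubling of `Φ-sum`, but the factor n makes both sides vanish there.
  rescale zero = trans (ℤ.*-zeroˡ (Φ 0)) (sym (∑-zero (fibre squareG 0) (λ r _ → ℤ.*-zeroˡ (ε (+ r)))))
  rescale (suc n) = trans (cong (+ suc n *_) (Φ-sum n))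
    (trans (shuffle (+ suc n) (∑ (fibre squareG (suc n)) (λ r → ε (+ r))))
        (∑-* (fibre squareG (suc n)) (+ 2 * + suc n) (λ r → ε (+ r))))
    where
    shuffle : ∀ n s → n * (+ 2 * s) ≡ + 2 * n * s
    shuffle = solve-∀
  lemma : ∀ s t d → s * - ((+ 1 - t) * d) ≡ - ((+ 1 - t) * s * d)
  lemma = solve-∀
  on-boundary : ∀ ((r , k) : ℕ × ℕ) → r ℕ.* r ≡ n × k ℕ.< r ℕ.+ r ℕ.∸ 1 →
    u (r , k) ≡ - f (to (square-boundary n) (r , k))
  on-boundary (r , k) (_ , k<) = trans (lemma′ (ε y) (ε (+ r)) y (y - + r) (ε-sign y))
    (cong₂ (λ t s → - (H (ε y) t s (y - + r) y z + G (ε y) t s (y - + r) y z)) (sym εz)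
      (sym (trans (ε-+ y (- + r)) (cong (ε y *_) (ε-neg (+ r))))))
    where
    y = + suc k
    z = + (r ℕ.+ r ℕ.∸ suc k)
    k<2r : ∀ r → k ℕ.< r ℕ.+ r ℕ.∸ 1 → suc k ℕ.≤ r ℕ.+ r
    k<2r (suc r) k< = ℕ.≤-trans k< (ℕ.n≤1+n _)
    εz : ε z ≡ ε y
    εz = trans (cong ε {z} {+ r + + r - y} (linear (+ 1 *[ cong +_ (ℕ.m+[n∸m]≡n (k<2r r k<)) ])
        (lemma″ y z (+ r))))
      (trans (ε-+ (+ r + + r) (- y)) (trans (cong₂ _*_ (ε-double (+ r)) (ε-neg y)) (ℤ.*-identityˡ (ε y))))
      where
      lemma″ : ∀ y z r → z - (r + r - y) ≡ + 1 * (y + z - (r + r))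
      lemma″ = solve-∀
    lemma′ : ∀ e s y x → e ≡ + 1 ⊎ e ≡ - + 1 → s * ((+ 1 - e) * y) ≡
      - ((+ 1 - e) * (e * s) * y + - ((+ 1 - e) * (+ 1 + e) * (e * s) * x))
    lemma′ e s y x (inj₁ refl) = solve (s ∷ y ∷ x ∷ [])
    lemma′ e s y x (inj₂ refl) = solve (s ∷ y ∷ x ∷ [])

-- Legendre's theorem on sums of four triangular numbers

Σσ F : Series
Σσ = gen pairG (λ (d , _) → + suc d)
F m = Σσ (suc (2 ℕ.* m))

-- Grouping the solutions of ξ(ξ - 1) + yz = 2m + 1 by i = ξ(ξ - 1)/2 and yz = 2j + 1 turns the
-- vanishing of the sum of `h` into a convolution, in which the divisors y add up to `F j`.
F-recurrence : ∀ m → ∑ (antidiagonal m) (λ (i , j) → (+ j - + 4 * + i) * Ψ i * F j) ≡ + 0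
F-recurrence m = ℤ.*-cancelˡ-≡ (+ 2) _ _ (begin
  + 2 * ∑ diagonal (λ (i , j) → (+ j - + 4 * + i) * Ψ i * F j)
    ≡⟨ ∑-* diagonal (+ 2) (λ (i , j) → (+ j - + 4 * + i) * Ψ i * F j) ⟩
  ∑ diagonal (λ (i , j) → + 2 * ((+ j - + 4 * + i) * Ψ i * F j))
    ≡⟨ ∑-cong diagonal (λ (i , j) _ → expand i j) ⟩
  ∑ diagonal (λ ij → ∑ (blocks ij) (λ (ξ , d , δ) → w (ij , ξ , d , δ)))
    ≡⟨ ∑-Σ diagonal blocks w ⟨
  ∑ (Σ-enum diagonal blocks) w
    ≡⟨ ∑-≅ regroup (Σ-enum diagonal blocks) E w h weight ⟩
  ∑ E h
    ≡⟨ vanishes ⟩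
  + 0 ∎)
  where
  open ≡-Reasoning
  open Sigma m using (h; vanishes)
  diagonal = antidiagonal m
  E = oddTriples (suc (2 ℕ.* m))
  blocks : ∀ ij → Enum (λ (ξ , d , δ) → triN ξ ≡ proj₁ ij × suc d ℕ.* suc δ ≡ suc (2 ℕ.* proj₂ ij))
  blocks (i , j) = Σ-enum (fibre triG i) (λ _ → fibre pairG (suc (2 ℕ.* j)))
  w : (ℕ × ℕ) × ℤ × ℕ × ℕ → ℤ
  w ((i , j) , ξ , d , δ) = + 2 * (+ j - + 4 * + i) * + suc d
  expand : ∀ i j → + 2 * ((+ j - + 4 * + i) * Ψ i * F j) ≡ ∑ (blocks (i , j))
      (λ (ξ , d , δ) → w ((i , j) , ξ , d , δ))
  expand i j = begin
    + 2 * (c * Ψ i * F j)                          ≡⟨ shuffle c (Ψ i) (F j) ⟩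
    Ψ i * (+ 2 * c * F j)                          ≡⟨ cong (Ψ i *_) (∑-* S (+ 2 * c) (λ (d , _) → + suc d)) ⟩
    Ψ i * ∑ S (λ (d , _) → + 2 * c * + suc d)      ≡⟨ ∑*∑ (fibre triG i) S (λ _ → + 1)
        (λ (d , _) → + 2 * c * + suc d) ⟩
    ∑ (fibre triG i) (λ _ → ∑ S (λ (d , _) → + 1 * (+ 2 * c * + suc d)))
      ≡⟨ ∑-cong (fibre triG i) (λ _ _ → ∑-cong S (λ (d , _) _ → ℤ.*-identityˡ (+ 2 * c * + suc d))) ⟩
    ∑ (fibre triG i) (λ _ → ∑ S (λ (d , _) → + 2 * c * + suc d))
      ≡⟨ ∑-Σ (fibre triG i) (λ _ → S) (λ (ξ , d , δ) → w ((i , j) , ξ , d , δ)) ⟨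
    ∑ (blocks (i , j)) (λ (ξ , d , δ) → w ((i , j) , ξ , d , δ)) ∎
    where
    c = + j - + 4 * + i
    S = fibre pairG (suc (2 ℕ.* j))
    shuffle : ∀ c p f → + 2 * (c * p * f) ≡ p * (+ 2 * c * f)
    shuffle = solve-∀
  regroup : (λ ((ij , ξ , d , δ) : (ℕ × ℕ) × ℤ × ℕ × ℕ) → (proj₁ ij ℕ.+ proj₂ ij ≡ m) ×
      (triN ξ ≡ proj₁ ij × suc d ℕ.* suc δ ≡ suc (2 ℕ.* proj₂ ij))) ≅ Triple (+ 1) (+ suc (2 ℕ.* m))
  regroup = record
    { to = λ (_ , v) → to i₀ v
    ; from = λ v → let ξ = proj₁ v in (triN ξ , m ℕ.∸ triN ξ) , from i₀ v
    ; to-⊆ = λ { {((i , j) , ξ , d , δ)} (refl , refl , e) → to-⊆ i₀ {ξ , d , δ}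
        (trans (cong (2 ℕ.* triN ξ ℕ.+_) e) (collect (triN ξ) j)) }
    ; from-⊆ = λ {v} t → let le , e = separate (triN (proj₁ v)) (from-⊆ i₀ {v} t) in
        ℕ.m+[n∸m]≡n le , refl , e
    ; from-to = λ { {((i , j) , v)} (refl , refl , _) → cong (λ k → (i , k) , v) (ℕ.m+n∸m≡n i j) }
    ; to-from = λ t → to-from i₀ t }
    where
    i₀ = triple-≅ (+ 1) 2triG deg-2triG (suc (2 ℕ.* m))
    collect : ∀ i j → 2 ℕ.* i ℕ.+ suc (2 ℕ.* j) ≡ suc (2 ℕ.* (i ℕ.+ j))
    collect = ℕ-Solver.solve-∀
    separate : ∀ t {s} → 2 ℕ.* t ℕ.+ suc s ≡ suc (2 ℕ.* m) → t ℕ.≤ m × suc s ≡ suc (2 ℕ.* (m ℕ.∸ t))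
    separate t {s} e = ℕ.*-cancelˡ-≤ 2 2t≤2m , cong suc (begin
      s                        ≡⟨ ℕ.m+n∸m≡n (2 ℕ.* t) s ⟨
      2 ℕ.* t ℕ.+ s ℕ.∸ 2 ℕ.* t  ≡⟨ cong (ℕ._∸ 2 ℕ.* t) e′ ⟩
      2 ℕ.* m ℕ.∸ 2 ℕ.* t        ≡⟨ ℕ.*-distribˡ-∸ 2 m t ⟨
      2 ℕ.* (m ℕ.∸ t)            ∎)
      where
      e′ : 2 ℕ.* t ℕ.+ s ≡ 2 ℕ.* m
      e′ = ℕ.suc-injective (trans (sym (ℕ.+-suc (2 ℕ.* t) s)) e)
      2t≤2m : 2 ℕ.* t ℕ.≤ 2 ℕ.* m
      2t≤2m = subst (2 ℕ.* t ℕ.≤_) e′ (ℕ.m≤m+n (2 ℕ.* t) s)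
  weight : ∀ v → ((proj₁ (proj₁ v) ℕ.+ proj₂ (proj₁ v) ≡ m) × _) → w v ≡ h (to regroup v)
  weight ((i , j) , ξ , d , δ) (_ , refl , e) = lemma (+ suc d) (+ suc d * + suc δ) (triZ ξ) (+ j) ξ
    (trans (sym (ℤ.pos-* (suc d) (suc δ))) (trans (cong +_ e) (cong (ℤ._+_ (+ 1)) (ℤ.pos-* 2 j)))) (2*triZ ξ)
    where
    lemma : ∀ y yz t j ξ → yz ≡ + 1 + + 2 * j → + 2 * t ≡ ξ * (ξ - + 1) →
      + 2 * (j - + 4 * t) * y ≡ y * (yz - (ξ + ξ - + 1) * (ξ + ξ - + 1))
    lemma y yz t j ξ e₁ e₂ = linear ((- y) *[ e₁ ] ⊕ (- + 4 * y) *[ e₂ ]) (solve (y ∷ yz ∷ t ∷ j ∷ ξ ∷ []))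

opaque
  unfolding ∑

  F-zero : F 0 ≡ + 1
  F-zero = refl

  Ψ-zero : Ψ 0 ≡ + 2
  Ψ-zero = refl

-- Ψ⁴ and 16 F satisfy the recurrence of a series X with Ψ D(X) = 4 D(Ψ) X.
Ψ⁴≡16F : ∀ m → ((Ψ ⊛ Ψ) ⊛ (Ψ ⊛ Ψ)) m ≡ + 16 * F m
Ψ⁴≡16F m = recurrence-unique m (λ i j → (+ j - + 4 * + i) * Ψ i) Q (λ j → + 16 * F j)
  leading (λ k _ → Q-recurrence k) (λ k _ → 16F-recurrence k) start m ℕ.≤-refl
  where
  open ≡-Reasoning
  Q = (Ψ ⊛ Ψ) ⊛ (Ψ ⊛ Ψ)
  α = gen pairG λ-weight
  leading : ∀ k → (+ suc k - + 4 * + 0) * Ψ 0 ≢ + 0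
  leading k e with trans (sym (cong ((+ suc k - + 4 * + 0) *_) Ψ-zero)) e
  ... | ()
  -- The recurrence is homogeneous, so the factor 16 is fixed only here, by Ψ 0 = 2 and F 0 = 1.
  start : Q 0 ≡ + 16 * F 0
  start = trans (cong (λ p → p * p * (p * p)) Ψ-zero) (cong (+ 16 *_) (sym F-zero))
  16F-recurrence : ∀ k → ∑ (antidiagonal k) (λ (i , j) → (+ j - + 4 * + i) * Ψ i * (+ 16 * F j)) ≡ + 0
  16F-recurrence k = begin
    ∑ (antidiagonal k) (λ (i , j) → (+ j - + 4 * + i) * Ψ i * (+ 16 * F j))
      ≡⟨ ∑-cong (antidiagonal k) (λ (i , j) _ → lemma ((+ j - + 4 * + i) * Ψ i) (F j)) ⟩
    ∑ (antidiagonal k) (λ (i , j) → + 16 * ((+ j - + 4 * + i) * Ψ i * F j))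
      ≡⟨ ∑-* (antidiagonal k) (+ 16) (λ (i , j) → (+ j - + 4 * + i) * Ψ i * F j) ⟨
    + 16 * ∑ (antidiagonal k) (λ (i , j) → (+ j - + 4 * + i) * Ψ i * F j)
      ≡⟨ cong (+ 16 *_) (F-recurrence k) ⟩
    + 0 ∎
    where
    lemma : ∀ x f → x * (+ 16 * f) ≡ + 16 * (x * f)
    lemma = solve-∀
  Log-Q : Log Q ((α ∔ α) ∔ (α ∔ α))
  Log-Q = Log-⊛ (Log-⊛ Log-Ψ Log-Ψ) (Log-⊛ Log-Ψ Log-Ψ)
  Q-recurrence : ∀ k → ∑ (antidiagonal k) (λ (i , j) → (+ j - + 4 * + i) * Ψ i * Q j) ≡ + 0
  Q-recurrence k = begin
    ∑ diagonal (λ (i , j) → (+ j - + 4 * + i) * Ψ i * Q j)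
      ≡⟨ ∑-cong diagonal (λ (i , j) _ → lemma (+ i) (+ j) (Ψ i) (Q j)) ⟩
    ∑ diagonal (λ (i , j) → Ψ i * D Q j + - + 4 * (D Ψ i * Q j))
      ≡⟨ ∑-+ diagonal (λ (i , j) → Ψ i * D Q j) (λ (i , j) → - + 4 * (D Ψ i * Q j)) ⟨
    ∑ diagonal (λ (i , j) → Ψ i * D Q j) + ∑ diagonal (λ (i , j) → - + 4 * (D Ψ i * Q j))
      ≡⟨ cong₂ _+_ (⊛-∑ Ψ (D Q) k) (trans (cong (- + 4 *_) (⊛-∑ (D Ψ) Q k))
          (∑-* diagonal (- + 4) (λ (i , j) → D Ψ i * Q j))) ⟨
    (Ψ ⊛ D Q) k + - + 4 * (D Ψ ⊛ Q) k
      ≡⟨ cong₂ (λ x y → x + - + 4 * y) (⊛-cong {Ψ} (λ _ → refl) Log-Q k) (⊛-cong {g = Q} Log-Ψ (λ _ → refl) k) ⟩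
    (Ψ ⊛ (Q ⊛ ((α ∔ α) ∔ (α ∔ α)))) k + - + 4 * ((Ψ ⊛ α) ⊛ Q) k
      ≡⟨ cong (_+ - + 4 * ((Ψ ⊛ α) ⊛ Q) k) (rearrange Ψ Q α k) ⟩
    (((Ψ ⊛ α) ⊛ Q) k + ((Ψ ⊛ α) ⊛ Q) k + (((Ψ ⊛ α) ⊛ Q) k + ((Ψ ⊛ α) ⊛ Q) k)) + - + 4 * ((Ψ ⊛ α) ⊛ Q) k
      ≡⟨ cancel (((Ψ ⊛ α) ⊛ Q) k) ⟩
    + 0 ∎
    where
    diagonal = antidiagonal k
    lemma : ∀ i j p q → (j - + 4 * i) * p * q ≡ p * (j * q) + - + 4 * (i * p * q)
    lemma = solve-∀
    cancel : ∀ x → (x + x + (x + x)) + - + 4 * x ≡ + 0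
    cancel = solve-∀
    rearrange : ∀ p q α → p ⊛ (q ⊛ ((α ∔ α) ∔ (α ∔ α))) ≈
      (((p ⊛ α) ⊛ q) ∔ ((p ⊛ α) ⊛ q)) ∔ (((p ⊛ α) ⊛ q) ∔ ((p ⊛ α) ⊛ q))
    rearrange = solve⊛ 3 (λ p q α → p :* (q :* ((α :+ α) :+ (α :+ α))) :=
      ((p :* α) :* q :+ (p :* α) :* q) :+ ((p :* α) :* q :+ (p :* α) :* q)) (λ _ → refl)

-- The logarithmic derivative of the product P

bools : Enum {Bool} (λ _ → ⊤)
bools = record
  { list = false ∷ true ∷ []
  ; unique = ((λ ()) All.∷ All.[]) AllPairs.∷ All.[] AllPairs.∷ AllPairs.[]
  ; sound = λ _ → tt
  ; complete = λ { {false} _ → here refl ; {true} _ → there (here refl) } }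

-- `false` and `true` index the monomials 1 and -q^m of the factor 1 - q^m.
factorDeg : ℕ → Bool → ℕ
factorDeg m false = 0
factorDeg m true = m

factorWeight : Bool → ℤ
factorWeight false = + 1
factorWeight true = - + 1

factorG : ℕ → Graded Bool
factorG m = bounded (factorDeg m) (λ _ → bools) (λ _ → tt)

multipleG : ∀ m .{{_ : ℕ.NonZero m}} → Graded ℕ
multipleG m = bounded (λ δ → m ℕ.* suc δ) {λ n δ → δ ℕ.< n} range (λ δ → ℕ.m≤n*m (suc δ) m)

opaque
  unfolding ∑

  oneMinus-gen : ∀ m .{{_ : ℕ.NonZero m}} → oneMinusQ^ m ≈ gen (factorG m) factorWeight
  oneMinus-gen (suc m) zero = refl
  -- `oneMinusQ^` compares the degree with m, whereas the filter in the fibre compares m with the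
  -- degree; the mixed cases contradict the symmetry of equality.
  oneMinus-gen (suc m) (suc j) with j ℕ.≡ᵇ m in e | m ℕ.≡ᵇ j in e′
  ... | true | true = refl
  ... | false | false = refl
  ... | true | false = ⊥-elim (subst Data.Bool.T e′
      (ℕ.≡⇒≡ᵇ m j (sym (ℕ.≡ᵇ⇒≡ j m (subst Data.Bool.T (sym e) tt)))))
  ... | false | true = ⊥-elim (subst Data.Bool.T e
      (ℕ.≡⇒≡ᵇ j m (sym (ℕ.≡ᵇ⇒≡ m j (subst Data.Bool.T (sym e′) tt)))))

-- 1 - q^m has logarithmic derivative - m (q^m + q^2m + …): in the product of the two, the terms
-- indexed by (false , δ + 1) and (true , δ) cancel.
factor-weight : ℕ → Bool × ℕ → ℤ
factor-weight m = factorWeight ∙ (λ _ → - + m)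

Log-factor : ∀ m .{{_ : ℕ.NonZero m}} → Log (oneMinusQ^ m) (gen (multipleG m) (λ _ → - + m))
Log-factor m n = begin
  + n * oneMinusQ^ m n                     ≡⟨ cong (+ n *_) (oneMinus-gen m n) ⟩
  + n * ∑ Fn factorWeight                  ≡⟨ ∑-* Fn (+ n) factorWeight ⟩
  ∑ Fn (λ b → + n * factorWeight b)        ≡⟨ ∑-∩ Fn true?
      (λ { false refl _ → refl ; true _ ¬t → ⊥-elim (¬t refl) }) ⟩
  ∑ (Fn ∩ true?) (λ b → + n * factorWeight b)
    ≡⟨ ∑-≅ top (Fn ∩ true?) (E ∩ first?) (λ b → + n * factorWeight b) w (λ { true (refl , _) → lemma (+ m) }) ⟩
  ∑ (E ∩ first?) w                         ≡⟨ ℤ.+-identityʳ (∑ (E ∩ first?) w) ⟨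
  ∑ (E ∩ first?) w + + 0                   ≡⟨ cong (ℤ._+_ (∑ (E ∩ first?) w)) rest ⟨
  ∑ (E ∩ first?) w + ∑ (E ∖ first?) w      ≡⟨ ∑-split E first? w ⟨
  ∑ E w                                    ≡⟨ gen-⊗ (factorG m) (multipleG m) factorWeight (λ _ → - + m) n ⟨
  (gen (factorG m) factorWeight ⊛ e) n     ≡⟨ ⊛-cong {g = e} (oneMinus-gen m) (λ _ → refl) n ⟨
  (oneMinusQ^ m ⊛ e) n                     ∎
  where
  open ≡-Reasoning
  e = gen (multipleG m) (λ _ → - + m)
  Fn = fibre (factorG m) n
  E = fibre (factorG m ⊗ multipleG m) n
  w = factor-weight m
  lemma : ∀ m → m * - + 1 ≡ + 1 * - m
  lemma = solve-∀
  true? : Decidable (λ b → b ≡ true)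
  true? b = b Data.Bool.≟ true
  First : Bool × ℕ → Set
  First (b , δ) = b ≡ false × δ ≡ 0
  first? : Decidable First
  first? (false , zero) = yes (refl , refl)
  first? (false , suc δ) = no λ ()
  first? (true , δ) = no λ ()
  top : (λ b → factorDeg m b ≡ n × b ≡ true) ≅ (λ v → deg (factorG m ⊗ multipleG m) v ≡ n × First v)
  top = record { to = λ _ → false , 0 ; from = λ _ → true
    ; to-⊆ = λ { (e , refl) → trans (ℕ.*-identityʳ m) e , refl , refl }
    ; from-⊆ = λ { (e , refl , refl) → trans (sym (ℕ.*-identityʳ m)) e , refl }
    ; from-to = λ { (_ , refl) → refl } ; to-from = λ { (_ , refl , refl) → refl } }
  ι : Bool × ℕ → Bool × ℕ
  ι (false , δ) = true , ℕ.pred δ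
  ι (true , δ) = false , suc δ
  ι-⊆ : ∀ v → deg (factorG m ⊗ multipleG m) v ≡ n × ¬ First v → deg (factorG m ⊗ multipleG m) (ι v) ≡ n × ¬
      First (ι v)
  ι-⊆ (false , zero) (_ , ¬f) = ⊥-elim (¬f (refl , refl))
  ι-⊆ (false , suc δ) (e , _) = trans (sym (ℕ.*-suc m (suc δ))) e , λ ()
  ι-⊆ (true , δ) (e , _) = trans (ℕ.*-suc m (suc δ)) e , λ ()
  ιι : ∀ v → deg (factorG m ⊗ multipleG m) v ≡ n × ¬ First v → ι (ι v) ≡ v
  ιι (false , zero) (_ , ¬f) = ⊥-elim (¬f (refl , refl))
  ιι (false , suc δ) _ = refl
  ιι (true , δ) _ = refl
  shift : (λ v → deg (factorG m ⊗ multipleG m) v ≡ n × ¬ First v) ≅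
      (λ v → deg (factorG m ⊗ multipleG m) v ≡ n × ¬ First v)
  shift = record { to = ι ; from = ι ; to-⊆ = ι-⊆ _ ; from-⊆ = ι-⊆ _ ; from-to = ιι _ ; to-from = ιι _ }
  rest : ∑ (E ∖ first?) w ≡ + 0
  rest = x≡-x⇒x≡0 _ (trans
    (∑-≅ shift (E ∖ first?) (E ∖ first?) w (λ v → - w v)
      (λ { (false , _) _ → flip₁ (+ m) ; (true , _) _ → flip₂ (+ m) }))
    (sym (∑-neg (E ∖ first?) w)))
    where
    flip₁ : ∀ m → + 1 * - m ≡ - (- + 1 * - m)
    flip₁ = solve-∀
    flip₂ : ∀ m → - + 1 * - m ≡ - (+ 1 * - m)
    flip₂ = solve-∀

e^ : ∀ m .{{_ : ℕ.NonZero m}} → Series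
e^ m = gen (multipleG m) (λ _ → - + m)

logP-term : ℕ → Series
logP-term d = e^ (2 ℕ.* suc d) ∔ (e^ (4 ℕ.* suc d) ∔ (e^ (6 ℕ.* suc d) ∔ e^ (12 ℕ.* suc d)))

logP : ℕ → Series
logP zero = nil
logP (suc k) = logP k ∔ logP-term k

Log-P : ∀ k → Log (P k) (logP k)
Log-P zero n = trans (derivative n) (sym (trans (⊛-comm one nil n) (⊛-zeroˡ one n)))
  where
  derivative : ∀ n → D one n ≡ + 0
  derivative zero = refl
  derivative (suc n) = ℤ.*-zeroʳ (+ suc n)
Log-P (suc k) = Log-⊛ (Log-P k) (Log-⊛ (Log-factor (2 ℕ.* suc k)) (Log-⊛ (Log-factor (4 ℕ.* suc k))
  (Log-⊛ (Log-factor (6 ℕ.* suc k)) (Log-factor (12 ℕ.* suc k)))))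

-- The coefficient at n is c σ(n/c) when c divides n > 0, and 0 otherwise.
Sσ : ∀ c .{{_ : ℕ.NonZero c}} → Series
Sσ c = gen (scale c pairG) (λ (d , _) → + c * + suc d)

-- Truncation is harmless: a factorisation of n ≤ k as c times a divisor times a codivisor only
-- involves divisors up to k, and these belong to the first k factors.
∑-e^ : ∀ c .{{_ : ℕ.NonZero c}} k n → n ℕ.≤ k →
  ∑ (range k) (λ d → e^ (c ℕ.* suc d) {{ℕ.m*n≢0 c (suc d)}} n) ≡ - Sσ c n
∑-e^ c k n n≤k = begin
  ∑ (range k) (λ d → ∑ (M d) (λ _ → - + (c ℕ.* suc d)))  ≡⟨ ∑-Σ (range k) M (λ (d , _) → - + (c ℕ.* suc d)) ⟨
  ∑ (Σ-enum (range k) M) (λ (d , _) → - + (c ℕ.* suc d))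
    ≡⟨ ∑-≅ regroup (Σ-enum (range k) M) (fibre (scale c pairG) n) (λ (d , _) → - + (c ℕ.* suc d))
        (λ (d , _) → - (+ c * + suc d))
         (λ (d , _) _ → cong -_ (ℤ.pos-* c (suc d))) ⟩
  ∑ (fibre (scale c pairG) n) (λ (d , _) → - (+ c * + suc d))  ≡⟨ ∑-neg (fibre (scale c pairG) n)
      (λ (d , _) → + c * + suc d) ⟨
  - Sσ c n ∎
  where
  open ≡-Reasoning
  M : ∀ d → Enum (λ δ → c ℕ.* suc d ℕ.* suc δ ≡ n)
  M d = fibre (multipleG (c ℕ.* suc d) {{ℕ.m*n≢0 c (suc d)}}) n
  regroup : (λ ((d , δ) : ℕ × ℕ) → d ℕ.< k × c ℕ.* suc d ℕ.* suc δ ≡ n) ≅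
      (λ (d , δ) → c ℕ.* (suc d ℕ.* suc δ) ≡ n)
  regroup = ≅-id (λ (d , δ) (_ , e) → trans (sym (ℕ.*-assoc c (suc d) (suc δ))) e)
    (λ (d , δ) e → ℕ.≤-trans (ℕ.≤-trans (ℕ.m≤m*n (suc d) (suc δ))
        (ℕ.≤-trans (ℕ.m≤n*m _ c) (ℕ.≤-reflexive e))) n≤k ,
      trans (ℕ.*-assoc c (suc d) (suc δ)) e)

logP-S : ∀ k n → n ℕ.≤ k → logP k n ≡ - Sσ 2 n + (- Sσ 4 n + (- Sσ 6 n + - Sσ 12 n))
logP-S k n n≤k = trans (unfold k) (trans
  (sym (∑-+ R (t 2) (λ d → t 4 d + (t 6 d + t 12 d))))
  (cong₂ _+_ (∑-e^ 2 k n n≤k) (trans (sym (∑-+ R (t 4) (λ d → t 6 d + t 12 d)))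
    (cong₂ _+_ (∑-e^ 4 k n n≤k) (trans (sym (∑-+ R (t 6) (t 12)))
      (cong₂ _+_ (∑-e^ 6 k n n≤k) (∑-e^ 12 k n n≤k)))))))
  where
  R = range k
  t : ∀ c .{{_ : ℕ.NonZero c}} → ℕ → ℤ
  t c d = e^ (c ℕ.* suc d) {{ℕ.m*n≢0 c (suc d)}} n
  unfold : ∀ k → logP k n ≡ ∑ (range k) (λ d → logP-term d n)
  unfold zero = sym (∑-range-zero (λ d → logP-term d n))
  unfold (suc k) = trans (cong (_+ logP-term k n) (unfold k)) (sym (∑-range-suc k (λ d → logP-term d n)))

-- Comparison of the theta product with the truncated product

module _ (c : ℕ) .{{_ : ℕ.NonZero c}} where

  private instance
    2c≢0 : ℕ.NonZero (2 ℕ.* c)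
    2c≢0 = ℕ.m*n≢0 2 c

  sign-vanish : ∀ k → ¬ (alternating (suc k) ≡ + 1) → + 1 + alternating (suc k) ≡ + 0
  sign-vanish k odd with ε-sign (+ suc k)
  ... | inj₁ e = ⊥-elim (odd e)
  ... | inj₂ e = cong (ℤ._+_ (+ 1)) e

  sign-double : ∀ k → alternating (suc (suc (k ℕ.+ k))) ≡ + 1
  sign-double k = trans (ℤ.neg-involutive (alternating (k ℕ.+ k))) (alternating-double k)

  double-≡ : ∀ x y → 2 ℕ.* c ℕ.* (suc x ℕ.* suc y) ≡ c ℕ.* (suc (suc (x ℕ.+ x)) ℕ.* suc y)
  double-≡ x y = lemma c x y
    where
    lemma : ∀ c x y → 2 ℕ.* c ℕ.* (suc x ℕ.* suc y) ≡ c ℕ.* (suc (suc (x ℕ.+ x)) ℕ.* suc y)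
    lemma = ℕ-Solver.solve-∀

  swapped : ∀ x y → c ℕ.* (suc x ℕ.* suc y) ≡ c ℕ.* (suc y ℕ.* suc x)
  swapped x y = cong (c ℕ.*_) (ℕ.*-comm (suc x) (suc y))

  -- The factor 1 + ε is 2 on even divisors d = 2e and 0 on odd ones, and 2 c d = 2 (2c) e.
  S-even-d : ∀ n → ∑ (fibre (scale c pairG) n) (λ (d , _) → (+ 1 + alternating (suc d)) * (+ c * + suc d)) ≡
      + 2 * Sσ (2 ℕ.* c) n
  S-even-d n = begin
    ∑ E w                    ≡⟨ ∑-∩ E even? (λ (d , δ) _ odd → trans
        (cong (_* (+ c * + suc d)) (sign-vanish d odd)) (ℤ.*-zeroˡ (+ c * + suc d))) ⟩
    ∑ (E ∩ even?) w          ≡⟨ ∑-≅ i E₂ (E ∩ even?) (λ (d , _) → + 2 * (+ (2 ℕ.* c) * + suc d)) w weight ⟨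
    ∑ E₂ (λ (d , _) → + 2 * (+ (2 ℕ.* c) * + suc d))  ≡⟨ ∑-* E₂ (+ 2) (λ (d , _) → + (2 ℕ.* c) * + suc d) ⟨
    + 2 * Sσ (2 ℕ.* c) n ∎
    where
    open ≡-Reasoning
    E = fibre (scale c pairG) n
    E₂ = fibre (scale (2 ℕ.* c) pairG) n
    w : ℕ × ℕ → ℤ
    w (d , _) = (+ 1 + alternating (suc d)) * (+ c * + suc d)
    even? : Decidable (λ ((d , δ) : ℕ × ℕ) → alternating (suc d) ≡ + 1)
    even? (d , δ) = alternating (suc d) ℤ.≟ + 1
    i : (λ ((d , δ) : ℕ × ℕ) → 2 ℕ.* c ℕ.* (suc d ℕ.* suc δ) ≡ n) ≅
      (λ ((d , δ) : ℕ × ℕ) → c ℕ.* (suc d ℕ.* suc δ) ≡ n × alternating (suc d) ≡ + 1)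
    i = record { to = λ (d , δ) → suc (d ℕ.+ d) , δ ; from = λ (d , δ) → ℕ.⌊ d /2⌋ , δ
      ; to-⊆ = λ {(d , δ)} e → trans (sym (double-≡ d δ)) e , sign-double d
      ; from-⊆ = λ {(d , δ)} (e , s) → trans (double-≡ ℕ.⌊ d /2⌋ δ)
          (trans (cong (λ k → c ℕ.* (suc k ℕ.* suc δ)) (half-odd d s)) e)
      ; from-to = λ {(d , δ)} _ → cong (_, δ) (half-even d)
      ; to-from = λ {(d , δ)} (_ , s) → cong (_, δ) (half-odd d s) }
    weight : ∀ v → _ → + 2 * (+ (2 ℕ.* c) * + suc (proj₁ v)) ≡ w (to i v)
    weight (d , δ) _ = trans (cong (λ m → + 2 * (m * + suc d)) (ℤ.pos-* 2 c))
      (trans (lemma (+ c) (+ d)) (cong (λ s → (+ 1 + s) * (+ c * + suc (suc (d ℕ.+ d)))) (sym (sign-double d))))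
      where
      lemma : ∀ c d → + 2 * (+ 2 * c * (+ 1 + d)) ≡ + 2 * (c * (+ 2 + (d + d)))
      lemma = solve-∀

  -- Halving the codivisor leaves d unchanged, so only the constant is absorbed: 2 c d = (2c) d.
  -- Hence there is no factor 2, in contrast to `S-even-d`.
  S-even-δ : ∀ n → ∑ (fibre (scale c pairG) n) (λ (d , δ) → (+ 1 + alternating (suc δ)) * (+ c * + suc d)) ≡
      Sσ (2 ℕ.* c) n
  S-even-δ n = begin
    ∑ E w                    ≡⟨ ∑-∩ E even? (λ (d , δ) _ odd → trans
        (cong (_* (+ c * + suc d)) (sign-vanish δ odd)) (ℤ.*-zeroˡ (+ c * + suc d))) ⟩
    ∑ (E ∩ even?) w          ≡⟨ ∑-≅ i E₂ (E ∩ even?) (λ (d , _) → + (2 ℕ.* c) * + suc d) w weight ⟨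
    Sσ (2 ℕ.* c) n ∎
    where
    open ≡-Reasoning
    E = fibre (scale c pairG) n
    E₂ = fibre (scale (2 ℕ.* c) pairG) n
    w : ℕ × ℕ → ℤ
    w (d , δ) = (+ 1 + alternating (suc δ)) * (+ c * + suc d)
    even? : Decidable (λ ((d , δ) : ℕ × ℕ) → alternating (suc δ) ≡ + 1)
    even? (d , δ) = alternating (suc δ) ℤ.≟ + 1
    i : (λ ((d , δ) : ℕ × ℕ) → 2 ℕ.* c ℕ.* (suc d ℕ.* suc δ) ≡ n) ≅
      (λ ((d , δ) : ℕ × ℕ) → c ℕ.* (suc d ℕ.* suc δ) ≡ n × alternating (suc δ) ≡ + 1)
    i = record { to = λ (d , δ) → d , suc (δ ℕ.+ δ) ; from = λ (d , δ) → d , ℕ.⌊ δ /2⌋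
      ; to-⊆ = λ {(d , δ)} e → trans (swapped d (suc (δ ℕ.+ δ)))
          (trans (sym (double-≡ δ d)) (trans (cong (2 ℕ.* c ℕ.*_) (ℕ.*-comm (suc δ) (suc d))) e)) ,
              sign-double δ
      ; from-⊆ = λ {(d , δ)} (e , s) → trans (cong (2 ℕ.* c ℕ.*_) (ℕ.*-comm (suc d) (suc ℕ.⌊ δ /2⌋)))
          (trans (double-≡ ℕ.⌊ δ /2⌋ d) (trans (cong (λ k → c ℕ.* (suc k ℕ.* suc d)) (half-odd δ s))
              (trans (swapped δ d) e)))
      ; from-to = λ {(d , δ)} _ → cong (d ,_) (half-even δ)
      ; to-from = λ {(d , δ)} (_ , s) → cong (d ,_) (half-odd δ s) }
    weight : ∀ v → _ → + (2 ℕ.* c) * + suc (proj₁ v) ≡ w (to i v)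
    weight (d , δ) _ = trans (cong (_* + suc d) (ℤ.pos-* 2 c))
      (trans (lemma (+ c) (+ suc d)) (cong (λ s → (+ 1 + s) * (+ c * + suc d)) (sym (sign-double δ))))
      where
      lemma : ∀ c d → + 2 * c * d ≡ + 2 * (c * d)
      lemma = solve-∀

  -- The logarithmic form of ψ(q^c) φ(-q^c) = ∏ (1 - q^ck)(1 - q^2ck). Pointwise, -ε(d) d - (1 -
  -- ε(δ)) d = -d - (1 + ε(d)) d + (1 + ε(δ)) d, and the last two terms sum to -2 and +1 times
  -- `Sσ (2 ℕ.* c) n`.
  λμ-S : ∀ n → gen (scale c pairG) (λ v → + c * λ-weight v) n + gen (scale c pairG) (λ v → + c * μ-weight v) n
    ≡ - Sσ c n + - Sσ (2 ℕ.* c) n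
  λμ-S n = begin
    ∑ E (λ v → + c * λ-weight v) + ∑ E (λ v → + c * μ-weight v)
      ≡⟨ ∑-+ E (λ v → + c * λ-weight v) (λ v → + c * μ-weight v) ⟩
    ∑ E (λ v → + c * λ-weight v + + c * μ-weight v)
      ≡⟨ ∑-cong E (λ (d , δ) _ → lemma (+ c) (+ suc d) (alternating (suc d)) (alternating (suc δ))) ⟩
    ∑ E (λ v → - + 1 * s v + (- + 1 * p v + q v))
      ≡⟨ ∑-+ E (λ v → - + 1 * s v) (λ v → - + 1 * p v + q v) ⟨
    ∑ E (λ v → - + 1 * s v) + ∑ E (λ v → - + 1 * p v + q v)
      ≡⟨ cong₂ _+_ (∑-* E (- + 1) s) (∑-+ E (λ v → - + 1 * p v) q) ⟨
    - + 1 * ∑ E s + (∑ E (λ v → - + 1 * p v) + ∑ E q)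
      ≡⟨ cong₂ (λ x y → - + 1 * ∑ E s + (x + y))
          (trans (sym (∑-* E (- + 1) p)) (cong (- + 1 *_) (S-even-d n))) (S-even-δ n) ⟩
    - + 1 * Sσ c n + (- + 1 * (+ 2 * Sσ (2 ℕ.* c) n) + Sσ (2 ℕ.* c) n)
      ≡⟨ collect (Sσ c n) (Sσ (2 ℕ.* c) n) ⟩
    - Sσ c n + - Sσ (2 ℕ.* c) n ∎
    where
    open ≡-Reasoning
    E = fibre (scale c pairG) n
    s p q : ℕ × ℕ → ℤ
    s (d , _) = + c * + suc d
    p (d , _) = (+ 1 + alternating (suc d)) * (+ c * + suc d)
    q (d , δ) = (+ 1 + alternating (suc δ)) * (+ c * + suc d)
    lemma : ∀ c d e f → c * - (e * d) + c * - ((+ 1 - f) * d) ≡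
      - + 1 * (c * d) + (- + 1 * ((+ 1 + e) * (c * d)) + (+ 1 + f) * (c * d))
    lemma = solve-∀
    collect : ∀ x y → - + 1 * x + (- + 1 * (+ 2 * y) + y) ≡ - x + - y
    collect = solve-∀

-- Since Ψ = 2 ψ(q), this `Θ` is 4 ψ(q²) ψ(q⁶) φ(-q²) φ(-q⁶); `Λ` is its logarithmic derivative.
Θ Λ : Series
Θ = (gen (scale 2 triG) (λ _ → + 1) ⊛ gen (scale 6 triG) (λ _ → + 1)) ⊛
    (gen (scale 2 sqG) ε ⊛ gen (scale 6 sqG) ε)
Λ = (gen (scale 2 pairG) (λ v → + 2 * λ-weight v) ∔ gen (scale 6 pairG) (λ v → + 6 * λ-weight v)) ∔
    (gen (scale 2 pairG) (λ v → + 2 * μ-weight v) ∔ gen (scale 6 pairG) (λ v → + 6 * μ-weight v))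

Log-Θ : Log Θ Λ
Log-Θ = Log-⊛ (Log-⊛ (Log-scale 2 triG pairG (λ _ → + 1) λ-weight Log-Ψ)
    (Log-scale 6 triG pairG (λ _ → + 1) λ-weight Log-Ψ))
              (Log-⊛ (Log-scale 2 sqG pairG ε μ-weight Log-Φ) (Log-scale 6 sqG pairG ε μ-weight Log-Φ))

logP-Λ : ∀ k n → n ℕ.≤ k → logP k n ≡ Λ n
logP-Λ k n n≤k = trans (logP-S k n n≤k) (sym (trans
  (regroup (gen (scale 2 pairG) (λ v → + 2 * λ-weight v) n) (gen (scale 6 pairG) (λ v → + 6 * λ-weight v) n)
           (gen (scale 2 pairG) (λ v → + 2 * μ-weight v) n) (gen (scale 6 pairG) (λ v → + 6 * μ-weight v) n))
  (trans (cong₂ _+_ (λμ-S 2 n) (λμ-S 6 n)) (ℤ.+-assoc (- Sσ 2 n) (- Sσ 4 n) (- Sσ 6 n + - Sσ 12 n)))))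
  where
  regroup : ∀ a b c d → (a + b) + (c + d) ≡ (a + c) + (b + d)
  regroup = solve-∀

-- As `one i` vanishes for i > 0, the relation D X = X α in one degree becomes a single convolution
-- of the shape that `recurrence-unique` takes.
Log-recurrence : ∀ X α n → D X n ≡ (X ⊛ α) n →
  ∑ (antidiagonal n) (λ (i , j) → (one i * + j - α i) * X j) ≡ + 0
Log-recurrence X α n e = begin
  ∑ diagonal (λ (i , j) → (one i * + j - α i) * X j)
    ≡⟨ ∑-cong diagonal (λ (i , j) _ → lemma (one i) (+ j) (α i) (X j)) ⟩
  ∑ diagonal (λ (i , j) → one i * D X j + - + 1 * (α i * X j))
    ≡⟨ ∑-+ diagonal (λ (i , j) → one i * D X j) (λ (i , j) → - + 1 * (α i * X j)) ⟨
  ∑ diagonal (λ (i , j) → one i * D X j) + ∑ diagonal (λ (i , j) → - + 1 * (α i * X j))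
    ≡⟨ cong₂ _+_ (⊛-∑ one (D X) n) (trans (cong (- + 1 *_) (⊛-∑ α X n))
        (∑-* diagonal (- + 1) (λ (i , j) → α i * X j))) ⟨
  (one ⊛ D X) n + - + 1 * (α ⊛ X) n
    ≡⟨ cong₂ (λ x y → x + - + 1 * y) (trans (⊛-identityˡ (D X) n) e) (⊛-comm α X n) ⟩
  (X ⊛ α) n + - + 1 * (X ⊛ α) n
    ≡⟨ cancel ((X ⊛ α) n) ⟩
  + 0 ∎
  where
  open ≡-Reasoning
  diagonal = antidiagonal n
  lemma : ∀ o j α x → (o * j - α) * x ≡ o * (j * x) + - + 1 * (α * x)
  lemma = solve-∀
  cancel : ∀ x → x + - + 1 * x ≡ + 0
  cancel = solve-∀

opaque
  unfolding ∑

  Θ-zero : Θ 0 ≡ + 4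
  Θ-zero = refl

  Λ-zero : Λ 0 ≡ + 0
  Λ-zero = refl

P-zero : ∀ k → P k 0 ≡ + 1
P-zero zero = refl
P-zero (suc k) = cong (_* + 1) (P-zero k)

-- The logarithmic derivative of `P k` agrees with `Λ` only up to degree k, hence the bound. The
-- factor 4 is the constant term of `Θ`.
Θ≡4P : ∀ k n → n ℕ.≤ k → Θ n ≡ + 4 * P k n
Θ≡4P k n n≤k = recurrence-unique k (λ i j → one i * + j - Λ i) Θ (λ j → + 4 * P k j)
  leading (λ m _ → Log-recurrence Θ Λ m (Log-Θ m)) P-recurrence
  (trans Θ-zero (cong (+ 4 *_) (sym (P-zero k)))) n n≤k
  where
  open ≡-Reasoning
  nonzero : ∀ m {z} → z ≡ + 0 → + 1 * + suc m - z ≢ + 0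
  nonzero m refl ()
  leading : ∀ m → + 1 * + suc m - Λ 0 ≢ + 0
  leading m = nonzero m Λ-zero
  P-recurrence : ∀ m → m ℕ.≤ k → ∑ (antidiagonal m) (λ (i , j) → (one i * + j - Λ i) * (+ 4 * P k j)) ≡ + 0
  P-recurrence m m≤k = begin
    ∑ diagonal (λ (i , j) → (one i * + j - Λ i) * (+ 4 * P k j))
      ≡⟨ ∑-cong diagonal (λ { (i , j) refl → trans (cong (λ α → (one i * + j - α) * (+ 4 * P k j))
           (sym (logP-Λ k i (ℕ.≤-trans (ℕ.m≤m+n i j) m≤k)))) (pull (one i * + j - logP k i) (P k j)) }) ⟩
    ∑ diagonal (λ (i , j) → + 4 * ((one i * + j - logP k i) * P k j))
      ≡⟨ ∑-* diagonal (+ 4) (λ (i , j) → (one i * + j - logP k i) * P k j) ⟨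
    + 4 * ∑ diagonal (λ (i , j) → (one i * + j - logP k i) * P k j)
      ≡⟨ cong (+ 4 *_) (Log-recurrence (P k) (logP k) m (Log-P k m)) ⟩
    + 0 ∎
    where
    diagonal = antidiagonal m
    pull : ∀ x y → x * (+ 4 * y) ≡ + 4 * (x * y)
    pull = solve-∀

-- The dissection of Ψ modulo 3

∑-range-3 : ∀ w → ∑ (range 3) w ≡ w 0 + w 1 + w 2
∑-range-3 w = trans (∑-range-suc 2 w) (cong (_+ w 2) (trans (∑-range-suc 1 w) (cong (_+ w 1)
  (trans (∑-range-suc 0 w) (trans (cong (_+ w 0) (∑-range-zero w)) (ℤ.+-identityˡ (w 0)))))))

residue : ℕ → ℤ → ℤ
residue r p = + r + p * + 3

residue-% : ∀ {r} p → r ℕ.< 3 → residue r p /ℕ 3 ≡ p × residue r p %ℕ 3 ≡ r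
residue-% {r} p r<3 = divMod-unique 3 (residue r p) p r r<3 refl

residue-unique : ∀ {r r′} p p′ → r ℕ.< 3 → r′ ℕ.< 3 → residue r p ≡ residue r′ p′ → r ≡ r′
residue-unique p p′ r< r′< e = trans (sym (proj₂ (residue-% p r<)))
  (trans (cong (_%ℕ 3) e) (proj₂ (residue-% p′ r′<)))

residueG : ℕ → Graded ℤ
residueG r = bounded (triN ∘ residue r) {λ n p → ∣ p ∣ ℕ.≤ suc n ℕ.+ r} (λ n → ∣≤∣ (suc n ℕ.+ r)) bound
  where
  open ℕ.≤-Reasoning
  cancel : ∀ x p → x + p - x ≡ p
  cancel = solve-∀
  bound : ∀ p → ∣ p ∣ ℕ.≤ suc (triN (residue r p)) ℕ.+ r
  bound p = begin
    ∣ p ∣                         ≤⟨ ℕ.m≤m*n ∣ p ∣ 3 ⟩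
    ∣ p ∣ ℕ.* 3                   ≡⟨ ℤ.abs-* p (+ 3) ⟨
    ∣ p * + 3 ∣                   ≡⟨ cong ∣_∣ (cancel (+ r) (p * + 3)) ⟨
    ∣ residue r p - + r ∣         ≤⟨ ℤ.∣i-j∣≤∣i∣+∣j∣ (residue r p) (+ r) ⟩
    ∣ residue r p ∣ ℕ.+ r         ≤⟨ ℕ.+-monoˡ-≤ r (∣x∣≤1+triN (residue r p)) ⟩
    suc (triN (residue r p)) ℕ.+ r ∎

residue-reflect : ∀ p → triN (residue 0 (- p)) ≡ triN (residue 1 p)
residue-reflect p = trans (cong triN (lemma p)) (triN-reflect (residue 1 p))
  where
  lemma : ∀ p → + 0 + - p * + 3 ≡ + 1 - (+ 1 + p * + 3)
  lemma = solve-∀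

residueΨ : ℕ → ℤ → Series
residueΨ r c = gen (residueG r) (λ _ → c)

-- The substitution x ↦ 1 - x maps the class of 1 onto the class of 0, whence the weight 2. Class 0
-- has degrees divisible by 3 and class 2 has degrees 1 + 9t, so this is Ψ(q) = 2 A(q³) + q Ψ(q⁹).
Ψ-dissection : Ψ ≈ residueΨ 0 (+ 2) ∔ residueΨ 2 (+ 1)
Ψ-dissection n = begin
  Ψ n                               ≡⟨ ∑-≅ classes (Σ-enum (range 3) R) (fibre triG n) (λ _ → + 1)
      (λ _ → + 1) (λ _ _ → refl) ⟨
  ∑ (Σ-enum (range 3) R) (λ _ → + 1)  ≡⟨ ∑-Σ (range 3) R (λ _ → + 1) ⟩
  ∑ (range 3) (λ r → card (R r))    ≡⟨ ∑-range-3 (λ r → card (R r)) ⟩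
  card (R 0) + card (R 1) + card (R 2)
    ≡⟨ cong (λ a → card (R 0) + a + card (R 2))
        (∑-≅ reflect (R 1) (R 0) (λ _ → + 1) (λ _ → + 1) (λ _ _ → refl)) ⟩
  card (R 0) + card (R 0) + card (R 2)
    ≡⟨ cong (_+ card (R 2)) (∑-+ (R 0) (λ _ → + 1) (λ _ → + 1)) ⟩
  residueΨ 0 (+ 2) n + residueΨ 2 (+ 1) n  ∎
  where
  open ≡-Reasoning
  R : ∀ r → Enum (λ p → triN (residue r p) ≡ n)
  R r = fibre (residueG r) n
  classes : (λ ((r , p) : ℕ × ℤ) → r ℕ.< 3 × triN (residue r p) ≡ n) ≅ (λ x → triN x ≡ n)
  classes = record { to = λ (r , p) → residue r p ; from = λ x → x %ℕ 3 , x /ℕ 3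
    ; to-⊆ = proj₂ ; from-⊆ = λ {x} e → n%ℕd<d x 3 , trans (cong triN (sym (a≡a%ℕn+[a/ℕn]*n x 3))) e
    ; from-to = λ {(r , p)} (r<3 , _) → let q≡ , r≡ = residue-% p r<3 in cong₂ _,_ r≡ q≡
    ; to-from = λ {x} _ → sym (a≡a%ℕn+[a/ℕn]*n x 3) }
  reflect : (λ p → triN (residue 1 p) ≡ n) ≅ (λ p → triN (residue 0 p) ≡ n)
  reflect = record { to = -_ ; from = -_
    ; to-⊆ = λ {p} e → trans (residue-reflect p) e
    ; from-⊆ = λ {p} e → trans (sym (trans (cong (triN ∘ residue 0) (sym (ℤ.neg-involutive p)))
        (residue-reflect (- p)))) e
    ; from-to = λ {p} _ → ℤ.neg-involutive p ; to-from = λ {p} _ → ℤ.neg-involutive p }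

triZ-residue-0 : ∀ p → triZ (residue 0 p) ≡ + 3 * (p * p + triZ p)
triZ-residue-0 p = halve (lemma (triZ (residue 0 p)) (triZ p) p (2*triZ (residue 0 p)) (2*triZ p))
  where
  lemma : ∀ t u p → + 2 * t ≡ (+ 0 + p * + 3) * (+ 0 + p * + 3 - + 1) → + 2 * u ≡ p * (p - + 1) →
    + 2 * t ≡ + 2 * (+ 3 * (p * p + u))
  lemma t u p e₁ e₂ = linear (+ 1 *[ e₁ ] ⊕ (- + 3) *[ e₂ ]) (solve (t ∷ u ∷ p ∷ []))

triZ-residue-2 : ∀ p → triZ (residue 2 p) ≡ + 1 + + 9 * triZ (p + + 1)
triZ-residue-2 p = halve (lemma (triZ (residue 2 p)) (triZ (p + + 1)) p (2*triZ (residue 2 p))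
    (2*triZ (p + + 1)))
  where
  lemma : ∀ t u p → + 2 * t ≡ (+ 2 + p * + 3) * (+ 2 + p * + 3 - + 1) → + 2 * u ≡ (p + + 1) * (p + + 1 - + 1) →
    + 2 * t ≡ + 2 * (+ 1 + + 9 * u)
  lemma t u p e₁ e₂ = linear (+ 1 *[ e₁ ] ⊕ (- + 9) *[ e₂ ]) (solve (t ∷ u ∷ p ∷ []))

quadG : (r₁ r₂ r₃ r₄ : ℕ) → Graded (ℤ × ℤ × ℤ × ℤ)
quadG r₁ r₂ r₃ r₄ = residueG r₁ ⊗ residueG r₂ ⊗ residueG r₃ ⊗ residueG r₄

quad-count : ∀ r₁ r₂ r₃ r₄ c₁ c₂ c₃ c₄ n →
  (residueΨ r₁ c₁ ⊛ (residueΨ r₂ c₂ ⊛ (residueΨ r₃ c₃ ⊛ residueΨ r₄ c₄))) n ≡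
  ∑ (fibre (quadG r₁ r₂ r₃ r₄) n) (λ _ → c₁ * (c₂ * (c₃ * c₄)))
quad-count r₁ r₂ r₃ r₄ c₁ c₂ c₃ c₄ n = begin
  (residueΨ r₁ c₁ ⊛ (residueΨ r₂ c₂ ⊛ (residueΨ r₃ c₃ ⊛ residueΨ r₄ c₄))) n
    ≡⟨ ⊛-cong {residueΨ r₁ c₁} (λ _ → refl) (λ k → trans
         (⊛-cong {residueΨ r₂ c₂} (λ _ → refl) (gen-⊗ (residueG r₃) (residueG r₄) (λ _ → c₃) (λ _ → c₄)) k)
         (gen-⊗ (residueG r₂) (residueG r₃ ⊗ residueG r₄) (λ _ → c₂) (λ _ → c₃ * c₄) k)) n ⟩
  (residueΨ r₁ c₁ ⊛ gen (residueG r₂ ⊗ residueG r₃ ⊗ residueG r₄) (λ _ → c₂ * (c₃ * c₄))) n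
    ≡⟨ gen-⊗ (residueG r₁) (residueG r₂ ⊗ residueG r₃ ⊗ residueG r₄) (λ _ → c₁) (λ _ → c₂ * (c₃ * c₄)) n ⟩
  ∑ (fibre (quadG r₁ r₂ r₃ r₄) n) (λ _ → c₁ * (c₂ * (c₃ * c₄))) ∎
  where open ≡-Reasoning

binomial : ∀ f g → ((f ∔ g) ⊛ (f ∔ g)) ⊛ ((f ∔ g) ⊛ (f ∔ g)) ≈
  f ⊛ (f ⊛ (f ⊛ f)) ∔
  (f ⊛ (f ⊛ (f ⊛ g)) ∔ f ⊛ (f ⊛ (f ⊛ g)) ∔ f ⊛ (f ⊛ (f ⊛ g)) ∔ f ⊛ (f ⊛ (f ⊛ g))) ∔
  (f ⊛ (f ⊛ (g ⊛ g)) ∔ f ⊛ (f ⊛ (g ⊛ g)) ∔ f ⊛ (f ⊛ (g ⊛ g)) ∔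
   f ⊛ (f ⊛ (g ⊛ g)) ∔ f ⊛ (f ⊛ (g ⊛ g)) ∔ f ⊛ (f ⊛ (g ⊛ g))) ∔
  (f ⊛ (g ⊛ (g ⊛ g)) ∔ f ⊛ (g ⊛ (g ⊛ g)) ∔ f ⊛ (g ⊛ (g ⊛ g)) ∔ f ⊛ (g ⊛ (g ⊛ g))) ∔
  g ⊛ (g ⊛ (g ⊛ g))
binomial = solve⊛ 2 (λ f g → ((f :+ g) :* (f :+ g)) :* ((f :+ g) :* (f :+ g)) :=
  f :* (f :* (f :* f)) :+
  (f :* (f :* (f :* g)) :+ f :* (f :* (f :* g)) :+ f :* (f :* (f :* g)) :+ f :* (f :* (f :* g))) :+
  (f :* (f :* (g :* g)) :+ f :* (f :* (g :* g)) :+ f :* (f :* (g :* g)) :+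
   f :* (f :* (g :* g)) :+ f :* (f :* (g :* g)) :+ f :* (f :* (g :* g))) :+
  (f :* (g :* (g :* g)) :+ f :* (g :* (g :* g)) :+ f :* (g :* (g :* g)) :+ f :* (g :* (g :* g))) :+
  g :* (g :* (g :* g))) (λ _ → refl)

-- Only f³g and g⁴ survive in the binomial expansion. There are four places for g and each f carries
-- the weight 2, so the first count has the coefficient 4 · 2³ = 32.
Ψ⁴-count : ∀ n → (∀ v → deg (quadG 0 0 0 0) v ≢ n) → (∀ v → deg (quadG 0 0 2 2) v ≢ n) →
  (∀ v → deg (quadG 0 2 2 2) v ≢ n) → ((Ψ ⊛ Ψ) ⊛ (Ψ ⊛ Ψ)) n ≡
  + 32 * card (fibre (quadG 0 0 0 2) n) + card (fibre (quadG 2 2 2 2) n)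
Ψ⁴-count n none₀ none₂ none₃ = begin
  ((Ψ ⊛ Ψ) ⊛ (Ψ ⊛ Ψ)) n
    ≡⟨ ⊛-cong {g = Ψ ⊛ Ψ} Ψ² Ψ² n ⟩
  (((f ∔ g) ⊛ (f ∔ g)) ⊛ ((f ∔ g) ⊛ (f ∔ g))) n
    ≡⟨ binomial f g n ⟩
  (f ⊛ (f ⊛ (f ⊛ f))) n + (fffg + fffg + fffg + fffg) + (ffgg + ffgg + ffgg + ffgg + ffgg + ffgg)
    + (fggg + fggg + fggg + fggg) + gggg
    ≡⟨ total ((f ⊛ (f ⊛ (f ⊛ f))) n) fffg ffgg fggg gggg (card (fibre (quadG 0 0 0 2) n))
        (card (fibre (quadG 2 2 2 2) n))
         (trans (quad-count 0 0 0 0 (+ 2) (+ 2) (+ 2) (+ 2) n) (∑-empty (fibre (quadG 0 0 0 0) n) none₀))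
         (trans (quad-count 0 0 0 2 (+ 2) (+ 2) (+ 2) (+ 1) n)
             (sym (∑-* (fibre (quadG 0 0 0 2) n) (+ 8) (λ _ → + 1))))
         (trans (quad-count 0 0 2 2 (+ 2) (+ 2) (+ 1) (+ 1) n) (∑-empty (fibre (quadG 0 0 2 2) n) none₂))
         (trans (quad-count 0 2 2 2 (+ 2) (+ 1) (+ 1) (+ 1) n) (∑-empty (fibre (quadG 0 2 2 2) n) none₃))
         (quad-count 2 2 2 2 (+ 1) (+ 1) (+ 1) (+ 1) n) ⟩
  + 32 * card (fibre (quadG 0 0 0 2) n) + card (fibre (quadG 2 2 2 2) n)
    ∎
  where
  open ≡-Reasoning
  f = residueΨ 0 (+ 2)
  g = residueΨ 2 (+ 1)
  fffg = (f ⊛ (f ⊛ (f ⊛ g))) n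
  ffgg = (f ⊛ (f ⊛ (g ⊛ g))) n
  fggg = (f ⊛ (g ⊛ (g ⊛ g))) n
  gggg = (g ⊛ (g ⊛ (g ⊛ g))) n
  Ψ² : Ψ ⊛ Ψ ≈ (f ∔ g) ⊛ (f ∔ g)
  Ψ² = ⊛-cong {g = Ψ} Ψ-dissection Ψ-dissection
  total : ∀ a b c d e b′ e′ → a ≡ + 0 → b ≡ + 8 * b′ → c ≡ + 0 → d ≡ + 0 → e ≡ e′ →
    a + (b + b + b + b) + (c + c + c + c + c + c) + (d + d + d + d) + e ≡ + 32 * b′ + e′
  total a b c d e b′ e′ p q r s t = linear (+ 1 *[ p ] ⊕ (+ 4) *[ q ] ⊕ (+ 6) *[ r ] ⊕ (+ 4) *[ s ] ⊕ + 1 *[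
      t ])
    (solve (a ∷ b ∷ c ∷ d ∷ e ∷ b′ ∷ e′ ∷ []))

-- Modulo 3 a variable of class 0 adds 0 to the degree and one of class 2 adds 1, so degree 3k + 1
-- takes one or four variables of class 2.
Ψ⁴-dissection : ∀ k n → n ≡ suc (3 ℕ.* k) → ((Ψ ⊛ Ψ) ⊛ (Ψ ⊛ Ψ)) n ≡
  + 32 * card (fibre (quadG 0 0 0 2) n) + card (fibre (quadG 2 2 2 2) n)
Ψ⁴-dissection k n n≡ = Ψ⁴-count n none₀ none₂ none₃
  where
  +n : + n ≡ residue 1 (+ k)
  +n = trans (cong +_ n≡) (cong (ℤ._+_ (+ 1)) (trans (ℤ.pos-* 3 k) (ℤ.*-comm (+ 3) (+ k))))
  none₀ : ∀ v → ¬ (deg (quadG 0 0 0 0) v ≡ n)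
  none₀ (a , b , c , d) e = ℕ.1+n≢0 (residue-unique (+ k) (x a + (x b + (x c + x d))) (s≤s (s≤s z≤n))
      (s≤s z≤n) (trans (sym +n) (trans (cong +_ (sym e)) (trans
      (cong₂ _+_ (triZ-residue-0 a) (cong₂ _+_ (triZ-residue-0 b)
          (cong₂ _+_ (triZ-residue-0 c) (triZ-residue-0 d))))
      (collect (x a) (x b) (x c) (x d))))))
    where
    x : ℤ → ℤ
    x p = p * p + triZ p
    collect : ∀ a b c d → + 3 * a + (+ 3 * b + (+ 3 * c + + 3 * d)) ≡ + 0 + (a + (b + (c + d))) * + 3
    collect = solve-∀
  none₂ : ∀ v → ¬ (deg (quadG 0 0 2 2) v ≡ n)
  none₂ (a , b , c , d) e = ℕ.1+n≢n (sym (residue-unique (+ k) (x a + (x b + + 3 * (y c + y d)))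
      (s≤s (s≤s z≤n)) (s≤s (s≤s (s≤s z≤n))) (trans (sym +n) (trans (cong +_ (sym e)) (trans
      (cong₂ _+_ (triZ-residue-0 a) (cong₂ _+_ (triZ-residue-0 b)
          (cong₂ _+_ (triZ-residue-2 c) (triZ-residue-2 d))))
      (collect (x a) (x b) (y c) (y d)))))))
    where
    x y : ℤ → ℤ
    x p = p * p + triZ p
    y p = triZ (p + + 1)
    collect : ∀ a b c d → + 3 * a + (+ 3 * b + ((+ 1 + + 9 * c) + (+ 1 + + 9 * d))) ≡ + 2 +
        (a + (b + + 3 * (c + d))) * + 3
    collect = solve-∀
  none₃ : ∀ v → ¬ (deg (quadG 0 2 2 2) v ≡ n)
  none₃ (a , b , c , d) e = ℕ.1+n≢0 (residue-unique (+ k) (x a + (+ 1 + + 3 * (y b + (y c + y d))))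
      (s≤s (s≤s z≤n)) (s≤s z≤n) (trans (sym +n) (trans (cong +_ (sym e)) (trans
      (cong₂ _+_ (triZ-residue-0 a) (cong₂ _+_ (triZ-residue-2 b)
          (cong₂ _+_ (triZ-residue-2 c) (triZ-residue-2 d))))
      (collect (x a) (y b) (y c) (y d))))))
    where
    x y : ℤ → ℤ
    x p = p * p + triZ p
    y p = triZ (p + + 1)
    collect : ∀ a b c d → + 3 * a + ((+ 1 + + 9 * b) + ((+ 1 + + 9 * c) + (+ 1 + + 9 * d))) ≡ + 0 +
        (a + (+ 1 + + 3 * (b + (c + d)))) * + 3
    collect = solve-∀

-- Removing the constant from 1 + 9t in the fourth variable, which has class 2, lowers the degree 3k
-- + 1 to 3k. The other three variables share a residue, so their differences are divisible by 3.
classG : ℕ → Graded (ℤ × ℤ × ℤ × ℤ)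
classG r = residueG r ⊗ residueG r ⊗ residueG r ⊗ scale 9 triG

classCount : ℕ → ℕ → ℤ
classCount r k = card (fibre (classG r) (3 ℕ.* k))

triN-residue-2 : ∀ p → triN (residue 2 p) ≡ suc (9 ℕ.* triN (p + + 1))
triN-residue-2 p = ℤ.+-injective (trans (triZ-residue-2 p)
    (cong (ℤ._+_ (+ 1)) (sym (ℤ.pos-* 9 (triN (p + + 1))))))

quad-class : ∀ r k n → n ≡ suc (3 ℕ.* k) → card (fibre (quadG r r r 2) n) ≡ classCount r k
quad-class r k n n≡ = ∑-≅ shift (fibre (quadG r r r 2) n) (fibre (classG r) (3 ℕ.* k)) (λ _ → + 1)
    (λ _ → + 1) (λ _ _ → refl)
  where
  deg-shift : ∀ a b c d → deg (quadG r r r 2) (a , b , c , d) ≡ suc (deg (classG r) (a , b , c , d + + 1))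
  deg-shift a b c d = trans (cong (λ t → T a ℕ.+ (T b ℕ.+ (T c ℕ.+ t))) (triN-residue-2 d))
      (lemma (T a) (T b) (T c) (9 ℕ.* triN (d + + 1)))
    where
    T : ℤ → ℕ
    T p = triN (residue r p)
    lemma : ∀ a b c d → a ℕ.+ (b ℕ.+ (c ℕ.+ suc d)) ≡ suc (a ℕ.+ (b ℕ.+ (c ℕ.+ d)))
    lemma = ℕ-Solver.solve-∀
  up-down : ∀ d → d - + 1 + + 1 ≡ d
  up-down = solve-∀
  down-up : ∀ d → d + + 1 - + 1 ≡ d
  down-up = solve-∀
  shift : (λ v → deg (quadG r r r 2) v ≡ n) ≅ (λ v → deg (classG r) v ≡ 3 ℕ.* k)
  shift = record { to = λ (a , b , c , d) → a , b , c , d + + 1 ; from = λ (a , b , c , d) → a , b , c , d - + 1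
    ; to-⊆ = λ {(a , b , c , d)} e → ℕ.suc-injective (trans (sym (deg-shift a b c d)) (trans e n≡))
    ; from-⊆ = λ {(a , b , c , d)} e → trans (deg-shift a b c (d - + 1))
        (trans (cong suc (trans (cong (λ d → deg (classG r) (a , b , c , d)) (up-down d)) e)) (sym n≡))
    ; from-to = λ {(a , b , c , d)} _ → cong (λ d → a , b , c , d) (down-up d)
    ; to-from = λ {(a , b , c , d)} _ → cong (λ d → a , b , c , d) (up-down d) }

classCount-1 : ∀ k → classCount 1 k ≡ classCount 0 k
classCount-1 k = ∑-≅ reflect (fibre (classG 1) (3 ℕ.* k)) (fibre (classG 0) (3 ℕ.* k)) (λ _ → + 1)
    (λ _ → + 1) (λ _ _ → refl)
  where
  negate : ℤ × ℤ × ℤ × ℤ → ℤ × ℤ × ℤ × ℤ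
  negate (a , b , c , d) = - a , - b , - c , d
  involutive : ∀ v → negate (negate v) ≡ v
  involutive (a , b , c , d) = cong₂ _,_ (ℤ.neg-involutive a)
      (cong₂ _,_ (ℤ.neg-involutive b) (cong₂ _,_ (ℤ.neg-involutive c) refl))
  deg-negate : ∀ v → deg (classG 0) (negate v) ≡ deg (classG 1) v
  deg-negate (a , b , c , d) = cong₂ ℕ._+_ (residue-reflect a)
      (cong₂ ℕ._+_ (residue-reflect b) (cong (ℕ._+ 9 ℕ.* triN d) (residue-reflect c)))
  reflect : (λ v → deg (classG 1) v ≡ 3 ℕ.* k) ≅ (λ v → deg (classG 0) v ≡ 3 ℕ.* k)
  reflect = record { to = negate ; from = negate
    ; to-⊆ = λ {v} e → trans (deg-negate v) e
    ; from-⊆ = λ {v} e → trans (sym (deg-negate (negate v))) (trans (cong (deg (classG 0)) (involutive v)) e)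
    ; from-to = λ {v} _ → involutive v ; to-from = λ {v} _ → involutive v }

16F-classes : ∀ k → + 16 * F (suc (3 ℕ.* k)) ≡ + 32 * classCount 0 k + classCount 2 k
16F-classes k = go (suc (3 ℕ.* k)) refl
  where
  go : ∀ n → n ≡ suc (3 ℕ.* k) → + 16 * F n ≡ + 32 * classCount 0 k + classCount 2 k
  go n n≡ = trans (sym (Ψ⁴≡16F n)) (trans (Ψ⁴-dissection k n n≡)
    (cong₂ (λ x y → + 32 * x + y) (quad-class 0 k n n≡) (quad-class 2 k n n≡)))

deg-class-2 : ∀ a b c d → + deg (classG 2) (a , b , c , d) ≡
  + 3 * (+ 1 + + 3 * (triZ (a + + 1) + triZ (b + + 1) + (triZ (c + + 1) + triZ d)))
deg-class-2 a b c d = trans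
  (cong₂ _+_ (triZ-residue-2 a) (cong₂ _+_ (triZ-residue-2 b)
      (cong₂ _+_ (triZ-residue-2 c) (ℤ.pos-* 9 (triN d)))))
  (lemma (triZ (a + + 1)) (triZ (b + + 1)) (triZ (c + + 1)) (triZ d))
  where
  lemma : ∀ a b c d → (+ 1 + + 9 * a) + ((+ 1 + + 9 * b) + ((+ 1 + + 9 * c) + + 9 * d)) ≡
    + 3 * (+ 1 + + 3 * (a + b + (c + d)))
  lemma = solve-∀

deg-class-2′ : ∀ k v → deg (classG 2) v ≡ 3 ℕ.* k → + k ≡ + 1 + + 3 *
    (triZ (proj₁ v + + 1) + triZ (proj₁ (proj₂ v) + + 1)
  + (triZ (proj₁ (proj₂ (proj₂ v)) + + 1) + triZ (proj₂ (proj₂ (proj₂ v)))))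
deg-class-2′ k (a , b , c , d) e = ℤ.*-cancelˡ-≡ (+ 3) _ _
  (trans (sym (ℤ.pos-* 3 k)) (trans (cong +_ (sym e)) (deg-class-2 a b c d)))

-- The first three variables contribute 1 modulo 9 each and the fourth contributes 0, so 3k ≡ 3
-- modulo 9.
classCount-2-zero : ∀ k → (∀ j → k ≢ suc (3 ℕ.* j)) → classCount 2 k ≡ + 0
classCount-2-zero k k≢ = ∑-empty (fibre (classG 2) (3 ℕ.* k)) λ { v@(a , b , c , d) e →
  k≢ (triN (a + + 1) ℕ.+ triN (b + + 1) ℕ.+ (triN (c + + 1) ℕ.+ triN d))
     (ℤ.+-injective (trans (deg-class-2′ k v e) (cong (ℤ._+_ (+ 1)) (sym (ℤ.pos-* 3
       (triN (a + + 1) ℕ.+ triN (b + + 1) ℕ.+ (triN (c + + 1) ℕ.+ triN d))))))) }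

-- After division by 3, removal of 1 and another division by 3, the form is again a sum of four
-- triangular numbers, so Legendre's theorem applies a second time, now at j.
classCount-2 : ∀ j k → k ≡ suc (3 ℕ.* j) → classCount 2 k ≡ + 16 * F j
classCount-2 j k k≡ = begin
  classCount 2 k
    ≡⟨ ∑-≅ shift (fibre (classG 2) (3 ℕ.* k)) (fibre tri⁴ j) (λ _ → + 1) (λ _ → + 1) (λ _ _ → refl) ⟩
  gen tri⁴ (λ _ → + 1) j
    ≡⟨ gen-⊗ (triG ⊗ triG) (triG ⊗ triG) (λ _ → + 1) (λ _ → + 1) j ⟨
  (gen (triG ⊗ triG) (λ _ → + 1) ⊛ gen (triG ⊗ triG) (λ _ → + 1)) j
    ≡⟨ ⊛-cong (gen-⊗ triG triG (λ _ → + 1) (λ _ → + 1)) (gen-⊗ triG triG (λ _ → + 1) (λ _ → + 1)) j ⟨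
  ((Ψ ⊛ Ψ) ⊛ (Ψ ⊛ Ψ)) j
    ≡⟨ Ψ⁴≡16F j ⟩
  + 16 * F j ∎
  where
  open ≡-Reasoning
  tri⁴ : Graded ((ℤ × ℤ) × (ℤ × ℤ))
  tri⁴ = (triG ⊗ triG) ⊗ (triG ⊗ triG)
  up-down : ∀ d → d - + 1 + + 1 ≡ d
  up-down = solve-∀
  down-up : ∀ d → d + + 1 - + 1 ≡ d
  down-up = solve-∀
  cancel : ∀ s t → + 1 + + 3 * s ≡ + 1 + + 3 * t → s ≡ t
  cancel s t e = ℤ.*-cancelˡ-≡ (+ 3) s t (linear (+ 1 *[ e ]) (solve (s ∷ t ∷ [])))
  +k : + k ≡ + 1 + + 3 * + j
  +k = trans (cong +_ k≡) (cong (ℤ._+_ (+ 1)) (ℤ.pos-* 3 j))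
  shift : (λ v → deg (classG 2) v ≡ 3 ℕ.* k) ≅ (λ v → deg tri⁴ v ≡ j)
  shift = record
    { to = λ (a , b , c , d) → (a + + 1 , b + + 1) , (c + + 1 , d)
    ; from = λ ((a , b) , (c , d)) → a - + 1 , b - + 1 , c - + 1 , d
    ; to-⊆ = λ {v} e → ℤ.+-injective (cancel _ (+ j) (trans (sym (deg-class-2′ k v e)) +k))
    ; from-⊆ = λ {((a , b) , (c , d))} e → ℤ.+-injective (trans (deg-class-2 (a - + 1) (b - + 1) (c - + 1) d)
        (trans (cong (λ s → + 3 * (+ 1 + + 3 * s))
          (trans (cong₂ _+_ (cong₂ _+_ (cong triZ (up-down a)) (cong triZ (up-down b)))
              (cong (_+ triZ d) (cong triZ (up-down c)))) (cong +_ e)))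
          (trans (cong (+ 3 *_) (sym +k)) (sym (ℤ.pos-* 3 k)))))
    ; from-to = λ {(a , b , c , d)} _ → cong₂ _,_ (down-up a) (cong₂ _,_ (down-up b) (cong (_, d) (down-up c)))
    ; to-from = λ {((a , b) , (c , d))} _ → cong₂ _,_ (cong₂ _,_ (up-down a) (up-down b))
        (cong (_, d) (up-down c)) }

-- The quaternary form of the series ψ(q) ψ(q³) a(q), with a(q) = Σ q^(u² + uv + v²).
Eisenstein : ℕ → ℤ × ℤ × ℤ × ℤ → Set
Eisenstein k (x , y , u , v) = triZ x + + 3 * triZ y + (u * u + u * v + v * v) ≡ + k

-- Triples of integers in one residue class r modulo 3 correspond to (x , u , v): their mean is x,
-- their differences are 3 u and 3 v.
class-≅ : ∀ k → (λ ((r , v) : ℕ × ℤ × ℤ × ℤ × ℤ) → r ℕ.< 3 × deg (classG r) v ≡ 3 ℕ.* k) ≅ Eisenstein k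
class-≅ k = record
  { to = λ (r , p₁ , p₂ , p₃ , y) → + r + p₁ + p₂ + p₃ , y , p₁ - p₂ , p₂ - p₃
  -- `s` is the middle member r + 3 p₂ of the triple, so its residue and quotient modulo 3 recover r
  -- and p₂.
  ; from = λ (x , y , u , v) → let s = x - u + v in s %ℕ 3 , s /ℕ 3 + u , s /ℕ 3 , s /ℕ 3 - v , y
  ; to-⊆ = λ {(r , p₁ , p₂ , p₃ , y)} (_ , e) →
      forward (+ r) p₁ p₂ p₃ (+ k) _ _ _ (triZ y) _
        (trans (cong (λ t → triZ (residue r p₁) + (triZ (residue r p₂) + (triZ (residue r p₃) + t)))
            (sym (ℤ.pos-* 9 (triN y)))) (trans (cong +_ e) (ℤ.pos-* 3 k)))
        (2*triZ (residue r p₁)) (2*triZ (residue r p₂)) (2*triZ (residue r p₃)) (2*triZ (+ r + p₁ + p₂ + p₃))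
  ; from-⊆ = λ {(x , y , u , v)} e → let s = x - u + v ; r = s %ℕ 3 ; q = s /ℕ 3 in
      n%ℕd<d s 3 , ℤ.+-injective (trans
        (cong (λ t → triZ (residue r (q + u)) + (triZ (residue r q) + (triZ (residue r (q - v)) + t)))
            (ℤ.pos-* 9 (triN y)))
        (trans (backward x u v (+ r) q (+ k) (triZ (residue r (q + u))) (triZ (residue r q))
            (triZ (residue r (q - v))) (triZ y) (triZ x)
          (a≡a%ℕn+[a/ℕn]*n s 3) e
          (2*triZ (residue r (q + u))) (2*triZ (residue r q)) (2*triZ (residue r (q - v))) (2*triZ x))
              (sym (ℤ.pos-* 3 k))))
  ; from-to = λ {(r , p₁ , p₂ , p₃ , y)} (r<3 , _) →
      let q≡ , r≡ = divMod-unique 3 (+ r + p₁ + p₂ + p₃ - (p₁ - p₂) + (p₂ - p₃)) p₂ r r<3 (middle (+ r) p₁ p₂ p₃)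
      in cong₂ _,_ r≡ (cong₂ _,_ (trans (cong (_+ (p₁ - p₂)) q≡) (first p₁ p₂))
           (cong₂ _,_ q≡ (cong (_, y) (trans (cong (_- (p₂ - p₃)) q≡) (last p₂ p₃)))))
  ; to-from = λ {(x , y , u , v)} _ → let s = x - u + v ; r = s %ℕ 3 ; q = s /ℕ 3 in
      cong₂ _,_ (mean x u v (+ r) q (a≡a%ℕn+[a/ℕn]*n s 3))
        (cong (y ,_) (cong₂ _,_ (difference q u) (difference′ q v)))
  }
  where
  -- Three numbers r + 3pᵢ with mean x have squares summing to 3x² plus the squared deviations. The
  -- deviations amount to 6 (u² + uv + v²), as the differences are 3u, 3v and 3(u + v). Hence the
  -- triangular numbers sum to 3 (x(x - 1)/2 + u² + uv + v²).
  forward : ∀ r p₁ p₂ p₃ k t₁ t₂ t₃ ty tx → t₁ + (t₂ + (t₃ + + 9 * ty)) ≡ + 3 * k →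
    + 2 * t₁ ≡ (r + p₁ * + 3) * (r + p₁ * + 3 - + 1) →
    + 2 * t₂ ≡ (r + p₂ * + 3) * (r + p₂ * + 3 - + 1) →
    + 2 * t₃ ≡ (r + p₃ * + 3) * (r + p₃ * + 3 - + 1) →
    + 2 * tx ≡ (r + p₁ + p₂ + p₃) * (r + p₁ + p₂ + p₃ - + 1) →
    tx + + 3 * ty + ((p₁ - p₂) * (p₁ - p₂) + (p₁ - p₂) * (p₂ - p₃) + (p₂ - p₃) * (p₂ - p₃)) ≡ k
  forward r p₁ p₂ p₃ k t₁ t₂ t₃ ty tx e e₁ e₂ e₃ ex = ℤ.*-cancelˡ-≡ (+ 6) _ k sixfold
    where
    sixfold : + 6 * (tx + + 3 * ty + ((p₁ - p₂) * (p₁ - p₂) + (p₁ - p₂) * (p₂ - p₃) + (p₂ - p₃) *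
        (p₂ - p₃))) ≡ + 6 * k
    sixfold = linear (+ 2 *[ e ] ⊕ (- + 1) *[ e₁ ] ⊕ (- + 1) *[ e₂ ] ⊕ (- + 1) *[ e₃ ] ⊕ + 3 *[ ex ])
      (solve (r ∷ p₁ ∷ p₂ ∷ p₃ ∷ k ∷ t₁ ∷ t₂ ∷ t₃ ∷ ty ∷ tx ∷ []))
  backward : ∀ x u v r q k t₁ t₂ t₃ ty tx → x - u + v ≡ r + q * + 3 →
    tx + + 3 * ty + (u * u + u * v + v * v) ≡ k →
    + 2 * t₁ ≡ (r + (q + u) * + 3) * (r + (q + u) * + 3 - + 1) →
    + 2 * t₂ ≡ (r + q * + 3) * (r + q * + 3 - + 1) →
    + 2 * t₃ ≡ (r + (q - v) * + 3) * (r + (q - v) * + 3 - + 1) →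
    + 2 * tx ≡ x * (x - + 1) →
    t₁ + (t₂ + (t₃ + + 9 * ty)) ≡ + 3 * k
  backward x u v r q k t₁ t₂ t₃ ty tx es e e₁ e₂ e₃ ex = halve twofold
    where
    twofold : + 2 * (t₁ + (t₂ + (t₃ + + 9 * ty))) ≡ + 2 * (+ 3 * k)
    twofold = linear (+ 6 *[ e ] ⊕ + 1 *[ e₁ ] ⊕ + 1 *[ e₂ ] ⊕ + 1 *[ e₃ ] ⊕ (- + 3) *[ ex ]
        ⊕ (+ 3 - + 3 * (r + q * + 3 + x - u + v) - + 6 * (u - v)) *[ es ])
      (solve (x ∷ u ∷ v ∷ r ∷ q ∷ k ∷ t₁ ∷ t₂ ∷ t₃ ∷ ty ∷ tx ∷ []))
  middle : ∀ r p₁ p₂ p₃ → r + p₁ + p₂ + p₃ - (p₁ - p₂) + (p₂ - p₃) ≡ r + p₂ * + 3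
  middle = solve-∀
  first : ∀ p₁ p₂ → p₂ + (p₁ - p₂) ≡ p₁
  first = solve-∀
  last : ∀ p₂ p₃ → p₂ - (p₂ - p₃) ≡ p₃
  last = solve-∀
  mean : ∀ x u v r q → x - u + v ≡ r + q * + 3 → r + (q + u) + q + (q - v) ≡ x
  mean x u v r q e = linear ((- + 1) *[ e ]) (solve (x ∷ u ∷ v ∷ r ∷ q ∷ []))
  difference : ∀ q u → q + u - q ≡ u
  difference = solve-∀
  difference′ : ∀ q v → q - (q - v) ≡ v
  difference′ = solve-∀

eisenstein : ∀ k → Enum (Eisenstein k)
eisenstein k = transport (class-≅ k) (Σ-enum (range 3) (λ r → fibre (classG r) (3 ℕ.* k)))

-- With C₀ and C₂ the class counts, the three residues give 2 C₀ + C₂ in total, whereas Legendre's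
-- theorem controls 32 C₀ + C₂. Multiplication by 16 matches the C₀ and leaves a surplus of 15 C₂.
eisenstein-count : ∀ k → + 16 * card (eisenstein k) ≡ + 16 * F (suc (3 ℕ.* k)) + + 15 * classCount 2 k
eisenstein-count k = begin
  + 16 * card (eisenstein k)
    ≡⟨ cong (+ 16 *_) (∑-≅ (class-≅ k) (Σ-enum (range 3) R) (eisenstein k) (λ _ → + 1) (λ _ → + 1)
        (λ _ _ → refl)) ⟨
  + 16 * ∑ (Σ-enum (range 3) R) (λ _ → + 1)
    ≡⟨ cong (+ 16 *_) (trans (∑-Σ (range 3) R (λ _ → + 1)) (∑-range-3 (λ r → card (R r)))) ⟩
  + 16 * (classCount 0 k + classCount 1 k + classCount 2 k)
    ≡⟨ cong (λ c → + 16 * (classCount 0 k + c + classCount 2 k)) (classCount-1 k) ⟩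
  + 16 * (classCount 0 k + classCount 0 k + classCount 2 k)
    ≡⟨ lemma (classCount 0 k) (classCount 2 k) ⟩
  (+ 32 * classCount 0 k + classCount 2 k) + + 15 * classCount 2 k
    ≡⟨ cong (_+ + 15 * classCount 2 k) (16F-classes k) ⟨
  + 16 * F (suc (3 ℕ.* k)) + + 15 * classCount 2 k ∎
  where
  open ≡-Reasoning
  R : ∀ r → Enum (λ v → deg (classG r) v ≡ 3 ℕ.* k)
  R r = fibre (classG r) (3 ℕ.* k)
  lemma : ∀ a b → + 16 * (a + a + b) ≡ (+ 32 * a + b) + + 15 * b
  lemma = solve-∀

-- The divisor sum

3∣⇒≡ : ∀ d → 3 ∣ suc d → d ≡ 2 ℕ.+ d ℕ./ 3 ℕ.* 3
3∣⇒≡ d (divides (suc q) e) = trans d≡ (cong (λ q → 2 ℕ.+ q ℕ.* 3) (sym (ℤ.+-injective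
  (proj₁ (divMod-unique 3 (+ d) (+ q) 2 (s≤s (s≤s (s≤s z≤n)))
      (trans (cong +_ d≡) (cong (ℤ._+_ (+ 2)) (ℤ.pos-* q 3))))))))
  where
  d≡ : d ≡ 2 ℕ.+ q ℕ.* 3
  d≡ = ℕ.suc-injective e

[2+3d]/3 : ∀ d → (2 ℕ.+ d ℕ.* 3) ℕ./ 3 ≡ d
[2+3d]/3 d = ℤ.+-injective (proj₁ (divMod-unique 3 (+ (2 ℕ.+ d ℕ.* 3)) (+ d) 2 (s≤s (s≤s (s≤s z≤n)))
  (cong (ℤ._+_ (+ 2)) (ℤ.pos-* d 3))))

3∣3+ : ∀ d → 3 ∣ suc (2 ℕ.+ d ℕ.* 3)
3∣3+ d = divides (suc d) refl

3∣? : Decidable (λ ((d , δ) : ℕ × ℕ) → 3 ∣ suc d)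
3∣? (d , δ) = 3 ∣? suc d

weight : ℕ × ℕ → ℤ
weight (d , _) = + suc d

-- The sum of the divisors prime to 3. It ignores factors 3 of n, which makes it the constant term
-- of the recursion along powers of 3.
σ′ : ℕ → ℤ
σ′ n = ∑ (fibre pairG n ∖ 3∣?) weight

prime-3 : Prime 3
prime-3 = toWitness {a? = prime? 3} _

-- A divisor of 3n that is prime to 3 forces the factor 3 into its codivisor, by Euclid's lemma.
coprime-≅ : ∀ n → (λ ((d , δ) : ℕ × ℕ) → suc d ℕ.* suc δ ≡ n × ¬ (3 ∣ suc d)) ≅
  (λ ((d , δ) : ℕ × ℕ) → suc d ℕ.* suc δ ≡ 3 ℕ.* n × ¬ (3 ∣ suc d))
coprime-≅ n = record
  { to = λ (d , δ) → d , 2 ℕ.+ δ ℕ.* 3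
  ; from = λ (d , δ) → d , δ ℕ./ 3
  ; to-⊆ = λ {(d , δ)} (e , ∤) → trans (triple d δ) (cong (3 ℕ.*_) e) , ∤
  ; from-⊆ = λ {(d , δ)} (e , ∤) → ℕ.*-cancelˡ-≡ _ n 3 (trans (sym (triple d (δ ℕ./ 3)))
      (trans (cong (λ δ → suc d ℕ.* suc δ) (sym (3∣⇒≡ δ (divisible d δ e ∤)))) e)) , ∤
  ; from-to = λ {(d , δ)} _ → cong (d ,_) ([2+3d]/3 δ)
  ; to-from = λ {(d , δ)} (e , ∤) → cong (d ,_) (sym (3∣⇒≡ δ (divisible d δ e ∤))) }
  where
  triple : ∀ d δ → suc d ℕ.* suc (2 ℕ.+ δ ℕ.* 3) ≡ 3 ℕ.* (suc d ℕ.* suc δ)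
  triple = ℕ-Solver.solve-∀
  divisible : ∀ d δ → suc d ℕ.* suc δ ≡ 3 ℕ.* n → ¬ (3 ∣ suc d) → 3 ∣ suc δ
  divisible d δ e ∤ with euclidsLemma (suc d) (suc δ) prime-3 (subst (3 ∣_) (sym e) (m∣m*n n))
  ... | inj₁ p = ⊥-elim (∤ p)
  ... | inj₂ p = p

σ′-triple : ∀ n → σ′ (3 ℕ.* n) ≡ σ′ n
σ′-triple n = sym (∑-≅ (coprime-≅ n) (fibre pairG n ∖ 3∣?) (fibre pairG (3 ℕ.* n) ∖ 3∣?) weight weight
    (λ _ _ → refl))

-- The divisors of 3n that are multiples of 3 are the 3d with d dividing n; the remaining ones are
-- the divisors of n prime to 3.
Σσ-triple : ∀ n → Σσ (3 ℕ.* n) ≡ + 3 * Σσ n + σ′ n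
Σσ-triple n = trans (∑-split (fibre pairG (3 ℕ.* n)) 3∣? weight) (cong₂ _+_
  (sym (trans (∑-* (fibre pairG n) (+ 3) weight)
    (∑-≅ divisible-≅ (fibre pairG n) (fibre pairG (3 ℕ.* n) ∩ 3∣?) (λ v → + 3 * weight v) weight
      (λ (d , _) _ → trans (lemma (+ d)) (cong (ℤ._+_ (+ 3)) (sym (ℤ.pos-* d 3)))))))
  (σ′-triple n))
  where
  lemma : ∀ d → + 3 * (+ 1 + d) ≡ + 3 + d * + 3
  lemma = solve-∀
  triple : ∀ d δ → suc (2 ℕ.+ d ℕ.* 3) ℕ.* suc δ ≡ 3 ℕ.* (suc d ℕ.* suc δ)
  triple = ℕ-Solver.solve-∀
  divisible-≅ : (λ ((d , δ) : ℕ × ℕ) → suc d ℕ.* suc δ ≡ n) ≅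
      (λ ((d , δ) : ℕ × ℕ) → suc d ℕ.* suc δ ≡ 3 ℕ.* n × 3 ∣ suc d)
  divisible-≅ = record
    { to = λ (d , δ) → 2 ℕ.+ d ℕ.* 3 , δ
    ; from = λ (d , δ) → d ℕ./ 3 , δ
    ; to-⊆ = λ {(d , δ)} e → trans (triple d δ) (cong (3 ℕ.*_) e) , 3∣3+ d
    ; from-⊆ = λ {(d , δ)} (e , 3∣) → ℕ.*-cancelˡ-≡ _ n 3 (trans (sym (triple (d ℕ./ 3) δ))
        (trans (cong (λ d → suc d ℕ.* suc δ) (sym (3∣⇒≡ d 3∣))) e))
    ; from-to = λ {(d , δ)} _ → cong (_, δ) ([2+3d]/3 d)
    ; to-from = λ {(d , δ)} (_ , 3∣) → cong (_, δ) (sym (3∣⇒≡ d 3∣)) }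

σ′-coprime : ∀ n → ¬ (3 ∣ n) → Σσ n ≡ σ′ n
σ′-coprime n 3∤n = trans (∑-split (fibre pairG n) 3∣? weight)
  (trans (cong (_+ σ′ n) (∑-empty (fibre pairG n ∩ 3∣?) λ
      { (d , δ) (e , 3∣) → 3∤n (subst (3 ∣_) e (∣m⇒∣m*n (suc δ) 3∣)) }))
    (ℤ.+-identityˡ (σ′ n)))

-- Iterating s ↦ 3s + σ(n) gives a geometric sum, doubled here to clear its denominator. The
-- induction also carries the fact that σ′ stays equal to σ(n).
Σσ-power : ∀ b n → ¬ (3 ∣ n) → + 2 * Σσ (3 ^ b ℕ.* n) ≡ (+ (3 ^ suc b) - + 1) * Σσ n
Σσ-power b n 3∤n = proj₁ (go b)
  where
  go : ∀ b → + 2 * Σσ (3 ^ b ℕ.* n) ≡ (+ (3 ^ suc b) - + 1) * Σσ n × σ′ (3 ^ b ℕ.* n) ≡ Σσ n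
  go zero = cong (λ m → + 2 * Σσ m) (ℕ.*-identityˡ n) , trans (cong σ′ (ℕ.*-identityˡ n))
      (sym (σ′-coprime n 3∤n))
  go (suc b) with go b
  ... | p , q = trans (cong (λ m → + 2 * Σσ m) (ℕ.*-assoc 3 (3 ^ b) n))
      (trans (cong (+ 2 *_) (Σσ-triple (3 ^ b ℕ.* n)))
        (trans (lemma (Σσ (3 ^ b ℕ.* n)) (σ′ (3 ^ b ℕ.* n)) (+ (3 ^ suc b)) (Σσ n) p q)
          (cong (λ x → (x - + 1) * Σσ n) (sym (ℤ.pos-* 3 (3 ^ suc b)))))) ,
    trans (cong σ′ (ℕ.*-assoc 3 (3 ^ b) n)) (trans (σ′-triple (3 ^ b ℕ.* n)) q)
    where
    lemma : ∀ s u x t → + 2 * s ≡ (x - + 1) * t → u ≡ t → + 2 * (+ 3 * s + u) ≡ (+ 3 * x - + 1) * t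
    lemma s u x t p q = linear (+ 3 *[ p ] ⊕ (+ 2) *[ q ]) (solve (s ∷ u ∷ x ∷ t ∷ []))

sum-filter-suc : ∀ {R : ℕ → Set} (R? : Decidable R) xs →
  + sum (filter R? (map suc xs)) ≡ sumL (filter (R? ∘ suc) xs) (λ d → + suc d)
sum-filter-suc R? [] = refl
sum-filter-suc R? (x ∷ xs) with R? (suc x)
... | yes _ = cong (ℤ._+_ (+ suc x)) (sum-filter-suc R? xs)
... | no _ = sum-filter-suc R? xs

opaque
  unfolding ∑

  σ-divisors : ∀ n → + σ n ≡ ∑ (range n ∩ (λ d → suc d ∣? n)) (λ d → + suc d)
  σ-divisors n = sum-filter-suc (_∣? n) (upTo n)

σ≡Σσ : ∀ n → + σ (suc n) ≡ Σσ (suc n)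
σ≡Σσ n = trans (σ-divisors (suc n)) (sym (∑-≅ i (fibre pairG (suc n))
    (range (suc n) ∩ (λ d → suc d ∣? suc n)) weight (λ d → + suc d) (λ _ _ → refl)))
  where
  quotient : ∀ d q → suc n ≡ q ℕ.* suc d → q ≡ suc (ℕ.pred (suc n ℕ./ suc d))
  quotient d (suc q) e = sym (cong (suc ∘ ℕ.pred) (trans (cong (ℕ._/ suc d) e) (ℕ.m*n/n≡m (suc q) (suc d))))
  i : (λ ((d , δ) : ℕ × ℕ) → suc d ℕ.* suc δ ≡ suc n) ≅ (λ d → d ℕ.< suc n × suc d ∣ suc n)
  i = record
    { to = proj₁ ; from = λ d → d , ℕ.pred (suc n ℕ./ suc d)
    ; to-⊆ = λ {(d , δ)} e → subst (suc d ℕ.≤_) e (ℕ.m≤m*n (suc d) (suc δ)) ,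
        divides (suc δ) (trans (sym e) (ℕ.*-comm (suc d) (suc δ)))
    ; from-⊆ = λ { {d} (_ , divides q e) → trans (cong (suc d ℕ.*_) (sym (quotient d q e)))
        (trans (ℕ.*-comm (suc d) q) (sym e)) }
    ; from-to = λ {(d , δ)} e → cong (d ,_) (ℕ.suc-injective
        (sym (quotient d (suc δ) (trans (sym e) (ℕ.*-comm (suc d) (suc δ))))))
    ; to-from = λ _ → refl }

-- The representations counted by t(1,2,3,6;n)

Even : ℤ → Set
Even x = x %ℕ 2 ≡ 0

even? : Decidable Even
even? x = x %ℕ 2 ℕ.≟ 0

halves : ∀ x → Even x → x ≡ x /ℕ 2 + x /ℕ 2
halves x e = trans (a≡a%ℕn+[a/ℕn]*n x 2) (trans (cong (λ r → + r + x /ℕ 2 * + 2) e) (lemma (x /ℕ 2)))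
  where
  lemma : ∀ q → + 0 + q * + 2 ≡ q + q
  lemma = solve-∀

odd-halves : ∀ x → ¬ Even x → x ≡ x /ℕ 2 + x /ℕ 2 + + 1
odd-halves x ¬e with x %ℕ 2 in eq | n%ℕd<d x 2
... | zero | _ = ⊥-elim (¬e refl)
... | suc (suc _) | s≤s (s≤s ())
... | suc zero | _ = trans (a≡a%ℕn+[a/ℕn]*n x 2) (trans (cong (λ r → + r + x /ℕ 2 * + 2) eq) (lemma (x /ℕ 2)))
  where
  lemma : ∀ q → + 1 + q * + 2 ≡ q + q + + 1
  lemma = solve-∀

double-halves : ∀ x w → x ≡ w + w → x /ℕ 2 ≡ w × Even x
double-halves x w e = divMod-unique 2 x w 0 (s≤s z≤n) (trans e (lemma w))
  where
  lemma : ∀ w → w + w ≡ + 0 + w * + 2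
  lemma = solve-∀

double-odd-halves : ∀ x w → x ≡ w + w + + 1 → x /ℕ 2 ≡ w × ¬ Even x
double-odd-halves x w e = let q , r = divMod-unique 2 x w 1 (s≤s (s≤s z≤n)) (trans e (lemma w))
  in q , λ r′ → ℕ.1+n≢0 (trans (sym r) r′)
  where
  lemma : ∀ w → w + w + + 1 ≡ + 1 + w * + 2
  lemma = solve-∀

ε-even : ∀ x → Even x → ε x ≡ + 1
ε-even x e = trans (cong ε (halves x e)) (ε-double (x /ℕ 2))

ε-¬even : ∀ x → ¬ Even x → ε x ≡ - + 1
ε-¬even x ¬e = trans (cong ε (odd-halves x ¬e))
  (trans (ε-+ (x /ℕ 2 + x /ℕ 2) (+ 1)) (cong (_* - + 1) (ε-double (x /ℕ 2))))

thetaG : Graded ((ℤ × ℤ) × (ℤ × ℤ))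
thetaG = (scale 2 triG ⊗ scale 6 triG) ⊗ (scale 2 sqG ⊗ scale 6 sqG)

theta-sign : (ℤ × ℤ) × (ℤ × ℤ) → ℤ
theta-sign = ((λ _ → + 1) ∙ (λ _ → + 1)) ∙ (ε ∙ ε)

Θ-gen : Θ ≈ gen thetaG theta-sign
Θ-gen n = trans
  (⊛-cong (gen-⊗ (scale 2 triG) (scale 6 triG) (λ _ → + 1) (λ _ → + 1))
      (gen-⊗ (scale 2 sqG) (scale 6 sqG) ε ε) n)
  (gen-⊗ (scale 2 triG ⊗ scale 6 triG) (scale 2 sqG ⊗ scale 6 sqG) ((λ _ → + 1) ∙ (λ _ → + 1)) (ε ∙ ε) n)

+deg-theta : ∀ x y z w → + deg thetaG ((x , y) , (z , w)) ≡ + 2 *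
    (triZ x + + 3 * triZ y + (z * z + + 3 * (w * w)))
+deg-theta x y z w = trans
  (cong₂ _+_ (cong₂ _+_ (ℤ.pos-* 2 (triN x)) (ℤ.pos-* 6 (triN y)))
             (cong₂ _+_ (trans (ℤ.pos-* 2 (sqN z)) (cong (+ 2 *_) (+sqN z)))
                 (trans (ℤ.pos-* 6 (sqN w)) (cong (+ 6 *_) (+sqN w)))))
  (lemma (triZ x) (triZ y) (z * z) (w * w))
  where
  lemma : ∀ x y z w → + 2 * x + + 6 * y + (+ 2 * z + + 6 * w) ≡ + 2 * (x + + 3 * y + (z + + 3 * w))
  lemma = solve-∀

theta-deg : ∀ k x y z w → deg thetaG ((x , y) , (z , w)) ≡ 2 ℕ.* k → triZ x + + 3 * triZ y +
    (z * z + + 3 * (w * w)) ≡ + k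
theta-deg k x y z w e = ℤ.*-cancelˡ-≡ (+ 2) _ (+ k)
    (trans (sym (+deg-theta x y z w)) (trans (cong +_ e) (ℤ.pos-* 2 k)))

deg-theta : ∀ k x y z w → triZ x + + 3 * triZ y + (z * z + + 3 * (w * w)) ≡ + k → deg thetaG
    ((x , y) , (z , w)) ≡ 2 ℕ.* k
deg-theta k x y z w e = ℤ.+-injective (trans (+deg-theta x y z w) (trans (cong (+ 2 *_) e) (sym (ℤ.pos-* 2 k))))

-- For v = 2w, completing the square gives (u + w)² + 3w². The degree doubles because `thetaG`
-- belongs to theta functions of q² and q⁶.
even-≅ : ∀ k → (λ v → Eisenstein k v × Even (proj₂ (proj₂ (proj₂ v)))) ≅ (λ v → deg thetaG v ≡ 2 ℕ.* k)
even-≅ k = record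
  { to = λ (x , y , u , v) → (x , y) , (u + v /ℕ 2 , v /ℕ 2)
  ; from = λ ((x , y) , (z , w)) → x , y , z - w , w + w
  ; to-⊆ = λ {(x , y , u , v)} (e , even) → deg-theta k x y (u + v /ℕ 2) (v /ℕ 2)
      (trans (cong (ℤ._+_ (triZ x + + 3 * triZ y)) (form u v (v /ℕ 2) (halves v even))) e)
  ; from-⊆ = λ {((x , y) , (z , w))} e →
      trans (cong (ℤ._+_ (triZ x + + 3 * triZ y)) (form′ z w)) (theta-deg k x y z w e) ,
      proj₂ (double-halves (w + w) w refl)
  ; from-to = λ {(x , y , u , v)} (_ , even) → cong₂ (λ u v → x , y , u , v) (cancel u (v /ℕ 2))
      (sym (halves v even))
  ; to-from = λ {((x , y) , (z , w))} _ → let h = proj₁ (double-halves (w + w) w refl) in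
      cong ((x , y) ,_) (cong₂ _,_ (trans (cong (ℤ._+_ (z - w)) h) (cancel′ z w)) h) }
  where
  form : ∀ u v w → v ≡ w + w → (u + w) * (u + w) + + 3 * (w * w) ≡ u * u + u * v + v * v
  form u _ w refl = lemma u w
    where
    lemma : ∀ u w → (u + w) * (u + w) + + 3 * (w * w) ≡ u * u + u * (w + w) + (w + w) * (w + w)
    lemma = solve-∀
  form′ : ∀ z w → (z - w) * (z - w) + (z - w) * (w + w) + (w + w) * (w + w) ≡ z * z + + 3 * (w * w)
  form′ = solve-∀
  cancel : ∀ u w → u + w - w ≡ u
  cancel = solve-∀
  cancel′ : ∀ z w → z - w + w ≡ z
  cancel′ = solve-∀

Rep : ℕ → ℤ⁴ → Set
Rep = IsRep 1 2 3 6

triZ-form : ∀ n x y z w → Rep n (x , y , z , w) → triZ x + + 3 * triZ z +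
    (+ 1 + + 2 * triZ y + + 6 * triZ w) ≡ + suc n
triZ-form n x y z w e = lemma (+ n) (triZ x) (triZ y) (triZ z) (triZ w)
  (trans e (cong₂ _+_ (cong₂ _+_ (cong₂ _+_ (cong (+ 1 *_) (tri≡triZ x)) (cong (+ 2 *_) (tri≡triZ y)))
      (cong (+ 3 *_) (tri≡triZ z))) (cong (+ 6 *_) (tri≡triZ w))))
  where
  lemma : ∀ n x y z w → n ≡ + 1 * x + + 2 * y + + 3 * z + + 6 * w → x + + 3 * z + (+ 1 + + 2 * y + + 6 * w)
      ≡ + 1 + n
  lemma n x y z w e = linear ((- + 1) *[ e ]) (solve (n ∷ x ∷ y ∷ z ∷ w ∷ []))

form-triZ : ∀ n x y z w → triZ x + + 3 * triZ z + (+ 1 + + 2 * triZ y + + 6 * triZ w) ≡ + suc n → Rep n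
    (x , y , z , w)
form-triZ n x y z w e = trans (lemma (+ n) (triZ x) (triZ y) (triZ z) (triZ w) e)
  (sym (cong₂ _+_ (cong₂ _+_ (cong₂ _+_ (cong (+ 1 *_) (tri≡triZ x)) (cong (+ 2 *_) (tri≡triZ y)))
      (cong (+ 3 *_) (tri≡triZ z))) (cong (+ 6 *_) (tri≡triZ w))))
  where
  lemma : ∀ n x y z w → x + + 3 * z + (+ 1 + + 2 * y + + 6 * w) ≡ + 1 + n → n ≡ + 1 * x + + 2 * y + + 3 * z
      + + 6 * w
  lemma n x y z w e = linear ((- + 1) *[ e ]) (solve (n ∷ x ∷ y ∷ z ∷ w ∷ []))

-- The form is ((2u + v)² + 3v²)/4. For v = 2q + 1 both squares are odd, and with z = u + q + 1 and
-- w = q + 1 it becomes 1 + z(z - 1) + 3w(w - 1). The constant 1 explains the passage from n to n +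
-- 1.
odd-≅ : ∀ n → (λ v → Eisenstein (suc n) v × ¬ Even (proj₂ (proj₂ (proj₂ v)))) ≅ Rep n
odd-≅ n = record
  { to = λ (x , y , u , v) → x , u + v /ℕ 2 + + 1 , y , v /ℕ 2 + + 1
  ; from = λ (x , z , y , w) → x , y , z - w , (w - + 1) + (w - + 1) + + 1
  ; to-⊆ = λ {(x , y , u , v)} (e , odd) → let q = v /ℕ 2 in form-triZ n x (u + q + + 1) y (q + + 1)
      (trans (cong (ℤ._+_ (triZ x + + 3 * triZ y))
          (form u v q (triZ (u + q + + 1)) (triZ (q + + 1)) (odd-halves v odd)
        (2*triZ (u + q + + 1)) (2*triZ (q + + 1)))) e)
  ; from-⊆ = λ {(x , z , y , w)} e →
      trans (cong (ℤ._+_ (triZ x + + 3 * triZ y)) (form′ z w (triZ z) (triZ w) (2*triZ z) (2*triZ w)))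
          (triZ-form n x z y w e) ,
      proj₂ (double-odd-halves ((w - + 1) + (w - + 1) + + 1) (w - + 1) refl)
  ; from-to = λ {(x , y , u , v)} (_ , odd) → cong₂ (λ u v → x , y , u , v) (cancel u (v /ℕ 2))
      (trans (cancel₁ (v /ℕ 2)) (sym (odd-halves v odd)))
  ; to-from = λ {(x , z , y , w)} _ → let h = proj₁ (double-odd-halves ((w - + 1) + (w - + 1) + + 1) (w - + 1) refl) in
      cong₂ (λ z w → x , z , y , w) (trans (cong (λ h → z - w + h + + 1) h) (cancel₂ z w))
          (trans (cong (_+ + 1) h) (cancel₃ w)) }
  where
  form : ∀ u v q s t → v ≡ q + q + + 1 → + 2 * s ≡ (u + q + + 1) * (u + q + + 1 - + 1) → + 2 * t ≡ (q + + 1)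
      * (q + + 1 - + 1) →
    + 1 + + 2 * s + + 6 * t ≡ u * u + u * v + v * v
  form u v q s t e₁ e₂ e₃ = linear ((- (u + v + q + q + + 1)) *[ e₁ ] ⊕ + 1 *[ e₂ ] ⊕ + 3 *[ e₃ ])
      (solve (u ∷ v ∷ q ∷ s ∷ t ∷ []))
  form′ : ∀ z w s t → + 2 * s ≡ z * (z - + 1) → + 2 * t ≡ w * (w - + 1) →
    (z - w) * (z - w) + (z - w) * ((w - + 1) + (w - + 1) + + 1) + ((w - + 1) + (w - + 1) + + 1) *
        ((w - + 1) + (w - + 1) + + 1) ≡ + 1 + + 2 * s + + 6 * t
  form′ z w s t e₁ e₂ = linear ((- + 1) *[ e₁ ] ⊕ (- + 3) *[ e₂ ]) (solve (z ∷ w ∷ s ∷ t ∷ []))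
  cancel : ∀ u q → u + q + + 1 - (q + + 1) ≡ u
  cancel = solve-∀
  cancel₁ : ∀ q → (q + + 1 - + 1) + (q + + 1 - + 1) + + 1 ≡ q + q + + 1
  cancel₁ = solve-∀
  cancel₂ : ∀ z w → z - w + (w - + 1) + + 1 ≡ z
  cancel₂ = solve-∀
  cancel₃ : ∀ w → w - + 1 + + 1 ≡ w
  cancel₃ = solve-∀

reps : ∀ n → Enum (Rep n)
reps n = transport (odd-≅ n) (eisenstein (suc n) ∖ λ (_ , _ , _ , v) → even? v)

-- Multiplication by a cube root of unity in the Eisenstein integers: z² + 3 w² with z, w of
-- opposite parity against (Z² + 3 W²)/4 with Z, W odd and congruent modulo 4.
EvenDiff : ℤ⁴ → Set
EvenDiff (_ , y , _ , w) = Even (y - w)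

evenDiff? : Decidable EvenDiff
evenDiff? (_ , y , _ , w) = even? (y - w)

SameParity : (ℤ × ℤ) × (ℤ × ℤ) → Set
SameParity (_ , (z , w)) = Even (z - w)

sameParity? : Decidable SameParity
sameParity? (_ , (z , w)) = even? (z - w)

rotate-≅ : ∀ n → (λ v → Rep n v × EvenDiff v) ≅ (λ v → deg thetaG v ≡ 2 ℕ.* suc n × ¬ SameParity v)
rotate-≅ n = record
  -- With Z = 2z - 1 and W = 2w - 1, the new pair is ((Z + 3W)/4, (Z - W)/4). Its difference is the
  -- odd number W, which gives opposite parity.
  { to = λ (x , z , y , w) → let h = (z - w) /ℕ 2 in (x , y) , (w + w - + 1 + h , h)
  ; from = λ ((x , y) , (z , w)) → let W = (z - w) /ℕ 2 + + 1 in x , W + (w + w) , y , W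
  ; to-⊆ = λ {(x , z , y , w)} (e , even) → let h = (z - w) /ℕ 2 in
      deg-theta (suc n) x y (w + w - + 1 + h) h
        (trans (cong (ℤ._+_ (triZ x + + 3 * triZ y))
            (form z w h (triZ z) (triZ w) (halves (z - w) even) (2*triZ z) (2*triZ w)))
          (triZ-form n x z y w e)) ,
      proj₂ (double-odd-halves (w + w - + 1 + h - h) (w - + 1) (parity w h))
  ; from-⊆ = λ {((x , y) , (z , w))} (e , odd) → let W = (z - w) /ℕ 2 + + 1 in
      form-triZ n x (W + (w + w)) y W
        (trans (cong (ℤ._+_ (triZ x + + 3 * triZ y))
            (form′ z w ((z - w) /ℕ 2) (triZ (W + (w + w))) (triZ W) (odd-halves (z - w) odd)
          (2*triZ (W + (w + w))) (2*triZ W))) (theta-deg (suc n) x y z w e)) ,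
      proj₂ (double-halves (W + (w + w) - W) w (difference W w))
  ; from-to = λ {(x , z , y , w)} (_ , even) → let h = (z - w) /ℕ 2
                                                   q≡ = trans (cong (_+ + 1) (proj₁
                                                       (double-odd-halves (w + w - + 1 + h - h) (w - + 1)
                                                           (parity w h)))) (up w) in
      cong₂ (λ z w → x , z , y , w) (trans (cong (_+ (h + h)) q≡) (recover z w h (halves (z - w) even))) q≡
  ; to-from = λ {((x , y) , (z , w))} (_ , odd) → let W = (z - w) /ℕ 2 + + 1
                                                      q≡ = proj₁ (double-halves (W + (w + w) - W) w
                                                          (difference W w)) in
      cong ((x , y) ,_) (cong₂ _,_ (trans (cong (ℤ._+_ (W + W - + 1)) q≡)
          (recover′ z w ((z - w) /ℕ 2) (odd-halves (z - w) odd))) q≡) }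
  where
  form : ∀ z w h s t → z - w ≡ h + h → + 2 * s ≡ z * (z - + 1) → + 2 * t ≡ w * (w - + 1) →
    (w + w - + 1 + h) * (w + w - + 1 + h) + + 3 * (h * h) ≡ + 1 + + 2 * s + + 6 * t
  form z w h s t e e₁ e₂ = linear ((+ 1 - z - w - h - h) *[ e ] ⊕ (- + 1) *[ e₁ ] ⊕ (- + 3) *[ e₂ ])
      (solve (z ∷ w ∷ h ∷ s ∷ t ∷ []))
  form′ : ∀ z w q s t → z - w ≡ q + q + + 1 → + 2 * s ≡ (q + + 1 + (w + w)) * (q + + 1 + (w + w) - + 1) → +
      2 * t ≡ (q + + 1) * (q + + 1 - + 1) →
    + 1 + + 2 * s + + 6 * t ≡ z * z + + 3 * (w * w)
  form′ z w q s t e e₁ e₂ = linear ((- (z + w + q + q + + 1)) *[ e ] ⊕ + 1 *[ e₁ ] ⊕ + 3 *[ e₂ ])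
      (solve (z ∷ w ∷ q ∷ s ∷ t ∷ []))
  parity : ∀ w h → w + w - + 1 + h - h ≡ (w - + 1) + (w - + 1) + + 1
  parity = solve-∀
  difference : ∀ W w → W + (w + w) - W ≡ w + w
  difference = solve-∀
  up : ∀ w → w - + 1 + + 1 ≡ w
  up = solve-∀
  recover : ∀ z w h → z - w ≡ h + h → w + (h + h) ≡ z
  recover z w h e = linear ((- + 1) *[ e ]) (solve (z ∷ w ∷ h ∷ []))
  recover′ : ∀ z w q → z - w ≡ q + q + + 1 → q + + 1 + (q + + 1) - + 1 + w ≡ z
  recover′ z w q e = linear ((- + 1) *[ e ]) (solve (z ∷ w ∷ q ∷ []))

-- The substitution w ↦ 1 - w preserves w(w - 1)/2 and changes the parity of y - w, so exactly half
-- of the representations have even difference.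
reflect-≅ : ∀ n → (λ v → Rep n v × EvenDiff v) ≅ (λ v → Rep n v × ¬ EvenDiff v)
reflect-≅ n = record
  { to = flip ; from = flip
  ; to-⊆ = λ {(x , y , z , w)} (e , even) → rep x y z w e ,
      proj₂ (double-odd-halves (y - (+ 1 - w)) ((y - w) /ℕ 2 + w - + 1)
          (odd y w ((y - w) /ℕ 2) (halves (y - w) even)))
  ; from-⊆ = λ {(x , y , z , w)} (e , odd) → rep x y z w e ,
      proj₂ (double-halves (y - (+ 1 - w)) ((y - w) /ℕ 2 + w)
          (even y w ((y - w) /ℕ 2) (odd-halves (y - w) odd)))
  ; from-to = λ {(x , y , z , w)} _ → cong (λ w → x , y , z , w) (involutive w)
  ; to-from = λ {(x , y , z , w)} _ → cong (λ w → x , y , z , w) (involutive w) }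
  where
  flip : ℤ⁴ → ℤ⁴
  flip (x , y , z , w) = x , y , z , + 1 - w
  involutive : ∀ w → + 1 - (+ 1 - w) ≡ w
  involutive = solve-∀
  rep : ∀ x y z w → Rep n (x , y , z , w) → Rep n (x , y , z , + 1 - w)
  rep x y z w e = form-triZ n x y z (+ 1 - w) (trans
    (cong (λ t → triZ x + + 3 * triZ z + (+ 1 + + 2 * triZ y + + 6 * t)) (cong +_ (triN-reflect w)))
        (triZ-form n x y z w e))
  odd : ∀ y w h → y - w ≡ h + h → y - (+ 1 - w) ≡ (h + w - + 1) + (h + w - + 1) + + 1
  odd y w h e = linear (+ 1 *[ e ]) (solve (y ∷ w ∷ h ∷ []))
  even : ∀ y w h → y - w ≡ h + h + + 1 → y - (+ 1 - w) ≡ (h + w) + (h + w)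
  even y w h e = linear (+ 1 *[ e ]) (solve (y ∷ w ∷ h ∷ []))

-- Let W₀ and W₁ count the elements of the theta fibre with z, w of equal and of opposite parity. As
-- ε(z) ε(w) = ε(z - w), Θ is W₀ - W₁. Rotation and reflection show that there are 2 W₁
-- representations, so the total W₀ + W₁ + 2 W₁ is (W₀ - W₁) + 2 · 2 W₁.
eisenstein-split : ∀ n → card (eisenstein (suc n)) ≡ Θ (2 ℕ.* suc n) + + 2 * card (reps n)
eisenstein-split n = begin
  card V
    ≡⟨ ∑-split V v-even? (λ _ → + 1) ⟩
  card (V ∩ v-even?) + card (V ∖ v-even?)
    ≡⟨ cong₂ _+_ (∑-≅ (even-≅ (suc n)) (V ∩ v-even?) W (λ _ → + 1) (λ _ → + 1) (λ _ _ → refl))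
                 (∑-≅ (odd-≅ n) (V ∖ v-even?) T (λ _ → + 1) (λ _ → + 1) (λ _ _ → refl)) ⟩
  card W + card T
    ≡⟨ combine (card W) (card (W ∩ sameParity?)) (card (W ∖ sameParity?)) (card T) (card (T ∩ evenDiff?))
        (card (T ∖ evenDiff?))
         (∑-split W sameParity? (λ _ → + 1)) (∑-split T evenDiff? (λ _ → + 1))
         (∑-≅ (rotate-≅ n) (T ∩ evenDiff?) (W ∖ sameParity?) (λ _ → + 1) (λ _ → + 1) (λ _ _ → refl))
         (∑-≅ (reflect-≅ n) (T ∩ evenDiff?) (T ∖ evenDiff?) (λ _ → + 1) (λ _ → + 1) (λ _ _ → refl)) ⟩
  (card (W ∩ sameParity?) + - card (W ∖ sameParity?)) + + 2 * card T
    ≡⟨ cong (_+ + 2 * card T) signed ⟨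
  Θ (2 ℕ.* suc n) + + 2 * card T ∎
  where
  open ≡-Reasoning
  V = eisenstein (suc n)
  T = reps n
  W = fibre thetaG (2 ℕ.* suc n)
  v-even? : Decidable (λ ((_ , _ , _ , v) : ℤ⁴) → Even v)
  v-even? (_ , _ , _ , v) = even? v
  combine : ∀ w w₀ w₁ t t₀ t₁ → w ≡ w₀ + w₁ → t ≡ t₀ + t₁ → t₀ ≡ w₁ → t₀ ≡ t₁ → w + t ≡ (w₀ + - w₁) + + 2 * t
  combine _ w₀ w₁ _ _ _ refl refl refl refl = lemma w₀ w₁
    where
    lemma : ∀ a b → a + b + (b + b) ≡ (a + - b) + + 2 * (b + b)
    lemma = solve-∀
  sign : ∀ z w → ε (z - w) ≡ + 1 * + 1 * (ε z * ε w)
  sign z w = trans (ε-+ z (- w)) (trans (cong (ε z *_) (ε-neg w)) (sym (ℤ.*-identityˡ (ε z * ε w))))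
  signed : Θ (2 ℕ.* suc n) ≡ card (W ∩ sameParity?) + - card (W ∖ sameParity?)
  signed = trans (Θ-gen (2 ℕ.* suc n)) (trans (∑-split W sameParity? theta-sign) (cong₂ _+_
    (∑-cong (W ∩ sameParity?) (λ { (_ , (z , w)) (_ , e) → trans (sym (sign z w)) (ε-even (z - w) e) }))
    (trans (∑-cong (W ∖ sameParity?) (λ { (_ , (z , w)) (_ , ¬e) → trans (sym (sign z w))
        (ε-¬even (z - w) ¬e) }))
      (sym (∑-neg (W ∖ sameParity?) (λ _ → + 1))))))

-- Combining the counts

4a≡Θ : ∀ n → Θ (2 ℕ.* suc n) ≡ + 4 * a (2 ℕ.* n ℕ.+ 3)
4a≡Θ n = go (2 ℕ.* suc n) (2 ℕ.* n ℕ.+ 3) (index n)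
  where
  index : ∀ n → 2 ℕ.* n ℕ.+ 3 ≡ suc (2 ℕ.* suc n)
  index = ℕ-Solver.solve-∀
  go : ∀ m N → N ≡ suc m → Θ m ≡ + 4 * a N
  go m _ refl = Θ≡4P m m ℕ.≤-refl

-- If 3 divides 2n + 3 then n = 3j and M = 2j + 1. The choice j = n + 1 - M avoids a division, and M
-- ≤ n + 1 makes the truncated subtraction exact.
third : ∀ n M → 2 ℕ.* n ℕ.+ 3 ≡ 3 ℕ.* M → ∃ λ j → suc n ≡ suc (3 ℕ.* j) × M ≡ suc (2 ℕ.* j)
third n M e = suc n ℕ.∸ M , ℤ.+-injective (trans (index₁ (+ n) (+ M) (+ j) e₁ e₂)
    (cong (ℤ._+_ (+ 1)) (sym (ℤ.pos-* 3 j)))) ,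
  ℤ.+-injective (trans (index₂ (+ n) (+ M) (+ j) e₁ e₂) (cong (ℤ._+_ (+ 1)) (sym (ℤ.pos-* 2 j))))
  where
  j = suc n ℕ.∸ M
  M≤1+n : M ℕ.≤ suc n
  M≤1+n = ℕ.≮⇒≥ λ n<M → ℕ.<-irrefl e (begin-strict
    2 ℕ.* n ℕ.+ 3          <⟨ ℕ.m<m+n (2 ℕ.* n ℕ.+ 3) (s≤s z≤n) ⟩
    2 ℕ.* n ℕ.+ 3 ℕ.+ 3    ≤⟨ ℕ.m≤m+n _ n ⟩
    2 ℕ.* n ℕ.+ 3 ℕ.+ 3 ℕ.+ n  ≡⟨ lemma n ⟩
    3 ℕ.* suc (suc n)      ≤⟨ ℕ.*-monoʳ-≤ 3 n<M ⟩
    3 ℕ.* M                ∎)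
    where
    open ℕ.≤-Reasoning
    lemma : ∀ n → 2 ℕ.* n ℕ.+ 3 ℕ.+ 3 ℕ.+ n ≡ 3 ℕ.* suc (suc n)
    lemma = ℕ-Solver.solve-∀
  e₁ : + 2 * + n + + 3 ≡ + 3 * + M
  e₁ = trans (cong (_+ + 3) (sym (ℤ.pos-* 2 n))) (trans (cong +_ e) (ℤ.pos-* 3 M))
  e₂ : + M + + j ≡ + 1 + + n
  e₂ = cong +_ (ℕ.m+[n∸m]≡n M≤1+n)
  index₁ : ∀ n M j → + 2 * n + + 3 ≡ + 3 * M → M + j ≡ + 1 + n → + 1 + n ≡ + 1 + + 3 * j
  index₁ n M j e₁ e₂ = linear ((- + 1) *[ e₁ ] ⊕ (- + 3) *[ e₂ ]) (solve (n ∷ M ∷ j ∷ []))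
  index₂ : ∀ n M j → + 2 * n + + 3 ≡ + 3 * M → M + j ≡ + 1 + n → M ≡ + 1 + + 2 * j
  index₂ n M j e₁ e₂ = linear ((- + 1) *[ e₁ ] ⊕ (- + 2) *[ e₂ ]) (solve (n ∷ M ∷ j ∷ []))

F-at-triple : ∀ n → F (suc (3 ℕ.* suc n)) ≡ Σσ (3 ℕ.* (2 ℕ.* n ℕ.+ 3))
F-at-triple n = cong Σσ (index n)
  where
  index : ∀ n → suc (2 ℕ.* suc (3 ℕ.* suc n)) ≡ 3 ℕ.* (2 ℕ.* n ℕ.+ 3)
  index = ℕ-Solver.solve-∀

-- Eliminating the Eisenstein count leaves 64 T = 32 f + 30 C - 128 a(2n + 3), where T is the number
-- of representations, f = σ(3(2n + 3)) and C = `classCount 2 (suc n)`. Here 2f = (3^(β+2) - 1)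
-- σ(n₁) and C = 8 (3^β - 1) σ(n₁), so 32 f + 30 C = 128 (3^(β+1) - 2) σ(n₁). The cases are separate
-- because C is 16 σ((2n + 3)/3) for β > 0, whereas for β = 0 it vanishes by a congruence.
reps-count : ∀ n β n₁ → 2 ℕ.* n ℕ.+ 3 ≡ 3 ^ β ℕ.* n₁ → ¬ (3 ∣ n₁) →
  card (reps n) ≡ + 2 * (+ (3 ^ suc β) - + 2) * Σσ n₁ - + 2 * a (2 ℕ.* n ℕ.+ 3)
reps-count n zero n₁ e 3∤ = ℤ.*-cancelˡ-≡ (+ 64) _ _
  (combine (card (eisenstein (suc n))) (Θ (2 ℕ.* suc n)) (card (reps n)) (a (2 ℕ.* n ℕ.+ 3))
      (F (suc (3 ℕ.* suc n))) (classCount 2 (suc n)) (Σσ n₁)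
    (eisenstein-split n) (4a≡Θ n) (eisenstein-count (suc n))
    (trans (cong (+ 2 *_) (trans (F-at-triple n) (cong Σσ 3N))) (Σσ-power 1 n₁ 3∤))
    (classCount-2-zero (suc n) no-third))
  where
  N≡n₁ : 2 ℕ.* n ℕ.+ 3 ≡ n₁
  N≡n₁ = trans e (ℕ.*-identityˡ n₁)
  3N : 3 ℕ.* (2 ℕ.* n ℕ.+ 3) ≡ 3 ^ 1 ℕ.* n₁
  3N = cong (3 ℕ.*_) N≡n₁
  no-third : ∀ j → suc n ≢ suc (3 ℕ.* j)
  no-third j refl = 3∤ (divides (suc (2 ℕ.* j)) (trans (sym N≡n₁) (lemma j)))
    where
    lemma : ∀ j → 2 ℕ.* (3 ℕ.* j) ℕ.+ 3 ≡ suc (2 ℕ.* j) ℕ.* 3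
    lemma = ℕ-Solver.solve-∀
  combine : ∀ V θ T α f C s → V ≡ θ + + 2 * T → θ ≡ + 4 * α → + 16 * V ≡ + 16 * f + + 15 * C → + 2 * f ≡
      (+ 9 - + 1) * s → C ≡ + 0 →
    + 64 * T ≡ + 64 * (+ 2 * (+ 3 - + 2) * s - + 2 * α)
  combine V θ T α f C s e₁ e₂ e₃ e₄ e₅ = linear
      ((- + 32) *[ e₁ ] ⊕ (- + 32) *[ e₂ ] ⊕ (+ 2) *[ e₃ ] ⊕ (+ 16) *[ e₄ ] ⊕ (+ 30) *[ e₅ ])
    (solve (V ∷ θ ∷ T ∷ α ∷ f ∷ C ∷ s ∷ []))
reps-count n (suc b) n₁ e 3∤ = ℤ.*-cancelˡ-≡ (+ 64) _ _
  (combine (card (eisenstein (suc n))) (Θ (2 ℕ.* suc n)) (card (reps n)) (a (2 ℕ.* n ℕ.+ 3))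
      (F (suc (3 ℕ.* suc n))) (classCount 2 (suc n)) (Σσ n₁)
    (F j) (+ (3 ^ suc b)) (+ (3 ^ suc (suc b))) (+ (3 ^ suc (suc (suc b))))
    (eisenstein-split n) (4a≡Θ n) (eisenstein-count (suc n))
    (trans (cong (+ 2 *_) (trans (F-at-triple n) (cong Σσ 3N))) (Σσ-power (suc (suc b)) n₁ 3∤))
    (classCount-2 j (suc n) n≡)
    (trans (cong (λ M → + 2 * Σσ M) (sym M≡)) (Σσ-power b n₁ 3∤))
    (ℤ.pos-* 3 (3 ^ suc b)) (ℤ.pos-* 3 (3 ^ suc (suc b))))
  where
  M = 3 ^ b ℕ.* n₁
  split = third n M (trans e (ℕ.*-assoc 3 (3 ^ b) n₁))
  j = proj₁ split
  n≡ = proj₁ (proj₂ split)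
  M≡ = proj₂ (proj₂ split)
  3N : 3 ℕ.* (2 ℕ.* n ℕ.+ 3) ≡ 3 ^ suc (suc b) ℕ.* n₁
  3N = trans (cong (3 ℕ.*_) e) (sym (ℕ.*-assoc 3 (3 ^ suc b) n₁))
  combine : ∀ V θ T α f C s g x₁ x₂ x₃ → V ≡ θ + + 2 * T → θ ≡ + 4 * α → + 16 * V ≡ + 16 * f + + 15 * C →
    + 2 * f ≡ (x₃ - + 1) * s → C ≡ + 16 * g → + 2 * g ≡ (x₁ - + 1) * s → x₂ ≡ + 3 * x₁ → x₃ ≡ + 3 * x₂ →
    + 64 * T ≡ + 64 * (+ 2 * (x₂ - + 2) * s - + 2 * α)
  combine V θ T α f C s g x₁ x₂ x₃ e₁ e₂ e₃ e₄ e₅ e₆ e₇ e₈ =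
    linear ((- + 32) *[ e₁ ] ⊕ (- + 32) *[ e₂ ] ⊕ (+ 2) *[ e₃ ] ⊕ (+ 16) *[ e₄ ] ⊕ (+ 30) *[ e₅ ] ⊕ (+ 240)
        *[ e₆ ]
      ⊕ (- + 80 * s) *[ e₇ ] ⊕ (+ 16 * s) *[ e₈ ])
    (solve (V ∷ θ ∷ T ∷ α ∷ f ∷ C ∷ s ∷ g ∷ x₁ ∷ x₂ ∷ x₃ ∷ []))

theorem3p3 : (n : ℕ) → 1 Data.Nat.≤ n → (β n₁ : ℕ) → 1 Data.Nat.≤ n₁ →
    2 Data.Nat.* n Data.Nat.+ 3 ≡ 3 ^ β Data.Nat.* n₁ → ¬ (3 ∣ n₁) →
    Σ[ k ∈ ℕ ] (tIs 1 2 3 6 n k ×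
    + k ≡ + 2 * (+ (3 ^ (suc β)) - + 2) * + σ n₁ - + 2 * a (2 Data.Nat.* n Data.Nat.+ 3))
theorem3p3 n _ β n₁@(suc m) _ e 3∤n₁ = length (list T) ,
  (list T , unique T , (λ v → mk⇔ (sound T) (complete T)) , refl) ,
  trans (card-length T) (trans (reps-count n β n₁ e 3∤n₁)
    (cong (λ s → + 2 * (+ (3 ^ suc β) - + 2) * s - + 2 * a (2 ℕ.* n ℕ.+ 3)) (sym (σ≡Σσ m))))
  where T = reps n
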